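{- (1) Let $d_n'$ denote the expected value of $d_H(\pi,\rho)$ when $\pi,\rho$ are two independent uniformly random elements of $\mathrm{NC}(n)$, i.e. $d_n'=\frac{1}{\mathrm{Cat}_n^2}\sum_{\pi,\rho\in\mathrm{NC}(n)}d_H(\pi,\rho)$. Then for any $\varepsilon>0$ and all large enough $n$, $$(0.5-\varepsilon)\,n\le d_n'\le 0.83\,n.$$ (2) Let $c_n'$ denote the expected number of components of a uniformly random meandric system of order $n$. Then for any $\varepsilon>0$ and all large enough $n$, $$0.17\,n\le c_n'\le(0.5+\varepsilon)\,n.$$
   Context: For a positive integer $n$, a partition $\pi$ of $\{1,\ldots,n\}$ is non-crossing if there are no two distinct blocks $V,W$ of $\pi$ and numbers $a<b<c<d$ with $a,c\in V$ and $b,d\in W$. $\mathrm{NC}(n)$ is the set of non-crossing partitions of $\{1,\ldots,n\}$, partially ordered by $\pi\le\rho$ iff every block of $\pi$ is contained in a block of $\rho$; $|\mathrm{NC}(n)|=\mathrm{Cat}_n=\frac{(2n)!}{n!(n+1)!}$. The Hasse diagram $\mathcal{H}_n$ is the undirected graph with vertex set $\mathrm{NC}(n)$ in which $\pi_1,\pi_2$ are joined by an edge iff one of them covers the other; $d_H$ is the graph distance in $\mathcal{H}_n$. Meandric systems: fix an oriented line $L$ in the plane $\mathbb{R}^2$ with $2n$ marked points $p_1,\ldots,p_{2n}$ in order. A (closed) meandric system of order $n$ is an equivalence class of non-self-intersecting, not necessarily connected, closed curves $C\subseteq\mathbb{R}^2$ intersecting $L$ transversely at precisely $p_1,\ldots,p_{2n}$,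 where two curves are equivalent if they can be deformed into each other by an isotopy of the plane fixing $L$ pointwise. The number of components of the system is the number of connected components of $C$. Equivalently, a meandric system of order $n$ is an ordered pair of non-crossing perfect matchings of $\{p_1,\ldots,p_{2n}\}$ (one drawn by arcs above $L$, the other below $L$), and its components are the closed curves formed by the union of the arcs of the two matchings; hence there are $\mathrm{Cat}_n^2$ meandric systems of order $n$. -}

module Defs where

open import Data.Bool.Properties using () renaming (_≟_ to _≟ᵇ_)
open import Data.Fin using (Fin; _<_)
open import Data.Fin.Properties using (all?; any?; _<?_; _≟_)
open import Data.Fin.Subset using (Subset; inside; outside; _∈_; _⊆_; ∣_∣)
open import Data.Fin.Subset.Properties using (_∈?_; _⊆?_)
open import Data.Integer using (+_)
open import Data.List using (List; []; _∷_; map; length; filter; upTo; allFin;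
  deduplicate; cartesianProduct; cartesianProductWith)
open import Data.List.Relation.Unary.Any as Any using (Any)
open import Data.Nat using (ℕ; zero; suc; _*_)
open import Data.Nat.ListAction using (sum)
import Data.Nat.Properties as ℕ
open import Data.Product using (_×_; _,_; ∃; uncurry)
open import Data.Rational using (ℚ; 0ℚ; _/_)
open import Data.Sum using (_⊎_)
open import Data.Vec using (Vec; lookup) renaming ([] to []ᵛ; _∷_ to _∷ᵛ_)
open import Data.Vec.Properties using (≡-dec)
open import Relation.Binary using (Rel; Decidable; DecidableEquality)
open import Relation.Binary.PropositionalEquality using (_≡_; _≢_)
open import Relation.Nullary using (¬_; yes; no)
open import Relation.Nullary.Decidable using (_×-dec_; _⊎-dec_; _→-dec_; ¬?)
import Relation.Unary as U
open import Level using (0ℓ)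

-- The value 0 on the empty list is a convention only.
mean : {A : Set} → (A → ℕ) → List A → ℚ
mean f []           = 0ℚ
mean f xs@(_ ∷ _) = + sum (map f xs) / length xs

vectors : {A : Set} → List A → (n : ℕ) → List (Vec A n)
vectors xs zero    = []ᵛ ∷ []
vectors xs (suc n) = cartesianProductWith _∷ᵛ_ xs (vectors xs n)

subsets : (n : ℕ) → List (Subset n)
subsets = vectors (outside ∷ inside ∷ [])

-- The least k < b with P k, or b if there is none.
leastBelow : {P : ℕ → Set} → U.Decidable P → ℕ → ℕ
leastBelow P? zero    = zero
leastBelow P? (suc b) with P? zero
... | yes _ = zero
... | no  _ = suc (leastBelow (λ k → P? (suc k)) b)

------------------------------------------------------------------------
-- Finite graphs

-- The vertex set consists of the entries of the list `vertices`.
module FiniteGraph {V : Set} (_≟_ : DecidableEquality V) (vertices : List V)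
                   {_~_ : Rel V 0ℓ} (_~?_ : Decidable _~_) where

  Walk : ℕ → Rel V 0ℓ
  Walk zero    u v = u ≡ v
  Walk (suc k) u v = Any (λ w → u ~ w × Walk k w v) vertices

  walk? : ∀ k → Decidable (Walk k)
  walk? zero    u v = u ≟ v
  walk? (suc k) u v = Any.any? (λ w → (u ~? w) ×-dec walk? k w v) vertices

  -- A shortest walk repeats no vertex, so only lengths below the number of
  -- vertices need to be searched, here and in `dist`.
  Connected : Rel V 0ℓ
  Connected u v = Any (λ k → Walk k u v) (upTo (length vertices))

  connected? : Decidable Connected
  connected? u v = Any.any? (λ k → walk? k u v) (upTo (length vertices))

  -- Length of a shortest walk.  For u, v in different components, where the
  -- distance would be infinite, the value is the number of vertices.
  dist : V → V → ℕ
  dist u v = leastBelow (λ k → walk? k u v) (length vertices)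

  -- Keeps the first listed vertex of each connected component.
  #components : ℕ
  #components = length (deduplicate connected? vertices)

------------------------------------------------------------------------
-- Non-crossing partitions

-- A partition π of Fin n is stored as the family of subsets whose i-th entry
-- is the block containing i.  This determines π and is determined by it, so
-- propositional equality of vectors is equality of partitions.
Blocks : ℕ → Set
Blocks n = Vec (Subset n) n

module _ {n : ℕ} where

  block : Blocks n → Fin n → Subset n
  block = lookup

  _≟ˢ_ : DecidableEquality (Subset n)
  _≟ˢ_ = ≡-dec _≟ᵇ_

  _≟ᴮ_ : DecidableEquality (Blocks n)
  _≟ᴮ_ = ≡-dec _≟ˢ_

  IsPartition : Blocks n → Set
  IsPartition π =
    (∀ i → i ∈ block π i) ×
    (∀ i j → j ∈ block π i → block π j ≡ block π i)

  isPartition? : U.Decidable IsPartition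
  isPartition? π =
    all? (λ i → i ∈? block π i) ×-dec
    all? (λ i → all? λ j → (j ∈? block π i) →-dec (block π j ≟ˢ block π i))

  Crossing : Rel (Subset n) 0ℓ
  Crossing V W = ∃ λ a → ∃ λ b → ∃ λ c → ∃ λ d →
    a < b × b < c × c < d × (a ∈ V × c ∈ V) × (b ∈ W × d ∈ W)

  crossing? : Decidable Crossing
  crossing? V W = any? λ a → any? λ b → any? λ c → any? λ d →
    (a <? b) ×-dec (b <? c) ×-dec (c <? d) ×-dec
    ((a ∈? V) ×-dec (c ∈? V)) ×-dec ((b ∈? W) ×-dec (d ∈? W))

  NonCrossing : Blocks n → Set
  NonCrossing π = ∀ i j → block π i ≢ block π j → ¬ Crossing (block π i) (block π j)

  nonCrossing? : U.Decidable NonCrossing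
  nonCrossing? π = all? λ i → all? λ j →
    ¬? (block π i ≟ˢ block π j) →-dec ¬? (crossing? (block π i) (block π j))

  _⊑_ : Rel (Blocks n) 0ℓ
  π ⊑ ρ = ∀ i → ∃ λ j → block π i ⊆ block ρ j

  _⊑?_ : Decidable _⊑_
  π ⊑? ρ = all? λ i → any? λ j → block π i ⊆? block ρ j

  _⊏_ : Rel (Blocks n) 0ℓ
  π ⊏ ρ = π ⊑ ρ × π ≢ ρ

  _⊏?_ : Decidable _⊏_
  π ⊏? ρ = (π ⊑? ρ) ×-dec ¬? (π ≟ᴮ ρ)

NC : (n : ℕ) → List (Blocks n)
NC n = filter (λ π → isPartition? π ×-dec nonCrossing? π) (vectors (subsets n) n)

------------------------------------------------------------------------
-- The Hasse diagram of NC n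

module _ {n : ℕ} where

  _⋖_ : Rel (Blocks n) 0ℓ
  π ⋖ ρ = π ⊏ ρ × ¬ Any (λ σ → π ⊏ σ × σ ⊏ ρ) (NC n)

  _⋖?_ : Decidable _⋖_
  π ⋖? ρ = (π ⊏? ρ) ×-dec ¬? (Any.any? (λ σ → (π ⊏? σ) ×-dec (σ ⊏? ρ)) (NC n))

  HasseEdge : Rel (Blocks n) 0ℓ
  HasseEdge π ρ = π ⋖ ρ ⊎ ρ ⋖ π

  hasseEdge? : Decidable HasseEdge
  hasseEdge? π ρ = (π ⋖? ρ) ⊎-dec (ρ ⋖? π)

  d-H : Blocks n → Blocks n → ℕ
  d-H = FiniteGraph.dist _≟ᴮ_ (NC n) hasseEdge?

d′ : ℕ → ℚ
d′ n = mean (uncurry d-H) (cartesianProduct (NC n) (NC n))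

------------------------------------------------------------------------
-- Meandric systems

IsMatching : {m : ℕ} → Blocks m → Set
IsMatching π = ∀ i → ∣ block π i ∣ ≡ 2

isMatching? : {m : ℕ} → U.Decidable (IsMatching {m})
isMatching? π = all? λ i → ∣ block π i ∣ ℕ.≟ 2

NCMatchings : (m : ℕ) → List (Blocks m)
NCMatchings m = filter isMatching? (NC m)

-- A meandric system of order n, up to isotopy, is a pair of non-crossing
-- perfect matchings of its 2n points on the line: the arcs above and the arcs
-- below.
MeandricSystem : ℕ → Set
MeandricSystem n = Blocks (2 * n) × Blocks (2 * n)

meandricSystems : (n : ℕ) → List (MeandricSystem n)
meandricSystems n = cartesianProduct (NCMatchings (2 * n)) (NCMatchings (2 * n))

module _ (n : ℕ) where

  -- i and j are the endpoints of an arc of the system (or i ≡ j, which has no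
  -- effect on the components).
  Arc : MeandricSystem n → Rel (Fin (2 * n)) 0ℓ
  Arc (upper , lower) i j = j ∈ block upper i ⊎ j ∈ block lower i

  arc? : (M : MeandricSystem n) → Decidable (Arc M)
  arc? (upper , lower) i j = (j ∈? block upper i) ⊎-dec (j ∈? block lower i)

  -- Every closed curve of the system meets the line, so the curves correspond
  -- to the classes of marked points joined by sequences of arcs.
  #curves : MeandricSystem n → ℕ
  #curves M = FiniteGraph.#components _≟_ (allFin (2 * n)) (arc? M)

c′ : ℕ → ℚ
c′ n = mean (#curves n) (meandricSystems n)

{-# OPTIONS --safe #-}

-- A Dyck word w of length 2n encodes a non-crossing partition ⟨ w ⟩ of n points (the cuts
-- at odd positions, two of them being equivalent if the factor between them is balanced)
-- and a non-crossing matching ⟪ w ⟫ of 2n points.  Write # for the number of blocks, ∨ for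
-- the join of set partitions and ∩ for their meet.
--
-- The number of components of unions of edge sets is submodular, so # π + # ρ - 2 # (π ∨ ρ)
-- is a metric; it is at most the Hasse distance because a cover in NC(n) unites two blocks.
-- The rotation x U y D of U x D y permutes the Dyck words; a word and its rotation have a
-- partition join, and a matching join, with a single block, and their partitions have n + 1
-- blocks in total.  Hence the distances from a third partition to the two add up to at
-- least n - 1, and the numbers of curves with a third matching to at most n + 1.  Averaging
-- gives d′ n ≥ (n - 1) / 2 and c′ n ≤ (n + 1) / 2.
--
-- For the other two bounds, walking through the meet bounds the distance of π and ρ by
-- 2 # (π ∩ ρ) - # π - # ρ, and n - # (π ∩ ρ) counts the odd cuts at which a nonempty common
-- balanced factor of the two words starts; on the side of matchings, every position at
-- which such a factor starts is the least point of a curve.  A common factor of length 2k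
-- starts at a given cut for C_k² C_{n-k}² ≥ 16^{-k} C_k² C_n² pairs of words, and cutting off
-- the shortest common factor (a renewal argument) shows that some factor of length at most
-- 2K starts there with probability at least 1 - 1 / Σ_{k ≤ K} C_k² 16^{-k}, which exceeds
-- 0.085 for K = 64.
module Submission where

open import Defs
open import Data.Bool using (Bool; true; false; _∧_; _∨_; not; if_then_else_)
open import Data.Product using (_×_; _,_; ∃; uncurry; proj₂; ∃₂; proj₁; map₁; ∃-syntax)
open import Data.Sum using (inj₁; inj₂; _⊎_; swap)
open import Function using (_∘_; _⇔_; Equivalence; mk⇔)
open import Level using (0ℓ)
open import Relation.Binary using (Rel; IsEquivalence; Decidable; DecidableEquality; Symmetric;
  tri<; tri≈; tri>)
open import Relation.Binary.PropositionalEquality using (_≡_; _≢_; refl; sym; trans; cong; cong₂;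
  subst; subst₂; module ≡-Reasoning)
open import Relation.Nullary using (Dec; yes; no; does; contradiction; ¬_)
open import Relation.Nullary.Decidable using (dec-false; dec-true; ¬?; _×-dec_; _⊎-dec_; _→-dec_;
  map′)

-- The lattice NC(n) is not semimodular: in NC(4) the partitions whose only nontrivial block is 1, 3
-- resp. 2, 4 are atoms, but their join has rank 3. So the distance in the Hasse diagram is not a
-- formula in the ranks of meets and joins taken inside NC(n). The lower bound therefore takes joins
-- in the lattice of all set partitions, which is semimodular. There the blocks of a join are the
-- classes generated by a union of edge lists, and the same count gives the number of curves of a
-- meandric system, so one submodularity lemma serves both. Meets of non-crossing partitions are
-- non-crossing, hence the same in both lattices.
--
-- The events that a common factor of length 2k starts at a given cut overlap for different k, so
-- bounds for their probabilities cannot be added. The events that the shortest common factor has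
-- length 2k are disjoint; the renewal inequality bounds their total from below although their
-- individual probabilities have no convenient closed form. The factor 16^(-k) comes from C_{d+1} ≤
-- 4 C_d, applied to both words.

-- Finite sums and counting.

module Sums where

  open import Data.Bool.Properties using (∧-identityʳ)
  open import Data.Fin using (Fin; zero; suc; toℕ)
  open import Data.Fin.Properties using (_≟_; suc-injective)
  open import Data.List using (List; []; _∷_; _++_; map; length; cartesianProduct)
  open import Data.List.Membership.Propositional using (_∈_)
  open import Data.List.Membership.Propositional.Properties using (∈-∃++; ∈-++⁻; ∈-++⁺ˡ; ∈-++⁺ʳ)
  open import Data.List.Properties using (map-++; map-∘; length-++)
  open import Data.List.Relation.Binary.Permutation.Propositional using (_↭_; ↭-refl; ↭-trans;
    prep)
  open import Data.List.Relation.Binary.Permutation.Propositional.Properties using (shift; map⁺;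
    ↭-length)
  import Data.List.Relation.Unary.All as All
  import Data.List.Relation.Unary.All.Properties as All
  open import Data.List.Relation.Unary.Any using (here; there)
  open import Data.List.Relation.Unary.AllPairs using ([]; _∷_)
  open import Data.List.Relation.Unary.Unique.Propositional using (Unique)
  open import Data.Nat using (ℕ; zero; suc; _+_; _*_; _≤_; _<_; z≤n; s≤s)
  open import Data.Nat.ListAction using (sum)
  open import Data.Nat.ListAction.Properties using (sum-↭; sum-++)
  open import Data.Nat.Properties using (≤-refl; ≤-trans; ≤-reflexive; ≤-antisym; +-suc; +-mono-≤;
    m≤m+n; +-identityʳ; *-zeroʳ; *-distribˡ-+; +-cancelˡ-≡)
  open import Data.Nat.Solver using (module +-*-Solver)

  does⁻ : {P : Set} (P? : Dec P) → does P? ≡ true → P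
  does⁻ (yes p) _ = p

  ⟦_⟧ : Bool → ℕ
  ⟦ true  ⟧ = 1
  ⟦ false ⟧ = 0

  ⟦⟧-mono : ∀ {a b} → (a ≡ true → b ≡ true) → ⟦ a ⟧ ≤ ⟦ b ⟧
  ⟦⟧-mono {false}         _ = z≤n
  ⟦⟧-mono {true}  {true}  _ = ≤-refl
  ⟦⟧-mono {true}  {false} h = contradiction (h refl) λ ()

  ⟦⟧-∨ : ∀ a b → ⟦ a ∨ b ⟧ ≡ ⟦ a ⟧ + ⟦ not a ∧ b ⟧
  ⟦⟧-∨ true  b = refl
  ⟦⟧-∨ false b = refl

  ∑ : {A : Set} → List A → (A → ℕ) → ℕ
  ∑ xs f = sum (map f xs)

  module _ {A : Set} where

    ∑-mono : (xs : List A) {f g : A → ℕ} → (∀ x → x ∈ xs → f x ≤ g x) → ∑ xs f ≤ ∑ xs g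
    ∑-mono []       h = z≤n
    ∑-mono (x ∷ xs) h = +-mono-≤ (h x (here refl)) (∑-mono xs λ y → h y ∘ there)

    ∑-cong : (xs : List A) {f g : A → ℕ} → (∀ x → x ∈ xs → f x ≡ g x) → ∑ xs f ≡ ∑ xs g
    ∑-cong []       h = refl
    ∑-cong (x ∷ xs) h = cong₂ _+_ (h x (here refl)) (∑-cong xs λ y → h y ∘ there)

    ∑-+ : (xs : List A) (f g : A → ℕ) → ∑ xs (λ x → f x + g x) ≡ ∑ xs f + ∑ xs g
    ∑-+ []       f g = refl
    ∑-+ (x ∷ xs) f g = trans (cong (f x + g x +_) (∑-+ xs f g))
      (solve 4 (λ a b c d → a :+ b :+ (c :+ d) := a :+ c :+ (b :+ d)) refl (f x) (g x) _ _)
      where open +-*-Solver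

    ∑-const : (xs : List A) (c : ℕ) → ∑ xs (λ _ → c) ≡ length xs * c
    ∑-const []       c = refl
    ∑-const (x ∷ xs) c = cong (c +_) (∑-const xs c)

    ∑-* : (xs : List A) (c : ℕ) (f : A → ℕ) → ∑ xs (λ x → c * f x) ≡ c * ∑ xs f
    ∑-* []       c f = sym (*-zeroʳ c)
    ∑-* (x ∷ xs) c f = trans (cong (c * f x +_) (∑-* xs c f)) (sym (*-distribˡ-+ c _ _))

    ∑-++ : (xs ys : List A) (f : A → ℕ) → ∑ (xs ++ ys) f ≡ ∑ xs f + ∑ ys f
    ∑-++ xs ys f = trans (cong sum (map-++ f xs ys)) (sum-++ (map f xs) (map f ys))

    ∑-map : {B : Set} (g : A → B) (xs : List A) (f : B → ℕ) → ∑ (map g xs) f ≡ ∑ xs (f ∘ g)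
    ∑-map g xs f = cong sum (sym (map-∘ xs))

    map-unique : {B : Set} (f : A → B) {xs : List A} → (∀ {x y} → x ∈ xs → y ∈ xs → f x ≡ f y → x ≡ y) →
                 Unique xs → Unique (map f xs)
    map-unique f inj []       = []
    map-unique f inj (x∉ ∷ u) =
      All.map⁺ (All.tabulate λ y∈ e → All.lookup x∉ y∈ (inj (here refl) (there y∈) e)) ∷
      map-unique f (λ x∈ y∈ → inj (there x∈) (there y∈)) u

    -- Sums and lengths are compared by completing xs to a permutation of ys: each element of xs is
    -- extracted from ys, and absence of duplicates keeps the rest of xs inside what remains.
    unique-⊆-↭ : {xs ys : List A} → Unique xs → (∀ {x} → x ∈ xs → x ∈ ys) →
                 ∃ λ zs → ys ↭ xs ++ zs
    unique-⊆-↭ {[]}     {ys} _ _ = ys , ↭-refl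
    unique-⊆-↭ {x ∷ xs} {ys} (x∉ ∷ u) sub with ∈-∃++ (sub (here refl))
    ... | us , vs , refl with unique-⊆-↭ {xs} {us ++ vs} u sub′
      where
      sub′ : ∀ {y} → y ∈ xs → y ∈ us ++ vs
      sub′ y∈ with ∈-++⁻ us (sub (there y∈))
      ... | inj₁ y∈us             = ∈-++⁺ˡ y∈us
      ... | inj₂ (here refl)      = contradiction y∈ (All.All¬⇒¬Any x∉)
      ... | inj₂ (there y∈vs)     = ∈-++⁺ʳ us y∈vs
    ... | zs , p = zs , ↭-trans (shift x us vs) (prep x p)

    ∑-⊆ : {xs ys : List A} → Unique xs → (∀ {x} → x ∈ xs → x ∈ ys) →
          (f : A → ℕ) → ∑ xs f ≤ ∑ ys f
    ∑-⊆ {xs} {ys} u sub f with unique-⊆-↭ u sub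
    ... | zs , p = subst (∑ xs f ≤_) (sym (trans (sum-↭ (map⁺ f p)) (∑-++ xs zs f))) (m≤m+n _ _)

    length-⊆ : {xs ys : List A} → Unique xs → (∀ {x} → x ∈ xs → x ∈ ys) → length xs ≤ length ys
    length-⊆ {xs} {ys} u sub with unique-⊆-↭ u sub
    ... | zs , p = subst (length xs ≤_) (sym (trans (↭-length p) (length-++ xs))) (m≤m+n _ _)

    -- With equal lengths the completing list is empty. Hence an injective self-map of a finite set
    -- permutes it, and the rotation of words can be used without constructing its inverse.
    ∑-⊆-length : {xs ys : List A} → Unique xs → (∀ {x} → x ∈ xs → x ∈ ys) →
                 length xs ≡ length ys → (f : A → ℕ) → ∑ xs f ≡ ∑ ys f
    ∑-⊆-length {xs} {ys} u sub l f with unique-⊆-↭ u sub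
    ... | [] , p = sym (trans (sum-↭ (map⁺ f p)) (trans (∑-++ xs [] f) (+-identityʳ _)))
    ... | z ∷ zs , p with +-cancelˡ-≡ (length xs) 0 _ (trans (+-identityʳ _) (trans l (trans (↭-length p) (length-++ xs))))
    ...   | ()

    ∑-set : {xs ys : List A} → Unique xs → Unique ys →
            (∀ {x} → x ∈ xs → x ∈ ys) → (∀ {x} → x ∈ ys → x ∈ xs) →
            (f : A → ℕ) → ∑ xs f ≡ ∑ ys f
    ∑-set u v s t f = ≤-antisym (∑-⊆ u s f) (∑-⊆ v t f)

  module _ {A B : Set} where

    ∑-cartesian : (xs : List A) (ys : List B) (f : A → B → ℕ) →
                  ∑ (cartesianProduct xs ys) (uncurry f) ≡ ∑ xs (λ x → ∑ ys (f x))
    ∑-cartesian []       ys f = refl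
    ∑-cartesian (x ∷ xs) ys f = trans (∑-++ (map (x ,_) ys) _ (uncurry f))
      (cong₂ _+_ (∑-map (x ,_) ys (uncurry f)) (∑-cartesian xs ys f))

    ∑-swap : (xs : List A) (ys : List B) (f : A → B → ℕ) →
             ∑ xs (λ x → ∑ ys (f x)) ≡ ∑ ys (λ y → ∑ xs (λ x → f x y))
    ∑-swap []       ys f = sym (trans (∑-const ys 0) (*-zeroʳ (length ys)))
    ∑-swap (x ∷ xs) ys f = trans (cong (∑ ys (f x) +_) (∑-swap xs ys f)) (sym (∑-+ ys (f x) _))

  count : {n : ℕ} → (Fin n → Bool) → ℕ
  count {zero}  P = 0
  count {suc n} P = ⟦ P zero ⟧ + count (P ∘ suc)

  count-mono : ∀ {n} {P Q : Fin n → Bool} → (∀ i → P i ≡ true → Q i ≡ true) → count P ≤ count Q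
  count-mono {zero}  h = z≤n
  count-mono {suc n} h = +-mono-≤ (⟦⟧-mono (h zero)) (count-mono (h ∘ suc))

  count-cong : ∀ {n} {P Q : Fin n → Bool} → (∀ i → P i ≡ Q i) → count P ≡ count Q
  count-cong {zero}  h = refl
  count-cong {suc n} h = cong₂ (λ b c → ⟦ b ⟧ + c) (h zero) (count-cong (h ∘ suc))

  count-true : ∀ {n} → count {n} (λ _ → true) ≡ n
  count-true {zero}  = refl
  count-true {suc n} = cong suc count-true

  _∖_ : ∀ {n} → (Fin n → Bool) → Fin n → Fin n → Bool
  (P ∖ i) j = P j ∧ not (does (j ≟ i))

  ∖⁺ : ∀ {n} (P : Fin n → Bool) {i j} → P j ≡ true → j ≢ i → (P ∖ i) j ≡ true
  ∖⁺ P {i} {j} Pj j≢i rewrite Pj | dec-false (j ≟ i) j≢i = refl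

  ∖⁻ : ∀ {n} (P : Fin n → Bool) {i j} → (P ∖ i) j ≡ true → P j ≡ true × j ≢ i
  ∖⁻ P {i} {j} h with P j | j ≟ i
  ∖⁻ P h | true | no j≢i = refl , j≢i

  count-remove : ∀ {n} (P : Fin n → Bool) i → P i ≡ true → count P ≡ suc (count (P ∖ i))
  count-remove P zero Pi rewrite Pi = cong suc (count-cong λ j → sym (∧-identityʳ (P (suc j))))
  count-remove P (suc i) Pi = trans (cong (⟦ P zero ⟧ +_) (count-remove (P ∘ suc) i Pi)) (trans (+-suc ⟦ P zero ⟧ _)
    (cong suc (cong₂ (λ b c → ⟦ b ⟧ + c) (sym (∧-identityʳ (P zero))) (count-cong λ j → lem j))))
    where
    lem : ∀ j → ((P ∘ suc) ∖ i) j ≡ (P ∖ suc i) (suc j)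
    lem j with j ≟ i
    ... | yes refl = refl
    ... | no _     = refl

  -- Induction on m: when `zero` satisfies P, its image is removed from Q, and injectivity on P
  -- keeps the remaining images away from it.
  count-injective : ∀ {m n} {P : Fin m → Bool} {Q : Fin n → Bool} (φ : Fin m → Fin n) →
                    (∀ i → P i ≡ true → Q (φ i) ≡ true) →
                    (∀ i j → P i ≡ true → P j ≡ true → φ i ≡ φ j → i ≡ j) →
                    count P ≤ count Q
  count-injective {zero} φ h inj = z≤n
  count-injective {suc m} {P = P} {Q} φ h inj with P zero in P0
  ... | false = count-injective (φ ∘ suc) (λ i → h (suc i)) λ i j p q e → suc-injective (inj _ _ p q e)
  ... | true  = ≤-trans
    (s≤s (count-injective {Q = Q ∖ φ zero} (φ ∘ suc)
      (λ i p → ∖⁺ Q (h (suc i) p) λ e → 0≢suc (inj _ _ P0 p (sym e)))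
      λ i j p q e → suc-injective (inj _ _ p q e)))
    (≤-reflexive (sym (count-remove Q (φ zero) (h zero P0))))
    where
    0≢suc : ∀ {i : Fin m} → zero ≢ suc i
    0≢suc ()

  -- Double counting over pairs of an element and an index. The bound is asked of the first r
  -- indices only, because near the end of a word a factor may have no room.
  ∑-count : {A : Set} {n : ℕ} (xs : List A) (P : A → Fin n → Bool) (s r b : ℕ) → r ≤ n →
            (∀ i → toℕ i < r → b ≤ s * ∑ xs (λ x → ⟦ P x i ⟧)) → r * b ≤ s * ∑ xs (λ x → count (P x))
  ∑-count xs P s zero b r≤n h = z≤n
  ∑-count {n = suc n} xs P s (suc r) b (s≤s r≤n) h = ≤-trans
    (+-mono-≤ (h zero (s≤s z≤n)) (∑-count xs (λ x → P x ∘ suc) s r b r≤n λ i i<r → h (suc i) (s≤s i<r)))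
    (≤-reflexive (trans (sym (*-distribˡ-+ s _ _)) (cong (s *_) (sym (∑-+ xs _ _)))))

-- Classes of the equivalence generated by a list of edges.

module Components where

  open Sums
  open import Data.Fin using (Fin; zero; suc)
  open import Data.Fin.Properties using (_≟_)
  open import Data.List using (List; []; _∷_; _++_)
  open import Data.List.Membership.Propositional using (_∈_)
  open import Data.List.Membership.Propositional.Properties using (∈-++⁻; ∈-++⁺ˡ; ∈-++⁺ʳ)
  open import Data.List.Relation.Unary.Any using (here; there)
  open import Data.Nat using (ℕ; zero; suc; _+_; _≤_)
  open import Data.Nat.Properties using (≤-refl; ≤-trans; ≤-reflexive; ≤-antisym; +-monoʳ-≤;
    +-suc; n≤1+n; module ≤-Reasoning)

  module _ {m : ℕ} where

    Idempotent : (Fin m → Fin m) → Set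
    Idempotent f = ∀ x → f (f x) ≡ f x

    fixed : (Fin m → Fin m) → Fin m → Bool
    fixed f x = does (f x ≟ x)

    fixed⁺ : ∀ f {x} → f x ≡ x → fixed f x ≡ true
    fixed⁺ f {x} = dec-true (f x ≟ x)

    fixed⁻ : ∀ f {x} → fixed f x ≡ true → f x ≡ x
    fixed⁻ f {x} = does⁻ (f x ≟ x)

    -- The map x ↦ f x from the fixed points of g to those of f is injective: equal f-values force
    -- equal g-values, and g fixes both points.
    count-fixed-antitone : ∀ {f g} → Idempotent f → (∀ x y → f x ≡ f y → g x ≡ g y) →
                           count (fixed g) ≤ count (fixed f)
    count-fixed-antitone {f} {g} idem h = count-injective f
      (λ x _ → fixed⁺ f (idem x))
      λ x y gx gy e → trans (sym (fixed⁻ g gx)) (trans (h x y e) (fixed⁻ g gy))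

    -- Union–find: `label es` picks a representative of each class of the equivalence
    -- generated by es, so κ es is the number of classes.
    Edges : Set
    Edges = List (Fin m × Fin m)

    merge : (Fin m → Fin m) → Fin m → Fin m → Fin m → Fin m
    merge f u v x = if does (f x ≟ f v) then f u else f x

    label : Edges → Fin m → Fin m
    label []             x = x
    label ((u , v) ∷ es) = merge (label es) u v

    κ : Edges → ℕ
    κ es = count (fixed (label es))

    merge-cong : ∀ f {u v x y} → f x ≡ f y → merge f u v x ≡ merge f u v y
    merge-cong f e rewrite e = refl

    merge-joins : ∀ f u v → merge f u v u ≡ merge f u v v
    merge-joins f u v rewrite dec-true (f v ≟ f v) refl with f u ≟ f v
    ... | yes _ = refl
    ... | no _  = refl

    merge-idempotent : ∀ {f} u v → Idempotent f → Idempotent (merge f u v)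
    merge-idempotent {f} u v idem x with f x ≟ f v
    ... | yes _ rewrite idem u with f u ≟ f v
    ...   | yes _ = refl
    ...   | no _  = refl
    merge-idempotent {f} u v idem x | no fx≢ rewrite idem x with f x ≟ f v
    ...   | yes e = contradiction e fx≢
    ...   | no _  = refl

    label-idempotent : ∀ es → Idempotent (label es)
    label-idempotent []             x = refl
    label-idempotent ((u , v) ∷ es)   = merge-idempotent u v (label-idempotent es)

    label-edge : ∀ {u v} es → (u , v) ∈ es → label es u ≡ label es v
    label-edge ((u , v) ∷ es) (here refl) = merge-joins (label es) u v
    label-edge (e ∷ es)       (there h)   = merge-cong (label es) (label-edge es h)

    module _ {E : Rel (Fin m) 0ℓ} (isEquivalence : IsEquivalence E) where
      private module E = IsEquivalence isEquivalence

      label-related : ∀ es → (∀ {u v} → (u , v) ∈ es → E u v) → ∀ x → E x (label es x)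
      label-related []             h x = E.refl
      label-related ((u , v) ∷ es) h x with label es x ≟ label es v
      ... | no _  = label-related es (λ p → h (there p)) x
      ... | yes e = E.trans (E.trans (r x) (E.reflexive e))
                      (E.trans (E.sym (r v)) (E.trans (E.sym (h (here refl))) (r u)))
        where r = label-related es (λ p → h (there p))

      label⇒related : ∀ es → (∀ {u v} → (u , v) ∈ es → E u v) →
                     ∀ x y → label es x ≡ label es y → E x y
      label⇒related es h x y e = E.trans (label-related es h x)
        (E.trans (E.reflexive e) (E.sym (label-related es h y)))

    -- Fed to `label⇒related`, a kernel turns every function that agrees along the edges into an
    -- invariant of the classes. Monotonicity of `κ` and the separation of curves both rest on this.
    kernel : ∀ {A : Set} (f : Fin m → A) → IsEquivalence λ x y → f x ≡ f y
    kernel f = record { refl = refl ; sym = sym ; trans = trans }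

    κ-antitone : ∀ {f} es → (∀ {u v} → (u , v) ∈ es → f u ≡ f v) → count (fixed f) ≤ κ es
    κ-antitone {f} es h = count-fixed-antitone (label-idempotent es)
      (label⇒related (kernel f) es h)

    κ-⊆ : ∀ {es es′} → (∀ {u v} → (u , v) ∈ es′ → label es u ≡ label es v) → κ es ≤ κ es′
    κ-⊆ {es} {es′} h = κ-antitone es′ h

    κ-joined : ∀ {u v} es → label es u ≡ label es v → κ es ≡ κ ((u , v) ∷ es)
    κ-joined {u} {v} es e = ≤-antisym
      (κ-⊆ {es} {(u , v) ∷ es} λ { (here refl) → e ; (there p) → label-edge es p })
      (κ-⊆ {(u , v) ∷ es} {es} λ p → label-edge ((u , v) ∷ es) (there p))

    -- `merge` redirects the class of v to the representative of u, so f v is the only fixed point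
    -- that disappears.
    κ-apart : ∀ {u v} es → label es u ≢ label es v → κ es ≡ suc (κ ((u , v) ∷ es))
    κ-apart {u} {v} es u≢v = trans (count-remove (fixed f) (f v) (fixed⁺ f (label-idempotent es v)))
      (cong suc (≤-antisym (count-mono to) (count-mono from)))
      where
      f = label es
      g = merge f u v
      to : ∀ x → (fixed f ∖ f v) x ≡ true → fixed g x ≡ true
      to x h with ∖⁻ (fixed f) h
      ... | p , x≢fv = fixed⁺ g lem
        where
        lem : g x ≡ x
        lem with f x ≟ f v
        ... | yes e = contradiction (trans (sym (fixed⁻ f p)) e) x≢fv
        ... | no _  = fixed⁻ f p
      from : ∀ x → fixed g x ≡ true → (fixed f ∖ f v) x ≡ true
      from x h = lem (fixed⁻ g h)
        where
        lem : g x ≡ x → (fixed f ∖ f v) x ≡ true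
        lem e with f x ≟ f v
        lem e | yes _ = ∖⁺ (fixed f) (fixed⁺ f (subst (λ z → f z ≡ z) e (label-idempotent es u)))
                          λ { refl → u≢v e }
        lem e | no n  = ∖⁺ (fixed f) (fixed⁺ f e) λ { refl → n (label-idempotent es v) }

    κ-≤-suc : ∀ e es → κ es ≤ suc (κ (e ∷ es))
    κ-≤-suc (u , v) es with label es u ≟ label es v
    ... | yes e = ≤-trans (≤-reflexive (κ-joined es e)) (n≤1+n _)
    ... | no n  = ≤-reflexive (κ-apart es n)

    κ-++-swap : ∀ as bs → κ (as ++ bs) ≤ κ (bs ++ as)
    κ-++-swap as bs = κ-⊆ {as ++ bs} {bs ++ as} λ p → label-edge (as ++ bs) (flip (∈-++⁻ bs p))
      where
      flip : ∀ {x} → _ → x ∈ as ++ bs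
      flip (inj₁ q) = ∈-++⁺ʳ as q
      flip (inj₂ q) = ∈-++⁺ˡ q

    -- Diminishing returns, one edge of as at a time: an edge that unites two classes of as ++ bs
    -- lowers the count by one, and the count for as ++ (bs ++ cs) by at most one; an edge inside a
    -- class of the former stays inside one of the latter. Dropping bs from as ++ (bs ++ cs) can
    -- only increase `κ`.
    κ-submodular : ∀ as bs cs → κ (as ++ bs) + κ (bs ++ cs) ≤ κ bs + κ (as ++ cs)
    κ-submodular as bs cs = ≤-trans (go as) (+-monoʳ-≤ (κ bs)
      (κ-⊆ {as ++ (bs ++ cs)} {as ++ cs} λ p → label-edge (as ++ (bs ++ cs)) (weaken (∈-++⁻ as p))))
      where
      weaken : ∀ {x} → _ → x ∈ as ++ (bs ++ cs)
      weaken (inj₁ q) = ∈-++⁺ˡ q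
      weaken (inj₂ q) = ∈-++⁺ʳ as (∈-++⁺ʳ bs q)
      open ≤-Reasoning
      go : ∀ as → κ (as ++ bs) + κ (bs ++ cs) ≤ κ bs + κ (as ++ (bs ++ cs))
      go [] = ≤-refl
      go ((u , v) ∷ as) with label (as ++ bs) u ≟ label (as ++ bs) v
      ... | yes e = begin
        κ ((u , v) ∷ as ++ bs) + κ (bs ++ cs)        ≡⟨ cong (_+ κ (bs ++ cs)) (κ-joined (as ++ bs) e) ⟨
        κ (as ++ bs) + κ (bs ++ cs)                  ≤⟨ go as ⟩
        κ bs + κ (as ++ (bs ++ cs))                  ≡⟨ cong (κ bs +_) (κ-joined (as ++ (bs ++ cs)) e′) ⟩
        κ bs + κ ((u , v) ∷ as ++ (bs ++ cs))        ∎
        where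
        widen : ∀ {x} → _ → x ∈ as ++ (bs ++ cs)
        widen (inj₁ q) = ∈-++⁺ˡ q
        widen (inj₂ q) = ∈-++⁺ʳ as (∈-++⁺ˡ q)
        e′ : label (as ++ (bs ++ cs)) u ≡ label (as ++ (bs ++ cs)) v
        e′ = label⇒related (kernel (label (as ++ (bs ++ cs)))) (as ++ bs)
          (λ p → label-edge (as ++ (bs ++ cs)) (widen (∈-++⁻ as p))) u v e
      ... | no n  = s≤s⁻¹ (begin
        suc (κ ((u , v) ∷ as ++ bs) + κ (bs ++ cs))  ≡⟨ cong (_+ κ (bs ++ cs)) (κ-apart (as ++ bs) n) ⟨
        κ (as ++ bs) + κ (bs ++ cs)                  ≤⟨ go as ⟩
        κ bs + κ (as ++ (bs ++ cs))                  ≤⟨ +-monoʳ-≤ (κ bs) (κ-≤-suc (u , v) (as ++ (bs ++ cs))) ⟩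
        κ bs + suc (κ ((u , v) ∷ as ++ (bs ++ cs)))  ≡⟨ +-suc (κ bs) _ ⟩
        suc (κ bs + κ ((u , v) ∷ as ++ (bs ++ cs)))  ∎)
        where open import Data.Nat using (s≤s⁻¹)

    κ-connected : ∀ es → (x : Fin m) → (∀ y → label es y ≡ label es x) → κ es ≤ 1
    κ-connected es x h = count-injective {Q = λ (_ : Fin 1) → true} (λ _ → zero) (λ _ _ → refl)
      λ i j p q _ → trans (sym (fixed⁻ (label es) p)) (trans (trans (h i) (sym (h j))) (fixed⁻ (label es) q))

-- Walks, shortest distances and counting components.

module Graphs where

  open Sums
  open Components
  open import Data.Fin using (Fin; zero; suc)
  import Data.Fin.Properties as Fin
  open import Data.List using (List; []; _∷_; length; filter; map; tabulate; allFin; deduplicate)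
  open import Data.List.Membership.Propositional using (_∈_; find; lose)
  open import Data.List.Membership.Propositional.Properties using (∈-map⁻; ∈-filter⁺; ∈-filter⁻;
    ∈-allFin; ∈-upTo⁺)
  open import Data.List.Properties using (length-map)
  open import Data.List.Relation.Unary.Any as Any using (Any; here; there)
  import Data.List.Relation.Unary.Any.Properties as Any
  open import Data.List.Relation.Unary.All using ([]; _∷_)
  open import Data.List.Relation.Unary.All.Properties using (all-filter; ¬Any⇒All¬)
  open import Data.List.Relation.Unary.AllPairs as AllPairs using (AllPairs; []; _∷_)
  import Data.List.Relation.Unary.AllPairs.Properties as AllPairs
  open import Data.List.Relation.Unary.Unique.Propositional using (Unique)
  import Data.List.Relation.Unary.Unique.Propositional.Properties as Unique
  open import Data.Nat using (ℕ; zero; suc; _+_; _≤_; _<_; z≤n; s≤s)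
  open import Data.Nat.Properties using (≤-trans; ≤-reflexive; ≤-antisym)
  import Relation.Unary as U

  leastBelow-≤ : ∀ {P : ℕ → Set} (P? : U.Decidable P) b {k} → P k → leastBelow P? b ≤ k
  leastBelow-≤ P? zero    p = z≤n
  leastBelow-≤ P? (suc b) {k} p with P? zero
  leastBelow-≤ P? (suc b) {k}     p | yes _ = z≤n
  leastBelow-≤ P? (suc b) {zero}  p | no ¬p = contradiction p ¬p
  leastBelow-≤ P? (suc b) {suc k} p | no _  = s≤s (leastBelow-≤ (P? ∘ suc) b p)

  leastBelow-holds : ∀ {P : ℕ → Set} (P? : U.Decidable P) b {k} → k < b → P k → P (leastBelow P? b)
  leastBelow-holds P? (suc b) {k} k<b p with P? zero
  leastBelow-holds P? (suc b) {k}     k<b       p | yes p₀ = p₀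
  leastBelow-holds P? (suc b) {zero}  k<b       p | no ¬p  = contradiction p ¬p
  leastBelow-holds P? (suc b) {suc k} (s≤s k<b) p | no _   = leastBelow-holds (P? ∘ suc) b k<b p

  module GraphProperties {V : Set} (_≟_ : DecidableEquality V) (vertices : List V)
                         {_~_ : Rel V 0ℓ} (_~?_ : Decidable _~_) where

    open FiniteGraph _≟_ vertices _~?_
    open import Data.List.Membership.DecPropositional _≟_ using (_∈?_)

    _++ʷ_ : ∀ {k l u v w} → Walk k u v → Walk l v w → Walk (k + l) u w
    _++ʷ_ {zero}  refl q = q
    _++ʷ_ {suc k} p    q = Any.map (λ { (e , r) → e , r ++ʷ q }) p

    -- Appending the reversed step produces the length l + 1, which is not suc l by computation;
    -- hence the separate equation for the length.
    reverseʷ : Symmetric _~_ → ∀ {k u v} → u ∈ vertices → Walk k u v → ∃ λ l → l ≡ k × Walk l v u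
    reverseʷ s {zero}  u∈ refl = 0 , refl , refl
    reverseʷ s {suc k} {u} u∈ p with find p
    ... | w , w∈ , e , q with reverseʷ s w∈ q
    ...   | l , refl , r = l + 1 , +-comm l 1 , r ++ʷ lose u∈ (s e , refl)
      where open import Data.Nat.Properties using (+-comm)

    data Trail : V → V → List V → Set where
      stop : ∀ {v} → Trail v v (v ∷ [])
      step : ∀ {u v w l} → u ~ w → Trail w v l → Trail u v (u ∷ l)

    SimpleTrail : V → V → Set
    SimpleTrail u v = ∃ λ l → Trail u v l × Unique l × (∀ {x} → x ∈ l → x ∈ vertices)

    cut : ∀ {u v w l} → u ∈ l → Trail w v l → Unique l → (∀ {x} → x ∈ l → x ∈ vertices) → SimpleTrail u v
    cut (here refl) stop       un sub = _ , stop , un , sub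
    cut (here refl) (step e t) un sub = _ , step e t , un , sub
    cut (there u∈)  (step e t) (_ ∷ un) sub = cut u∈ t un (sub ∘ there)

    -- Loop erasure: if u already occurs on the simple trail from w, the trail is cut back to that
    -- occurrence instead of being extended.
    simplify : ∀ {k u v} → u ∈ vertices → Walk k u v → SimpleTrail u v
    simplify {zero}  u∈ refl = _ , stop , [] ∷ [] , λ { (here refl) → u∈ }
    simplify {suc k} {u} u∈ p with find p
    ... | w , w∈ , e , q with simplify w∈ q
    ...   | l , t , un , sub with u ∈? l
    ...     | yes u∈l = cut u∈l t un sub
    ...     | no  u∉l = _ , step e t , ¬Any⇒All¬ l u∉l ∷ un , λ { (here refl) → u∈ ; (there x∈) → sub x∈ }

    start∈ : ∀ {u v l} → Trail u v l → u ∈ l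
    start∈ stop       = here refl
    start∈ (step _ _) = here refl

    trail⇒walk : ∀ {u v l} → Trail u v l → (∀ {x} → x ∈ l → x ∈ vertices) →
                 ∃ λ k → suc k ≡ length l × Walk k u v
    trail⇒walk stop       sub = 0 , refl , refl
    trail⇒walk (step e t) sub with trail⇒walk t (sub ∘ there)
    ... | k , k≡ , p = suc k , cong suc k≡ , lose (sub (there (start∈ t))) (e , p)

    -- `dist` and `Connected` search only lengths below the number of vertices; a trail without
    -- repetitions has such a length.
    shorten : ∀ {k u v} → u ∈ vertices → Walk k u v → ∃ λ l → l < length vertices × Walk l u v
    shorten u∈ p with simplify u∈ p
    ... | l , t , un , sub with trail⇒walk t sub
    ...   | k , k≡ , q = k , ≤-trans (≤-reflexive k≡) (length-⊆ un sub) , q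

    dist-≤ : ∀ {k u v} → Walk k u v → dist u v ≤ k
    dist-≤ {k} {u} {v} = leastBelow-≤ (λ k → walk? k u v) (length vertices)

    dist-walk : ∀ {k u v} → u ∈ vertices → Walk k u v → Walk (dist u v) u v
    dist-walk {u = u} {v} u∈ p with shorten u∈ p
    ... | l , l< , q = leastBelow-holds (λ k → walk? k u v) (length vertices) l< q

  count≡∑ : ∀ {n} {A : Set} (g : Fin n → A) (P : A → Bool) → count (P ∘ g) ≡ ∑ (tabulate g) (⟦_⟧ ∘ P)
  count≡∑ {zero}  g P = refl
  count≡∑ {suc n} g P = cong (⟦ P (g zero) ⟧ +_) (count≡∑ (g ∘ suc) P)

  length-filter≡∑ : ∀ {A : Set} {P : A → Set} (P? : U.Decidable P) xs →
                    length (filter P? xs) ≡ ∑ xs (λ x → ⟦ does (P? x) ⟧)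
  length-filter≡∑ P? [] = refl
  length-filter≡∑ P? (x ∷ xs) with P? x
  ... | yes _ = cong suc (length-filter≡∑ P? xs)
  ... | no _  = length-filter≡∑ P? xs

  deduplicate-apart : ∀ {A : Set} {R : Rel A 0ℓ} (R? : Decidable R) xs →
                      AllPairs (λ x y → ¬ R x y) (deduplicate R? xs)
  deduplicate-apart R? []       = []
  deduplicate-apart R? (x ∷ xs) = all-filter (¬? ∘ R? x) (deduplicate R? xs)
    ∷ AllPairs.filter⁺ (¬? ∘ R? x) (deduplicate-apart R? xs)

  -- The entries kept by `deduplicate` need not be fixed by f, so the comparison is made after
  -- applying f: the images of the kept entries are the fixed points, each occurring once.
  length-deduplicate : ∀ {m} {R : Rel (Fin m) 0ℓ} (R? : Decidable R) {f} → Idempotent f →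
    (∀ {x y} → R x y ⇔ (f x ≡ f y)) → length (deduplicate R? (allFin m)) ≡ count (fixed f)
  length-deduplicate {m} {R} R? {f} idem R⇔ = trans (sym (length-map f reps))
    (trans (≤-antisym (length-⊆ reps-unique reps⊆) (length-⊆ (Unique.filter⁺ fixed? (Unique.allFin⁺ m)) ⊆reps))
      (trans (length-filter≡∑ fixed? (allFin m)) (sym (count≡∑ (λ i → i) (fixed f)))))
    where
    open Equivalence
    fixed? : U.Decidable λ x → f x ≡ x
    fixed? x = f x Fin.≟ x
    reps = deduplicate R? (allFin m)
    reps-unique : Unique (map f reps)
    reps-unique = AllPairs.map⁺ (AllPairs.map (λ ¬r e → ¬r (from R⇔ e)) (deduplicate-apart R? (allFin m)))
    reps⊆ : ∀ {x} → x ∈ map f reps → x ∈ filter fixed? (allFin m)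
    reps⊆ p with ∈-map⁻ f p
    ... | y , _ , refl = ∈-filter⁺ fixed? (∈-allFin _) (idem y)
    ⊆reps : ∀ {x} → x ∈ filter fixed? (allFin m) → x ∈ map f reps
    ⊆reps {x} p = Any.map⁺ (Any.deduplicate⁺ R? {P = λ y → x ≡ f y}
      (λ r e → trans e (sym (to R⇔ r)))
      (Any.map (λ { refl → sym (proj₂ (∈-filter⁻ fixed? {xs = allFin m} p)) }) (∈-allFin x)))

  module _ {m : ℕ} {_~_ : Rel (Fin m) 0ℓ} (_~?_ : Decidable _~_) (es : Edges {m}) where

    open FiniteGraph Fin._≟_ (allFin m) _~?_
    open GraphProperties Fin._≟_ (allFin m) _~?_

    #components≡κ : Symmetric _~_ → (∀ {u v} → u ~ v ⇔ ((u , v) ∈ es)) → #components ≡ κ es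
    #components≡κ s ~⇔ = length-deduplicate connected? (label-idempotent es) λ {x} {y} →
      record { to = to′ ; from = from′ x y ; to-cong = cong _ ; from-cong = cong _ }
      where
      open Equivalence
      walk⇒label : ∀ {k u v} → Walk k u v → label es u ≡ label es v
      walk⇒label {zero}  refl = refl
      walk⇒label {suc k} p with find p
      ... | w , _ , e , q = trans (label-edge es (to ~⇔ e)) (walk⇒label q)
      to′ : ∀ {x y} → Connected x y → label es x ≡ label es y
      to′ c with find c
      ... | k , _ , p = walk⇒label p
      joined : IsEquivalence λ u v → ∃ λ k → Walk k u v
      joined = record
        { refl  = 0 , refl
        ; sym   = λ { {u} (k , p) → let l , _ , q = reverseʷ s (∈-allFin u) p in l , q }
        ; trans = λ { (k , p) (l , q) → k + l , p ++ʷ q }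
        }
      from′ : ∀ x y → label es x ≡ label es y → Connected x y
      from′ x y e with label⇒related joined es (λ {u} {v} p → 1 , lose (∈-allFin v) (from ~⇔ p , refl)) x y e
      ... | k , p with shorten (∈-allFin x) p
      ...   | l , l< , q = lose (∈-upTo⁺ l<) q

-- Non-crossing partitions: block numbers, meets and saturated chains.

module Partitions where

  open Sums
  open Components
  open Graphs
  open import Data.Fin using (Fin; zero; suc; _<_; _≤_)
  import Data.Fin.Properties as Fin
  open import Data.Fin.Subset using (_∈_)
  open import Data.Fin.Subset.Properties using (_∈?_; ⊆-antisym)
  open import Data.List using (List; []; _∷_; _++_; filter; allFin; cartesianProduct)
  import Data.List.Membership.Propositional as List
  open import Data.List.Membership.Propositional.Properties as List using (∈-filter⁺; ∈-filter⁻;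
    ∈-allFin; ∈-cartesianProduct⁺; ∈-cartesianProductWith⁺; ∈-++⁻)
  open import Data.List.Relation.Unary.Any as Any using (Any; here; there)
  open import Data.List.Relation.Unary.All using ([]; _∷_)
  open import Data.List.Relation.Unary.AllPairs using ([]; _∷_)
  open import Data.List.Relation.Unary.Unique.Propositional using (Unique)
  import Data.List.Relation.Unary.Unique.Propositional.Properties as Unique
  open import Data.Nat as ℕ using (ℕ; zero; suc; _+_; s≤s; s≤s⁻¹)
  import Data.Nat.Properties as ℕ
  open import Data.Vec as Vec using (Vec; []; _∷_; lookup; tabulate)
  open import Data.Vec.Properties using (lookup⇒[]=; []=⇒lookup; lookup∘tabulate; tabulate∘lookup;
    tabulate-cong; ∷-injective)

  open Equivalence using (to; from)

  ∈-vectors : ∀ {A : Set} {xs : List A} → (∀ x → x List.∈ xs) → ∀ {n} (v : Vec A n) → v List.∈ vectors xs n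
  ∈-vectors h []      = here refl
  ∈-vectors h (x ∷ v) = ∈-cartesianProductWith⁺ _∷_ (h x) (∈-vectors h v)

  vectors-unique : ∀ {A : Set} {xs : List A} → Unique xs → ∀ n → Unique (vectors xs n)
  vectors-unique u zero    = [] ∷ []
  vectors-unique u (suc n) = Unique.cartesianProductWith⁺ _∷_ ∷-injective u (vectors-unique u n)

  module _ {n : ℕ} where

    _~[_]_ : Fin n → Blocks n → Fin n → Set
    i ~[ π ] j = j ∈ block π i

    blocks-ext : {π ρ : Blocks n} → (∀ i j → i ~[ π ] j ⇔ i ~[ ρ ] j) → π ≡ ρ
    blocks-ext {π} {ρ} h = trans (sym (tabulate∘lookup π))
      (trans (tabulate-cong λ i → ⊆-antisym (λ {j} → to (h i j)) (λ {j} → from (h i j))) (tabulate∘lookup ρ))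

    fromRel : {R : Rel (Fin n) 0ℓ} → Decidable R → Blocks n
    fromRel R? = tabulate λ i → tabulate λ j → does (R? i j)

    ~-fromRel : {R : Rel (Fin n) 0ℓ} (R? : Decidable R) → ∀ i j → i ~[ fromRel R? ] j ⇔ R i j
    ~-fromRel R? i j = mk⇔
      (λ p → does⁻ (R? i j) (trans (sym entry) ([]=⇒lookup p)))
      (λ r → lookup⇒[]= j _ (trans entry (dec-true (R? i j) r)))
      where
      entry : lookup (block (fromRel R?) i) j ≡ does (R? i j)
      entry = trans (cong (λ v → lookup v j) (lookup∘tabulate _ i)) (lookup∘tabulate _ j)

    NonCrossingRel : Rel (Fin n) 0ℓ → Set
    NonCrossingRel R = ∀ {a b c d} → a < b → b < c → c < d → R a c → R b d → R a b

    record IsNC (π : Blocks n) : Set where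
      field
        ~-isEquivalence : IsEquivalence (λ i j → i ~[ π ] j)
        ~-noncrossing   : NonCrossingRel (λ i j → i ~[ π ] j)
      open IsEquivalence ~-isEquivalence public
        using () renaming (refl to ~-refl; sym to ~-sym; trans to ~-trans)

    isNC : ∀ {π} → IsPartition π → NonCrossing π → IsNC π
    isNC {π} (self , same) nc = record
      { ~-isEquivalence = record
        { refl  = self _
        ; sym   = λ {i} {j} p → subst (i ∈_) (sym (same i j p)) (self i)
        ; trans = λ {i} {j} {k} p q → subst (k ∈_) (same i j p) q
        }
      ; ~-noncrossing = noncrossing
      }
      where
      noncrossing : NonCrossingRel (λ i j → i ~[ π ] j)
      noncrossing {a} {b} {c} {d} a<b b<c c<d ac bd with block π a ≟ˢ block π b
      ... | yes e = subst (b ∈_) (sym e) (self b)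
      ... | no ¬e = contradiction (a , b , c , d , a<b , b<c , c<d , (self a , ac) , (self b , bd)) (nc a b ¬e)

    fromRel-isPartition : {R : Rel (Fin n) 0ℓ} (R? : Decidable R) → IsEquivalence R → IsPartition (fromRel R?)
    fromRel-isPartition R? eq = (λ i → from (~-fromRel R? i i) E.refl) , λ i j p →
      let r = to (~-fromRel R? i j) p in
      ⊆-antisym (λ {k} q → from (~-fromRel R? i k) (E.trans r (to (~-fromRel R? j k) q)))
                (λ {k} q → from (~-fromRel R? j k) (E.trans (E.sym r) (to (~-fromRel R? i k) q)))
      where module E = IsEquivalence eq

    fromRel-nonCrossing : {R : Rel (Fin n) 0ℓ} (R? : Decidable R) → IsEquivalence R → NonCrossingRel R →
                          NonCrossing (fromRel R?)
    fromRel-nonCrossing R? eq nc i j i≢j (a , b , c , d , a<b , b<c , c<d , (ia , ic) , (jb , jd)) =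
      i≢j (trans (sym (same i a ia)) (trans (sym (same a b ab)) (same j b jb)))
      where
      module E = IsEquivalence eq
      same = proj₂ (fromRel-isPartition R? eq)
      R-between : ∀ {x y z} → x ~[ fromRel R? ] y → x ~[ fromRel R? ] z → _
      R-between {x} {y} {z} p q = E.trans (E.sym (to (~-fromRel R? x y) p)) (to (~-fromRel R? x z) q)
      ab = from (~-fromRel R? a b) (nc a<b b<c c<d (R-between ia ic) (R-between jb jd))

    isNC? : ∀ π → _
    isNC? π = isPartition? {n} π ×-dec nonCrossing? π

    ∈NC⁻ : ∀ {π} → π List.∈ NC n → IsNC π
    ∈NC⁻ p = uncurry isNC (proj₂ (∈-filter⁻ isNC? {xs = vectors (subsets n) n} p))

    fromRel∈NC : {R : Rel (Fin n) 0ℓ} (R? : Decidable R) → IsEquivalence R → NonCrossingRel R →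
                 fromRel R? List.∈ NC n
    fromRel∈NC R? eq nc = ∈-filter⁺ isNC?
      (∈-vectors (∈-vectors λ { false → here refl ; true → there (here refl) }) _)
      (fromRel-isPartition R? eq , fromRel-nonCrossing R? eq nc)

    NC-unique : Unique (NC n)
    NC-unique = Unique.filter⁺ isNC? (vectors-unique (vectors-unique (((λ ()) ∷ []) ∷ ([] ∷ [])) n) n)

    edges : Blocks n → Edges
    edges π = filter (λ { (i , j) → j ∈? block π i }) (cartesianProduct (allFin n) (allFin n))

    ∈-edges : ∀ π {i j} → (i , j) List.∈ edges π ⇔ i ~[ π ] j
    ∈-edges π {i} {j} = mk⇔
      (λ p → proj₂ (∈-filter⁻ (λ { (i , j) → j ∈? block π i }) {xs = cartesianProduct (allFin n) (allFin n)} p))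
      (λ p → ∈-filter⁺ (λ { (i , j) → j ∈? block π i }) (∈-cartesianProduct⁺ (∈-allFin i) (∈-allFin j)) p)

    -- The number of blocks.
    # : Blocks n → ℕ
    # π = κ (edges π)

    _∩ᴾ_ : Blocks n → Blocks n → Blocks n
    π ∩ᴾ ρ = fromRel λ i j → (j ∈? block π i) ×-dec (j ∈? block ρ i)

    #∨ : Blocks n → Blocks n → ℕ
    #∨ π ρ = κ (edges π ++ edges ρ)

    #≤#∨ : ∀ π ρ → (∀ {i j} → i ~[ π ] j → i ~[ ρ ] j) → # ρ ℕ.≤ #∨ π ρ
    #≤#∨ π ρ h = κ-⊆ {es = edges ρ} {edges π ++ edges ρ} (λ p → label-edge (edges ρ) (back (∈-++⁻ (edges π) p)))
      where
      back : ∀ {u v} → _ ⊎ _ → (u , v) List.∈ edges ρ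
      back (inj₁ p) = from (∈-edges ρ) (h (to (∈-edges π) p))
      back (inj₂ p) = p

    label⇒~ : ∀ {π} → IsNC π → ∀ i j → label (edges π) i ≡ label (edges π) j → i ~[ π ] j
    label⇒~ {π} nc = label⇒related (IsNC.~-isEquivalence nc) (edges π) (to (∈-edges π))

    ⊑⇒~ : ∀ {π ρ} → IsNC π → IsNC ρ → π ⊑ ρ → ∀ {i j} → i ~[ π ] j → i ~[ ρ ] j
    ⊑⇒~ nπ nρ le {i} p with le i
    ... | k , sub = IsNC.~-trans nρ (IsNC.~-sym nρ (sub (IsNC.~-refl nπ))) (sub p)

    ~⇒⊑ : ∀ {π ρ : Blocks n} → (∀ {i j} → i ~[ π ] j → i ~[ ρ ] j) → π ⊑ ρ
    ~⇒⊑ h i = i , h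

    ⊏-witness : ∀ {π ρ} → IsNC π → IsNC ρ → π ⊏ ρ → ∃₂ λ i j → i ~[ ρ ] j × ¬ i ~[ π ] j
    ⊏-witness {π} {ρ} nπ nρ (le , ne) with Fin.any? (λ i → Fin.any? λ j → (j ∈? block ρ i) ×-dec ¬? (j ∈? block π i))
    ... | yes w = w
    ... | no ¬w = contradiction (blocks-ext λ i j → mk⇔ (⊑⇒~ nπ nρ le) (back i j)) ne
      where
      back : ∀ i j → i ~[ ρ ] j → i ~[ π ] j
      back i j p with j ∈? block π i
      ... | yes q = q
      ... | no ¬q = contradiction (i , j , p , ¬q) ¬w

    -- A pair related in ρ but not in π is an edge that unites two classes of π, and the enlarged
    -- edge list still lies within ρ.
    ⊏⇒#> : ∀ {π ρ} → IsNC π → IsNC ρ → π ⊏ ρ → # ρ ℕ.< # π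
    ⊏⇒#> {π} {ρ} nπ nρ lt with ⊏-witness nπ nρ lt
    ... | i , j , r , ¬p = ℕ.≤-trans (s≤s (κ-⊆ {es = edges ρ} {(i , j) ∷ edges π}
            λ { (here refl) → label-edge (edges ρ) (from (∈-edges ρ) r)
              ; (there q)   → label-edge (edges ρ) (from (∈-edges ρ) (⊑⇒~ nπ nρ (proj₁ lt) (to (∈-edges π) q))) }))
          (ℕ.≤-reflexive (sym (κ-apart (edges π) (¬p ∘ label⇒~ nπ i j))))

    open FiniteGraph _≟ᴮ_ (NC n) hasseEdge?
    open GraphProperties _≟ᴮ_ (NC n) hasseEdge?

    cover-or-between : ∀ {σ π} → σ ⊏ π →
                       σ ⋖ π ⊎ (∃ λ τ → τ List.∈ NC n × σ ⊏ τ × τ ⊏ π)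
    cover-or-between {σ} {π} lt = decide (Any.any? (λ τ → (σ ⊏? τ) ×-dec (τ ⊏? π)) (NC n))
      where
      decide : Dec (Any (λ τ → σ ⊏ τ × τ ⊏ π) (NC n)) → _
      decide (no cover)    = inj₁ (lt , cover)
      decide (yes between) = inj₂ (List.find between)

    Chain : Rel (Blocks n) 0ℓ
    Chain σ π = ∃ λ k → Walk k σ π × k + # π ℕ.≤ # σ

    chain-trans : ∀ {σ τ π} → Chain σ τ → Chain τ π → Chain σ π
    chain-trans {π = π} (k , p , k≤) (l , q , l≤) = k + l , p ++ʷ q ,
      ℕ.≤-trans (ℕ.≤-reflexive (ℕ.+-assoc k l (# π))) (ℕ.≤-trans (ℕ.+-monoʳ-≤ k l≤) k≤)

    -- f bounds the difference of the block numbers. If σ ⊏ π is not a cover, an intermediate τ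
    -- splits it into two pairs with smaller differences, since `#` drops strictly along `⊏`.
    saturated-chain : ∀ f {σ π} → σ List.∈ NC n → π List.∈ NC n → σ ⊑ π → # σ ℕ.≤ f + # π → Chain σ π
    saturated-chain f {σ} {π} σ∈ π∈ le bound = compare f bound (σ ≟ᴮ π)
      where
      split : ∀ f → # σ ℕ.≤ suc f + # π → σ ⊏ π →
              σ ⋖ π ⊎ (∃ λ τ → τ List.∈ NC n × σ ⊏ τ × τ ⊏ π) → Chain σ π
      split f bound lt (inj₁ cover) = 1 , List.lose π∈ (inj₁ cover , refl) , ⊏⇒#> (∈NC⁻ σ∈) (∈NC⁻ π∈) lt
      split f bound lt (inj₂ (τ , τ∈ , σ⊏τ , τ⊏π)) = chain-trans
        (saturated-chain f σ∈ τ∈ (proj₁ σ⊏τ) (ℕ.≤-trans bound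
          (ℕ.≤-trans (ℕ.≤-reflexive (sym (ℕ.+-suc f (# π)))) (ℕ.+-monoʳ-≤ f (⊏⇒#> (∈NC⁻ τ∈) (∈NC⁻ π∈) τ⊏π)))))
        (saturated-chain f τ∈ π∈ (proj₁ τ⊏π) (s≤s⁻¹ (ℕ.≤-trans (⊏⇒#> (∈NC⁻ σ∈) (∈NC⁻ τ∈) σ⊏τ) bound)))
      compare : ∀ f → # σ ℕ.≤ f + # π → Dec (σ ≡ π) → Chain σ π
      compare f       bound (yes refl) = 0 , refl , ℕ.≤-refl
      compare zero    bound (no ne)    = contradiction bound (ℕ.<⇒≱ (⊏⇒#> (∈NC⁻ σ∈) (∈NC⁻ π∈) (le , ne)))
      compare (suc f) bound (no ne)    = split f bound (le , ne) (cover-or-between (le , ne))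

    hasse-sym : ∀ {π ρ : Blocks n} → HasseEdge π ρ → HasseEdge ρ π
    hasse-sym (inj₁ e) = inj₂ e
    hasse-sym (inj₂ e) = inj₁ e

    ∩ᴾ-~ : ∀ π ρ {i j} → i ~[ π ∩ᴾ ρ ] j ⇔ (i ~[ π ] j × i ~[ ρ ] j)
    ∩ᴾ-~ π ρ {i} {j} = ~-fromRel (λ i j → (j ∈? block π i) ×-dec (j ∈? block ρ i)) i j

    ∩ᴾ∈NC : ∀ {π ρ} → IsNC π → IsNC ρ → π ∩ᴾ ρ List.∈ NC n
    ∩ᴾ∈NC {π} {ρ} nπ nρ = fromRel∈NC (λ i j → (j ∈? block π i) ×-dec (j ∈? block ρ i))
      (record { refl = P.~-refl , R.~-refl
              ; sym = λ (p , r) → P.~-sym p , R.~-sym r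
              ; trans = λ (p , r) (p′ , r′) → P.~-trans p p′ , R.~-trans r r′ })
      λ a<b b<c c<d (p , r) (p′ , r′) → P.~-noncrossing a<b b<c c<d p p′ , R.~-noncrossing a<b b<c c<d r r′
      where
      module P = IsNC nπ
      module R = IsNC nρ

    -- The walk goes from π down to the meet and then up to ρ.
    hasse-walk : ∀ {π ρ} → π List.∈ NC n → ρ List.∈ NC n →
                 ∃ λ k → Walk k π ρ × k + (# π + # ρ) ℕ.≤ # (π ∩ᴾ ρ) + # (π ∩ᴾ ρ)
    hasse-walk {π} {ρ} π∈ ρ∈ = join
      (saturated-chain _ m∈ π∈ (~⇒⊑ {π ∩ᴾ ρ} {π} λ {i} {j} → proj₁ ∘ to (∩ᴾ-~ π ρ {i} {j})) (ℕ.m≤m+n _ _))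
      (saturated-chain _ m∈ ρ∈ (~⇒⊑ {π ∩ᴾ ρ} {ρ} λ {i} {j} → proj₂ ∘ to (∩ᴾ-~ π ρ {i} {j})) (ℕ.m≤m+n _ _))
      where
      open import Data.Nat.Solver using (module +-*-Solver)
      open +-*-Solver
      m∈ = ∩ᴾ∈NC (∈NC⁻ π∈) (∈NC⁻ ρ∈)
      join : Chain (π ∩ᴾ ρ) π → Chain (π ∩ᴾ ρ) ρ → _
      join (k , p , k≤) (l , q , l≤) =
        let k′ , k′≡k , p′ = reverseʷ (λ {x} {y} → hasse-sym {x} {y}) m∈ p in
        k′ + l , p′ ++ʷ q , ℕ.≤-trans
          (ℕ.≤-reflexive (trans (cong (λ k → k + l + (# π + # ρ)) k′≡k)
            (solve 4 (λ k l a b → k :+ l :+ (a :+ b) := k :+ a :+ (l :+ b)) refl k l (# π) (# ρ))))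
          (ℕ.+-mono-≤ k≤ l≤)

    d-H-upper : ∀ {π ρ} → π List.∈ NC n → ρ List.∈ NC n →
                d-H π ρ + (# π + # ρ) ℕ.≤ # (π ∩ᴾ ρ) + # (π ∩ᴾ ρ)
    d-H-upper π∈ ρ∈ = let k , p , k≤ = hasse-walk π∈ ρ∈ in ℕ.≤-trans (ℕ.+-monoˡ-≤ _ (dist-≤ p)) k≤

-- Covers lose at most one block; lower bound for the Hasse distance.

module Covers where

  open Sums
  open Components
  open Graphs
  open Partitions
  open import Data.Fin using (Fin; zero; suc; _<_; _≤_; toℕ)
  import Data.Fin.Properties as Fin
  open import Data.Fin.Subset using (_∈_)
  open import Data.Fin.Subset.Properties using (_∈?_)
  open import Data.List using (List; _∷_)
  import Data.List.Membership.Propositional as List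
  import Data.List.Membership.Propositional.Properties as List
  open import Data.List.Relation.Unary.Any as Any using (here; there)
  open import Data.Nat as ℕ using (ℕ; zero; suc; _+_; s≤s; s≤s⁻¹)
  import Data.Nat.Properties as ℕ
  open import Data.Nat.Solver using (module +-*-Solver)

  open Equivalence using (to; from)

  module _ {n : ℕ} where

    -- Two π-blocks inside one ρ-block with no element of that ρ-block between i and j:
    -- uniting such π-blocks keeps π non-crossing.
    record Adjacent (π ρ : Blocks n) : Set where
      field
        i j   : Fin n
        i<j   : i < j
        i~j   : i ~[ ρ ] j
        i≁j   : ¬ i ~[ π ] j
        empty : ∀ k → i < k → k < j → ¬ i ~[ ρ ] k

    module _ {π ρ : Blocks n} (nπ : IsNC π) (nρ : IsNC ρ) (π⊑ρ : ∀ {i j} → i ~[ π ] j → i ~[ ρ ] j) where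
      private
        module P = IsNC nπ
        module R = IsNC nρ

      -- An element k of the ρ-block strictly between i and j yields a closer pair: (i, k) if k is
      -- unrelated to i in π, and (k, j) otherwise. f bounds the gap j - i.
      adjacent-between : ∀ f i j → toℕ j ℕ.≤ f + toℕ i → i < j → i ~[ ρ ] j → ¬ i ~[ π ] j → Adjacent π ρ
      adjacent-between zero    i j bound i<j r ¬p = contradiction i<j (ℕ.≤⇒≯ bound)
      adjacent-between (suc f) i j bound i<j r ¬p
        with Fin.any? (λ k → (i Fin.<? k) ×-dec (k Fin.<? j) ×-dec (k ∈? block ρ i))
      ... | no ¬k = record { i = i ; j = j ; i<j = i<j ; i~j = r ; i≁j = ¬p
                           ; empty = λ k i<k k<j q → ¬k (k , i<k , k<j , q) }
      ... | yes (k , i<k , k<j , q) with k ∈? block π i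
      ...   | no ¬q′ = adjacent-between f i k (s≤s⁻¹ (ℕ.≤-trans k<j bound)) i<k q ¬q′
      ...   | yes q′ = adjacent-between f k j
                (ℕ.≤-trans bound (ℕ.≤-trans (ℕ.≤-reflexive (sym (ℕ.+-suc f (toℕ i)))) (ℕ.+-monoʳ-≤ f i<k)))
                k<j (R.~-trans (R.~-sym q) r) λ p → ¬p (P.~-trans q′ p)

      adjacent : ∀ i j → i ~[ ρ ] j → ¬ i ~[ π ] j → Adjacent π ρ
      adjacent i j r ¬p with Fin.<-cmp i j
      ... | tri< i<j _ _ = adjacent-between (toℕ j) i j (ℕ.m≤m+n _ _) i<j r ¬p
      ... | tri≈ _ refl _ = contradiction P.~-refl ¬p
      ... | tri> _ _ j<i = adjacent-between (toℕ i) j i (ℕ.m≤m+n _ _) j<i (R.~-sym r) (¬p ∘ P.~-sym)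

      module Unite (adj : Adjacent π ρ) where
        open Adjacent adj

        Ends : Fin n → Set
        Ends x = i ~[ π ] x ⊎ j ~[ π ] x

        United : Rel (Fin n) 0ℓ
        United x y = x ~[ π ] y ⊎ (Ends x × Ends y)

        united? : Decidable United
        united? x y = (y ∈? block π x) ⊎-dec (ends? x ×-dec ends? y)
          where ends? = λ x → (x ∈? block π i) ⊎-dec (x ∈? block π j)

        ends-resp : ∀ {x y} → x ~[ π ] y → Ends x → Ends y
        ends-resp p (inj₁ q) = inj₁ (P.~-trans q p)
        ends-resp p (inj₂ q) = inj₂ (P.~-trans q p)

        united-isEquivalence : IsEquivalence United
        united-isEquivalence = record
          { refl  = inj₁ P.~-refl
          ; sym   = λ { (inj₁ p) → inj₁ (P.~-sym p) ; (inj₂ (p , q)) → inj₂ (q , p) }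
          ; trans = λ { (inj₁ p) (inj₁ q) → inj₁ (P.~-trans p q)
                      ; (inj₁ p) (inj₂ (q , r)) → inj₂ (ends-resp (P.~-sym p) q , r)
                      ; (inj₂ (p , q)) (inj₁ r) → inj₂ (p , ends-resp r q)
                      ; (inj₂ (p , _)) (inj₂ (_ , r)) → inj₂ (p , r) }
          }

        ends⇒ρ : ∀ {x} → Ends x → i ~[ ρ ] x
        ends⇒ρ (inj₁ p) = π⊑ρ p
        ends⇒ρ (inj₂ p) = R.~-trans i~j (π⊑ρ p)

        united⇒ρ : ∀ {x y} → United x y → x ~[ ρ ] y
        united⇒ρ (inj₁ p)       = π⊑ρ p
        united⇒ρ (inj₂ (p , q)) = R.~-trans (R.~-sym (ends⇒ρ p)) (ends⇒ρ q)

        outside : ∀ {x} → i ~[ ρ ] x → x ≤ i ⊎ j ≤ x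
        outside {x} r with i Fin.<? x | x Fin.<? j
        ... | no i≮x  | _       = inj₁ (ℕ.≮⇒≥ i≮x)
        ... | yes _   | no x≮j  = inj₂ (ℕ.≮⇒≥ x≮j)
        ... | yes i<x | yes x<j = contradiction r (empty x i<x x<j)

        -- An anchor e, which is i or j, in the π-block of x. The crossing arguments use only i ≤ e
        -- ≤ j, so they do not have to distinguish in which of the two united blocks x lies.
        record End (x : Fin n) : Set where
          constructor end
          field
            e   : Fin n
            i≤e : i ≤ e
            e≤j : e ≤ j
            in-π : e ~[ π ] x
            ends : ∀ {y} → e ~[ π ] y → Ends y

        toEnd : ∀ {x} → Ends x → End x
        toEnd (inj₁ p) = end i ℕ.≤-refl (ℕ.<⇒≤ i<j) p inj₁
        toEnd (inj₂ p) = end j (ℕ.<⇒≤ i<j) ℕ.≤-refl p inj₂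

        ≤-cases : ∀ {x y : Fin n} → x ≤ y → x ≡ y ⊎ x < y
        ≤-cases {x} {y} x≤y with x Fin.≟ y
        ... | yes e = inj₁ e
        ... | no ne = inj₂ (Fin.≤∧≢⇒< x≤y ne)

        -- The π-chord from b to d has no end strictly between i and j. If it lies on one side of
        -- this gap, it is crossed by the π-chord from c to its anchor; if it spans the gap, by the
        -- π-chord from a to its anchor. The degenerate case is an anchor that is b or d.
        crossed-by-π : ∀ {a b c d} → a < b → b < c → c < d → End a → End c → b ~[ π ] d →
                       b ≤ i ⊎ j ≤ b → d ≤ i ⊎ j ≤ d → Ends b
        crossed-by-π a<b b<c c<d _ (end e _ e≤j ec ends) bd (inj₂ j≤b) _ with ≤-cases (ℕ.≤-trans e≤j j≤b)
        ... | inj₁ refl = ends P.~-refl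
        ... | inj₂ e<b  = ends (P.~-noncrossing e<b b<c c<d ec bd)
        crossed-by-π a<b b<c c<d _ (end e i≤e _ ec ends) bd (inj₁ b≤i) (inj₁ d≤i) with ≤-cases (ℕ.≤-trans d≤i i≤e)
        ... | inj₁ refl = ends (P.~-sym bd)
        ... | inj₂ d<e  = ends (P.~-trans ec (P.~-sym (P.~-noncrossing b<c c<d d<e bd (P.~-sym ec))))
        crossed-by-π a<b b<c c<d (end e i≤e e≤j ea ends) _ bd (inj₁ b≤i) (inj₂ j≤d)
          with ≤-cases (ℕ.≤-trans b≤i i≤e) | ≤-cases (ℕ.≤-trans e≤j j≤d)
        ... | inj₁ refl | _         = ends P.~-refl
        ... | inj₂ _    | inj₁ refl = ends (P.~-sym bd)
        ... | inj₂ b<e  | inj₂ e<d  = ends (P.~-trans ea (P.~-noncrossing a<b b<e e<d (P.~-sym ea) bd))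

        -- Now the chord from a to c belongs to π and the other one to the united block: the anchor
        -- of b serves when the π-chord lies on one side of the gap, the anchor of d when it spans
        -- the gap.
        crosses-π : ∀ {a b c d} → a < b → b < c → c < d → a ~[ π ] c → End b → End d →
                    a ≤ i ⊎ j ≤ a → c ≤ i ⊎ j ≤ c → Ends a
        crosses-π a<b b<c c<d ac (end e i≤e e≤j eb ends) _ _ (inj₁ c≤i) with ≤-cases (ℕ.≤-trans c≤i i≤e)
        ... | inj₁ refl = ends (P.~-sym ac)
        ... | inj₂ c<e  = ends (P.~-trans eb (P.~-sym (P.~-noncrossing a<b b<c c<e ac (P.~-sym eb))))
        crosses-π a<b b<c c<d ac (end e i≤e e≤j eb ends) _ (inj₂ j≤a) (inj₂ _) with ≤-cases (ℕ.≤-trans e≤j j≤a)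
        ... | inj₁ refl = ends P.~-refl
        ... | inj₂ e<a  = ends (P.~-noncrossing e<a a<b b<c eb ac)
        crosses-π a<b b<c c<d ac _ (end e i≤e e≤j ed ends) (inj₁ a≤i) (inj₂ j≤c)
          with ≤-cases (ℕ.≤-trans a≤i i≤e) | ≤-cases (ℕ.≤-trans e≤j j≤c)
        ... | inj₁ refl | _         = ends P.~-refl
        ... | inj₂ _    | inj₁ refl = ends (P.~-sym ac)
        ... | inj₂ a<e  | inj₂ e<c  = ends (P.~-sym (P.~-noncrossing a<e e<c c<d ac ed))

        united-noncrossing : NonCrossingRel United
        united-noncrossing a<b b<c c<d (inj₁ ac) (inj₁ bd) = inj₁ (P.~-noncrossing a<b b<c c<d ac bd)
        united-noncrossing a<b b<c c<d (inj₂ (a∈ , _)) (inj₂ (b∈ , _)) = inj₂ (a∈ , b∈)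
        united-noncrossing a<b b<c c<d (inj₂ (a∈ , c∈)) (inj₁ bd) = inj₂ (a∈ ,
          crossed-by-π a<b b<c c<d (toEnd a∈) (toEnd c∈) bd (outside ib) (outside (R.~-trans ib (π⊑ρ bd))))
          where
          ab = R.~-noncrossing a<b b<c c<d (united⇒ρ (inj₂ (a∈ , c∈))) (π⊑ρ bd)
          ib = R.~-trans (ends⇒ρ a∈) ab
        united-noncrossing a<b b<c c<d (inj₁ ac) (inj₂ (b∈ , d∈)) = inj₂
          (crosses-π a<b b<c c<d ac (toEnd b∈) (toEnd d∈) (outside ia) (outside (R.~-trans ia (π⊑ρ ac))) , b∈)
          where
          ab = R.~-noncrossing a<b b<c c<d (π⊑ρ ac) (united⇒ρ (inj₂ (b∈ , d∈)))
          ia = R.~-trans (ends⇒ρ b∈) (R.~-sym ab)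

        τ : Blocks n
        τ = fromRel united?

        τ∈NC : τ List.∈ NC n
        τ∈NC = fromRel∈NC united? united-isEquivalence united-noncrossing

        π⊏τ : π ⊏ τ
        π⊏τ = ~⇒⊑ {π = π} {τ} (λ {x} {y} p → from (~-fromRel united? x y) (inj₁ p)) ,
          λ π≡τ → i≁j (subst (i ~[_] j) (sym π≡τ) (from (~-fromRel united? i j) (inj₂ (inj₁ P.~-refl , inj₂ P.~-refl))))

        τ⊑ρ : τ ⊑ ρ
        τ⊑ρ = ~⇒⊑ {π = τ} {ρ} λ {x} {y} p → united⇒ρ (to (~-fromRel united? x y) p)

        #-τ : # π ℕ.≤ suc (# τ)
        #-τ = ℕ.≤-trans (κ-≤-suc (i , j) (edges π)) (s≤s (κ-⊆ {es = es} {edges τ}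
          λ {x} {y} p → united⇒label (to (~-fromRel united? x y) (to (∈-edges τ) p))))
          where
          es = (i , j) ∷ edges π
          π-label : ∀ {x y} → x ~[ π ] y → label es x ≡ label es y
          π-label p = label-edge es (there (from (∈-edges π) p))
          ends⇒label : ∀ {x} → Ends x → label es x ≡ label es i
          ends⇒label (inj₁ p) = sym (π-label p)
          ends⇒label (inj₂ p) = trans (sym (π-label p)) (sym (label-edge es (here refl)))
          united⇒label : ∀ {x y} → United x y → label es x ≡ label es y
          united⇒label (inj₁ p)       = π-label p
          united⇒label (inj₂ (p , q)) = trans (ends⇒label p) (sym (ends⇒label q))

    -- Uniting two adjacent blocks gives a non-crossing τ with π ⊏ τ ⊑ ρ, so the cover forces τ ≡ ρ;
    -- and the classes of τ arise from those of π by a single additional edge.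
    ⋖⇒#≤ : ∀ {π ρ} → IsNC π → IsNC ρ → π ⋖ ρ → # π ℕ.≤ suc (# ρ)
    ⋖⇒#≤ {π} {ρ} nπ nρ (lt , cover) = decide (τ ≟ᴮ ρ)
      where
      w = ⊏-witness nπ nρ lt
      open Unite nπ nρ (⊑⇒~ nπ nρ (proj₁ lt))
        (adjacent nπ nρ (⊑⇒~ nπ nρ (proj₁ lt)) (proj₁ w) (proj₁ (proj₂ w)) (proj₁ (proj₂ (proj₂ w))) (proj₂ (proj₂ (proj₂ w))))
      decide : Dec (τ ≡ ρ) → # π ℕ.≤ suc (# ρ)
      decide (yes τ≡ρ) = subst (λ τ → # π ℕ.≤ suc (# τ)) τ≡ρ #-τ
      decide (no τ≢ρ)  = contradiction (List.lose τ∈NC (π⊏τ , τ⊑ρ , τ≢ρ)) cover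

    #∨-comm : ∀ (π ρ : Blocks n) → #∨ π ρ ℕ.≤ #∨ ρ π
    #∨-comm π ρ = κ-++-swap (edges π) (edges ρ)

    -- By submodularity # π + # ρ - 2 #∨ π ρ satisfies the triangle inequality; the next
    -- lemma says that it is at most 1 along an edge.
    edge⇒#≤ : ∀ {π ρ} → IsNC π → IsNC ρ → HasseEdge π ρ → # π + # ρ ℕ.≤ suc (#∨ π ρ + #∨ π ρ)
    edge⇒#≤ {π} {ρ} nπ nρ (inj₁ c) = ℕ.≤-trans
      (ℕ.+-monoˡ-≤ (# ρ) (⋖⇒#≤ nπ nρ c)) (s≤s (ℕ.+-mono-≤ le le))
      where le = #≤#∨ π ρ (⊑⇒~ nπ nρ (proj₁ (proj₁ c)))
    edge⇒#≤ {π} {ρ} nπ nρ (inj₂ c) = ℕ.≤-trans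
      (ℕ.+-monoʳ-≤ (# π) (⋖⇒#≤ nρ nπ c)) (ℕ.≤-trans (ℕ.≤-reflexive (ℕ.+-suc (# π) (# π))) (s≤s (ℕ.+-mono-≤ le le)))
      where le = ℕ.≤-trans (#≤#∨ ρ π (⊑⇒~ nρ nπ (proj₁ (proj₁ c)))) (#∨-comm ρ π)

    open FiniteGraph _≟ᴮ_ (NC n) hasseEdge?
    open GraphProperties _≟ᴮ_ (NC n) hasseEdge?

    -- Triangle inequality through the second vertex σ of the walk: after adding # σ twice to both
    -- sides, submodularity applies with the edges of σ in the middle.
    walk⇒#≤ : ∀ k {π ρ} → π List.∈ NC n → Walk k π ρ → # π + # ρ ℕ.≤ k + (#∨ π ρ + #∨ π ρ)
    walk⇒#≤ zero {π} π∈ refl = ℕ.+-mono-≤ le le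
      where le = #≤#∨ π π (λ p → p)
    walk⇒#≤ (suc k) {π} {ρ} π∈ p = via (List.find p)
      where
      via : ∃ (λ σ → σ List.∈ NC n × HasseEdge π σ × Walk k σ ρ) → _
      via (σ , σ∈ , e , q) = ℕ.+-cancelʳ-≤ (# σ + # σ) _ _ (begin
        # π + # ρ + (# σ + # σ)
          ≡⟨ solve 3 (λ a b c → a :+ b :+ (c :+ c) := a :+ c :+ (c :+ b)) refl (# π) (# ρ) (# σ) ⟩
        # π + # σ + (# σ + # ρ)
          ≤⟨ ℕ.+-mono-≤ (edge⇒#≤ (∈NC⁻ π∈) (∈NC⁻ σ∈) e) (walk⇒#≤ k σ∈ q) ⟩
        suc (#∨ π σ + #∨ π σ) + (k + (#∨ σ ρ + #∨ σ ρ))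
          ≡⟨ solve 3 (λ k x y → con 1 :+ (x :+ x) :+ (k :+ (y :+ y)) := con 1 :+ k :+ ((x :+ y) :+ (x :+ y))) refl k (#∨ π σ) (#∨ σ ρ) ⟩
        suc k + ((#∨ π σ + #∨ σ ρ) + (#∨ π σ + #∨ σ ρ))
          ≤⟨ ℕ.+-monoʳ-≤ (suc k) (ℕ.+-mono-≤ triangle triangle) ⟩
        suc k + ((# σ + #∨ π ρ) + (# σ + #∨ π ρ))
          ≡⟨ solve 3 (λ k s x → con 1 :+ k :+ ((s :+ x) :+ (s :+ x)) := con 1 :+ k :+ (x :+ x) :+ (s :+ s)) refl k (# σ) (#∨ π ρ) ⟩
        suc k + (#∨ π ρ + #∨ π ρ) + (# σ + # σ) ∎)
        where
        open ℕ.≤-Reasoning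
        open +-*-Solver
        triangle = κ-submodular (edges π) (edges σ) (edges ρ)

    -- `hasse-walk` enters only through the existence of a walk: it guarantees that `d-H` is the
    -- length of an actual walk and not the default value for unreachable pairs.
    d-H-lower : ∀ {π ρ} → π List.∈ NC n → ρ List.∈ NC n → # π + # ρ ℕ.≤ d-H π ρ + (#∨ π ρ + #∨ π ρ)
    d-H-lower π∈ ρ∈ = let _ , p , _ = hasse-walk π∈ ρ∈ in walk⇒#≤ _ π∈ (dist-walk π∈ p)

-- Height functions, their cuts and the partitions they induce.

module Levels where

  open Sums
  open Components
  open Partitions
  open import Data.Bool.Properties using (not-injective; not-involutive)
  open import Data.Fin using (Fin; zero; suc; toℕ; fromℕ<)
  import Data.Fin as Fin
  import Data.Fin.Properties as Fin
  open import Data.Fin.Subset.Properties using (_∈?_)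
  import Data.List.Membership.Propositional as List
  open import Data.Nat using (ℕ; zero; suc; _+_; _≤_; _<_; _⊔_; _<?_; _≤?_; _≟_; s≤s; z≤n; s≤s⁻¹)
  open import Data.Nat.Properties using (≤-refl; ≤-trans; ≤-reflexive; ≤-antisym; <⇒≤; <-irrefl;
    <-trans; <⇒≱; ≤∧≢⇒<; ≤-total; n≤1+n; m≤m⊔n; m≤n⊔m; allUpTo?; +-suc; +-identityʳ; m≤n⇒m≤1+n;
    m≤m+n; ≮⇒≥; +-monoʳ-≤)

  open Equivalence using (to; from)

  -- Twice i, by a recursion that exposes two constructors per point, so that stepping over a point
  -- strips two letters by computation.
  dbl : ℕ → ℕ
  dbl zero    = zero
  dbl (suc i) = suc (suc (dbl i))

  odd : ℕ → ℕ
  odd i = suc (dbl i)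

  dbl-≤ : ∀ {i j} → i ≤ j → dbl i ≤ dbl j
  dbl-≤ z≤n       = z≤n
  dbl-≤ (s≤s i≤j) = s≤s (s≤s (dbl-≤ i≤j))

  dbl-≤⁻ : ∀ {i j} → dbl i ≤ dbl j → i ≤ j
  dbl-≤⁻ {zero}          _             = z≤n
  dbl-≤⁻ {suc i} {suc j} (s≤s (s≤s h)) = s≤s (dbl-≤⁻ h)

  dbl-injective : ∀ {i j} → dbl i ≡ dbl j → i ≡ j
  dbl-injective e = ≤-antisym (dbl-≤⁻ (≤-reflexive e)) (dbl-≤⁻ (≤-reflexive (sym e)))

  dbl-+ : ∀ i j → dbl (i + j) ≡ dbl i + dbl j
  dbl-+ zero    j = refl
  dbl-+ (suc i) j = cong (2 +_) (dbl-+ i j)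

  odd-<-dbl : ∀ {i n} → i < n → odd i < dbl n
  odd-<-dbl h = dbl-≤ h

  odd-≤-dbl⁻ : ∀ {i n} → odd i ≤ dbl n → i < n
  odd-≤-dbl⁻ {zero}  {suc n} _             = s≤s z≤n
  odd-≤-dbl⁻ {suc i} {suc n} (s≤s (s≤s h)) = s≤s (odd-≤-dbl⁻ h)

  odd-< : ∀ {i j} → i < j → odd i < odd j
  odd-< h = s≤s (≤-trans (n≤1+n _) (dbl-≤ h))

  odd-<⁻ : ∀ {i j} → odd i < odd j → i < j
  odd-<⁻ {i} {j} h with i <? j
  ... | yes i<j = i<j
  ... | no  i≮j = contradiction h (λ h → <⇒≱ h (s≤s (dbl-≤ (≮⇒≥ i≮j))))

  parity : ℕ → Bool
  parity zero    = false
  parity (suc n) = not (parity n)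

  parity-dbl : ∀ i → parity (dbl i) ≡ false
  parity-dbl zero    = refl
  parity-dbl (suc i) rewrite parity-dbl i = refl

  even⊎odd : ∀ p → (∃ λ i → p ≡ dbl i) ⊎ (∃ λ i → p ≡ odd i)
  even⊎odd zero = inj₁ (0 , refl)
  even⊎odd (suc p) with even⊎odd p
  ... | inj₁ (i , refl) = inj₂ (i , refl)
  ... | inj₂ (i , refl) = inj₁ (suc i , refl)

  UnitSteps : ℕ → (ℕ → ℕ) → Set
  UnitSteps N H = ∀ p → p < N → H (suc p) ≡ suc (H p) ⊎ H p ≡ suc (H (suc p))

  Between : ℕ → ℕ → ℕ → Set
  Between p q r = (p ≤ r × r ≤ q) ⊎ (q ≤ r × r ≤ p)

  -- For the heights H of a Dyck path, cuts p and q satisfy p ≈ q iff the steps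
  -- between them form a Dyck path, i.e. iff they are corners of the same vertex of
  -- the corresponding plane tree.
  module Cuts (H : ℕ → ℕ) where

    infix 4 _≈_
    _≈_ : ℕ → ℕ → Set
    p ≈ q = ∀ r → Between p q r → H p ≤ H r × H q ≤ H r

    _≈?_ : Decidable _≈_
    p ≈? q = map′ (λ h r b → h (s≤s (below b)) b) (λ h {r} _ → h r)
      (allUpTo? (λ r → (((p ≤? r) ×-dec (r ≤? q)) ⊎-dec ((q ≤? r) ×-dec (r ≤? p)))
                        →-dec ((H p ≤? H r) ×-dec (H q ≤? H r))) (suc (p ⊔ q)))
      where
      below : ∀ {r} → Between p q r → r ≤ p ⊔ q
      below (inj₁ (_ , r≤q)) = ≤-trans r≤q (m≤n⊔m p q)
      below (inj₂ (_ , r≤p)) = ≤-trans r≤p (m≤m⊔n p q)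

    ≈⇒H≡ : ∀ {p q} → p ≈ q → H p ≡ H q
    ≈⇒H≡ {p} {q} h with ≤-total p q
    ... | inj₁ p≤q = ≤-antisym (proj₁ (h q (inj₁ (p≤q , ≤-refl)))) (proj₂ (h p (inj₁ (≤-refl , p≤q))))
    ... | inj₂ q≤p = ≤-antisym (proj₁ (h q (inj₂ (≤-refl , q≤p)))) (proj₂ (h p (inj₂ (q≤p , ≤-refl))))

    ≈⁺ : ∀ {p q} → p ≤ q → H p ≡ H q → (∀ r → p ≤ r → r ≤ q → H p ≤ H r) → p ≈ q
    ≈⁺ {p} {q} p≤q e h r (inj₁ (p≤r , r≤q)) = h r p≤r r≤q , ≤-trans (≤-reflexive (sym e)) (h r p≤r r≤q)
    ≈⁺ {p} {q} p≤q e h r (inj₂ (q≤r , r≤p)) = h r (≤-trans p≤q q≤r) (≤-trans r≤p p≤q) ,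
      ≤-trans (≤-reflexive (sym e)) (h r (≤-trans p≤q q≤r) (≤-trans r≤p p≤q))

    ≈-refl : ∀ {p} → p ≈ p
    ≈-refl = ≈⁺ ≤-refl refl λ r p≤r r≤p → ≤-reflexive (cong H (≤-antisym p≤r r≤p))

    ≈-sym : ∀ {p q} → p ≈ q → q ≈ p
    ≈-sym h r b = proj₂ (h r (swap b)) , proj₁ (h r (swap b))

    ≈-trans : ∀ {p q s} → p ≈ q → q ≈ s → p ≈ s
    ≈-trans {p} {q} {s} h g r b with between b
      where
      between : Between p s r → Between p q r ⊎ Between q s r
      between b with ≤-total r q
      between (inj₁ (p≤r , r≤s)) | inj₁ r≤q = inj₁ (inj₁ (p≤r , r≤q))
      between (inj₁ (p≤r , r≤s)) | inj₂ q≤r = inj₂ (inj₁ (q≤r , r≤s))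
      between (inj₂ (s≤r , r≤p)) | inj₁ r≤q = inj₂ (inj₂ (s≤r , r≤q))
      between (inj₂ (s≤r , r≤p)) | inj₂ q≤r = inj₁ (inj₂ (q≤r , r≤p))
    ... | inj₁ c = proj₁ (h r c) , ≤-trans (≤-reflexive (sym (trans (≈⇒H≡ h) (≈⇒H≡ g)))) (proj₁ (h r c))
    ... | inj₂ c = ≤-trans (≤-reflexive (trans (≈⇒H≡ h) (≈⇒H≡ g))) (proj₂ (g r c)) , proj₂ (g r c)

    -- b lies between a and c, and c lies between b and d; this bounds H b from below by H a and
    -- from above by H c, which equals H a.
    ≈-noncrossing : ∀ {a b c d} → a < b → b < c → c < d → a ≈ c → b ≈ d → a ≈ b
    ≈-noncrossing {a} {b} {c} {d} a<b b<c c<d ac bd = ≈⁺ (<⇒≤ a<b)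
      (≤-antisym (proj₁ (ac b (inj₁ (<⇒≤ a<b , <⇒≤ b<c))))
                 (≤-trans (proj₁ (bd c (inj₁ (<⇒≤ b<c , <⇒≤ c<d)))) (≤-reflexive (sym (≈⇒H≡ ac)))))
      λ r a≤r r≤b → proj₁ (ac r (inj₁ (a≤r , ≤-trans r≤b (<⇒≤ b<c))))

    ≈-cong : ∀ {G : ℕ → ℕ} {N p q} → (∀ r → r ≤ N → H r ≡ G r) → p ≤ N → q ≤ N → p ≈ q →
             ∀ r → Between p q r → G p ≤ G r × G q ≤ G r
    ≈-cong {G} {N} {p} {q} e p≤N q≤N h r b =
      subst₂ _≤_ (e p p≤N) (e r (r≤N b)) (proj₁ (h r b)) , subst₂ _≤_ (e q q≤N) (e r (r≤N b)) (proj₂ (h r b))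
      where
      r≤N : Between p q r → r ≤ N
      r≤N (inj₁ (_ , r≤q)) = ≤-trans r≤q q≤N
      r≤N (inj₂ (_ , r≤p)) = ≤-trans r≤p p≤N

    no-later : ∀ {p q} → H p ≡ suc (H (suc p)) → p < q → ¬ p ≈ q
    no-later {p} {q} e p<q h = <-irrefl refl (subst (_≤ H (suc p)) e (proj₁ (h (suc p) (inj₁ (n≤1+n p , p<q)))))

    no-earlier : ∀ {p q} → H (suc p) ≡ suc (H p) → q < suc p → ¬ suc p ≈ q
    no-earlier {p} {q} e q≤p h = <-irrefl refl (subst (_≤ H p) e (proj₁ (h p (inj₂ (s≤s⁻¹ q≤p , n≤1+n p)))))

    module _ {N : ℕ} (unit : UnitSteps N H) where

      -- A path that goes up at p and ends no higher than H p must come back to H p, since its steps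
      -- are units. `ascend` stops at the first return, before which the path is strictly above.
      later : ∀ {p} → H N ≤ H p → p < N → H (suc p) ≡ suc (H p) → ∃ λ q → p < q × q ≤ N × p ≈ q
      later {p} HN p<N e = ascend _ (suc p) (proj₂ (m≤n⇒∃[o]m+o≡n p<N)) ≤-refl λ r p<r r≤ →
        ≤-reflexive (sym (trans (cong H (≤-antisym r≤ p<r)) e))
        where
        open import Data.Nat.Properties using (m≤n⇒∃[o]m+o≡n)
        ascend : ∀ f s → s + f ≡ N → p < s → (∀ r → p < r → r ≤ s → H p < H r) → ∃ λ q → p < q × q ≤ N × p ≈ q
        ascend zero s s≡N p<s above = contradiction HN
          (<⇒≱ (subst (λ s → H p < H s) (trans (sym (+-identityʳ s)) s≡N) (above s p<s ≤-refl)))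
        ascend (suc f) s s≡N p<s above with H p ≟ H (suc s)
        ... | yes same = suc s , m≤n⇒m≤1+n p<s , s<N , ≈⁺ (m≤n⇒m≤1+n (<⇒≤ p<s)) same low
          where
          s<N : s < N
          s<N = subst (suc s ≤_) s≡N (≤-trans (m≤m+n (suc s) f) (≤-reflexive (sym (+-suc s f))))
          low : ∀ r → p ≤ r → r ≤ suc s → H p ≤ H r
          low r p≤r r≤ with r ≟ p | r ≟ suc s
          ... | yes refl | _        = ≤-refl
          ... | _        | yes refl = ≤-reflexive same
          ... | no r≢p   | no r≢    = <⇒≤ (above r (≤∧≢⇒< p≤r (r≢p ∘ sym)) (s≤s⁻¹ (≤∧≢⇒< r≤ r≢)))
        ... | no differ = ascend f (suc s) (trans (sym (+-suc s f)) s≡N) (m≤n⇒m≤1+n p<s) above′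
          where
          s<N : s < N
          s<N = subst (suc s ≤_) s≡N (≤-trans (m≤m+n (suc s) f) (≤-reflexive (sym (+-suc s f))))
          low : H p ≤ H (suc s)
          low with unit s s<N
          ... | inj₁ up   = ≤-trans (<⇒≤ (above s p<s ≤-refl)) (≤-trans (n≤1+n _) (≤-reflexive (sym up)))
          ... | inj₂ down = s≤s⁻¹ (subst (H p <_) down (above s p<s ≤-refl))
          above′ : ∀ r → p < r → r ≤ suc s → H p < H r
          above′ r p<r r≤ with r ≟ suc s
          ... | yes refl = ≤∧≢⇒< low differ
          ... | no r≢    = above r p<r (s≤s⁻¹ (≤∧≢⇒< r≤ r≢))

      earlier : ∀ {p} → H 0 ≤ H (suc p) → suc p ≤ N → H p ≡ suc (H (suc p)) → ∃ λ q → q ≤ p × suc p ≈ q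
      earlier {p} H0 p<N e = descend p ≤-refl λ r p≤r r≤p →
        ≤-reflexive (sym (trans (cong H (≤-antisym r≤p p≤r)) e))
        where
        P = suc p
        descend : ∀ s → s ≤ p → (∀ r → s ≤ r → r ≤ p → H P < H r) → ∃ λ q → q ≤ p × P ≈ q
        descend zero s≤p above = contradiction H0 (<⇒≱ (above 0 z≤n z≤n))
        descend (suc s) s<p above with H s ≟ H P
        ... | yes same = s , <⇒≤ s<p , ≈-sym (≈⁺ (m≤n⇒m≤1+n (<⇒≤ s<p)) same low)
          where
          low : ∀ r → s ≤ r → r ≤ P → H s ≤ H r
          low r s≤r r≤ with r ≟ s | r ≟ P
          ... | yes refl | _        = ≤-refl
          ... | _        | yes refl = ≤-reflexive same
          ... | no r≢s   | no r≢    = ≤-trans (≤-reflexive same) (<⇒≤ (above r (≤∧≢⇒< s≤r (r≢s ∘ sym)) (s≤s⁻¹ (≤∧≢⇒< r≤ r≢))))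
        ... | no differ = descend s (<⇒≤ s<p) above′
          where
          low : H P ≤ H s
          low with unit s (≤-trans (s≤s (<⇒≤ s<p)) p<N)
          ... | inj₁ up   = s≤s⁻¹ (subst (H P <_) up (above (suc s) ≤-refl s<p))
          ... | inj₂ down = ≤-trans (<⇒≤ (above (suc s) ≤-refl s<p)) (≤-trans (n≤1+n _) (≤-reflexive (sym down)))
          above′ : ∀ r → s ≤ r → r ≤ p → H P < H r
          above′ r s≤r r≤p with r ≟ s
          ... | yes refl = ≤∧≢⇒< low (differ ∘ sym)
          ... | no r≢    = above r (≤∧≢⇒< s≤r (r≢ ∘ sym)) r≤p

  record Dyck (N : ℕ) (H : ℕ → ℕ) : Set where
    field
      start : H 0 ≡ 0
      stop  : H N ≡ 0
      unit  : UnitSteps N H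

    parity-H : ∀ p → p ≤ N → parity (H p) ≡ parity p
    parity-H zero    _ = cong parity start
    parity-H (suc p) p<N with unit p p<N
    ... | inj₁ up   = trans (cong parity up) (cong not (parity-H p (<⇒≤ p<N)))
    ... | inj₂ down = not-injective (trans (cong parity (sym down)) (trans (parity-H p (<⇒≤ p<N)) (sym (not-involutive _))))

    open Cuts H

    -- Heights have the parity of their positions, and equivalent cuts have equal heights.
    ≈-odd : ∀ {i q} → odd i ≤ N → q ≤ N → odd i ≈ q → ∃ λ j → q ≡ odd j
    ≈-odd {i} {q} i≤ q≤ h with even⊎odd q
    ... | inj₂ o = o
    ... | inj₁ (j , refl) = contradiction
      (trans (sym (parity-dbl j)) (trans (sym (parity-H _ q≤)) (trans (cong parity (sym (≈⇒H≡ h)))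
        (trans (parity-H _ i≤) (cong not (parity-dbl i))))))
      λ ()

  -- The point i of Fin n corresponds to the cut odd (toℕ i).
  module _ {n : ℕ} (H : ℕ → ℕ) where
    open Cuts H

    _≈ᵒ?_ : Decidable {A = Fin n} {B = Fin n} λ i j → odd (toℕ i) ≈ odd (toℕ j)
    i ≈ᵒ? j = odd (toℕ i) ≈? odd (toℕ j)

    partition : Blocks n
    partition = fromRel _≈ᵒ?_

    ~-partition : ∀ i j → i ~[ partition ] j ⇔ odd (toℕ i) ≈ odd (toℕ j)
    ~-partition = ~-fromRel _≈ᵒ?_

    partition∈NC : partition List.∈ NC n
    partition∈NC = fromRel∈NC _≈ᵒ?_
      (record { refl  = λ {i} → ≈-refl {cut i}
              ; sym   = λ {i} {j} → ≈-sym {cut i} {cut j}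
              ; trans = λ {i} {j} {k} → ≈-trans {cut i} {cut j} {cut k} })
      λ {a} {b} {c} {d} a<b b<c c<d →
        ≈-noncrossing {cut a} {cut b} {cut c} {cut d} (odd-< a<b) (odd-< b<c) (odd-< c<d)
      where
      cut : Fin n → ℕ
      cut i = odd (toℕ i)

  HasLater HasEarlier : ∀ {n} → Blocks n → Fin n → Set
  HasLater   π i = ∃ λ j → i Fin.< j × i ~[ π ] j
  HasEarlier π i = ∃ λ j → j Fin.< i × i ~[ π ] j

  hasLater? : ∀ {n} (π : Blocks n) i → Dec (HasLater π i)
  hasLater? π i = Fin.any? λ j → (i Fin.<? j) ×-dec (j ∈? block π i)

  module _ {n : ℕ} {H : ℕ → ℕ} (dyck : Dyck (dbl n) H) (i : Fin n) where
    open Dyck dyck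
    open Cuts H
    private
      p = toℕ i
      p< = Fin.toℕ<n i

    up⇒hasLater : H (suc (odd p)) ≡ suc (H (odd p)) → HasLater (partition H) i
    up⇒hasLater e with later unit (subst (_≤ H (odd p)) (sym stop) z≤n) (odd-<-dbl p<) e
    ... | q , p<q , q≤ , h with ≈-odd {p} (<⇒≤ (odd-<-dbl p<)) q≤ h
    ...   | j , refl = fromℕ< j<n ,
            subst (p <_) (sym (Fin.toℕ-fromℕ< j<n)) (odd-<⁻ p<q) ,
            from (~-partition H i _) (subst (λ j → odd p ≈ odd j) (sym (Fin.toℕ-fromℕ< j<n)) h)
      where j<n = odd-≤-dbl⁻ q≤

    down⇒¬hasLater : H (odd p) ≡ suc (H (suc (odd p))) → ¬ HasLater (partition H) i
    down⇒¬hasLater e (j , i<j , h) = no-later e (odd-< i<j) (to (~-partition H i j) h)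

    down⇒hasEarlier : H (dbl p) ≡ suc (H (odd p)) → HasEarlier (partition H) i
    down⇒hasEarlier e with earlier unit (subst (_≤ H (odd p)) (sym start) z≤n) (<⇒≤ (odd-<-dbl p<)) e
    ... | q , q≤ , h with ≈-odd {p} (<⇒≤ (odd-<-dbl p<)) (≤-trans (≤-trans q≤ (n≤1+n _)) (<⇒≤ (odd-<-dbl p<))) h
    ...   | j , refl = fromℕ< j<n ,
            subst (_< p) (sym (Fin.toℕ-fromℕ< j<n)) j<p ,
            from (~-partition H i _) (subst (λ j → odd p ≈ odd j) (sym (Fin.toℕ-fromℕ< j<n)) h)
      where
      j<p = odd-<⁻ (s≤s q≤)
      j<n = <-trans j<p p<

    up⇒¬hasEarlier : H (odd p) ≡ suc (H (dbl p)) → ¬ HasEarlier (partition H) i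
    up⇒¬hasEarlier e (j , j<i , h) = no-earlier e (odd-< j<i) (to (~-partition H i j) h)

  module _ {n : ℕ} {H G : ℕ → ℕ} (dH : Dyck (dbl n) H) (dG : Dyck (dbl n) G)
           (same : partition {n} H ≡ partition G) where
    private
      module H = Dyck dH
      module G = Dyck dG

    -- The steps can be read off the partition: the step before the cut of point i goes down iff i
    -- has an earlier partner, and the step after it goes up iff i has a later partner.
    partition-determines-steps : ∀ p → p < dbl n → H (suc p) ≡ suc (H p) → G (suc p) ≡ suc (G p)
    partition-determines-steps p p< up with G.unit p p<
    ... | inj₁ up′  = up′
    ... | inj₂ down with even⊎odd p
    ...   | inj₁ (i , refl) = contradiction
              (subst (λ π → HasEarlier π (fromℕ< i<n)) (sym same) (down⇒hasEarlier dG (fromℕ< i<n) (shift G down)))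
              (up⇒¬hasEarlier dH (fromℕ< i<n) (shift′ H up))
      where
      i<n = odd-≤-dbl⁻ p<
      shift : ∀ F → F (dbl i) ≡ suc (F (odd i)) → F (dbl (toℕ (fromℕ< i<n))) ≡ suc (F (odd (toℕ (fromℕ< i<n))))
      shift F = subst (λ i → F (dbl i) ≡ suc (F (odd i))) (sym (Fin.toℕ-fromℕ< i<n))
      shift′ : ∀ F → F (odd i) ≡ suc (F (dbl i)) → F (odd (toℕ (fromℕ< i<n))) ≡ suc (F (dbl (toℕ (fromℕ< i<n))))
      shift′ F = subst (λ i → F (odd i) ≡ suc (F (dbl i))) (sym (Fin.toℕ-fromℕ< i<n))
    ...   | inj₂ (i , refl) = contradiction
              (subst (λ π → HasLater π (fromℕ< i<n)) same (up⇒hasLater dH (fromℕ< i<n) (shift′ H up)))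
              (down⇒¬hasLater dG (fromℕ< i<n) (shift G down))
      where
      i<n = odd-≤-dbl⁻ (<⇒≤ p<)
      shift : ∀ F → F (odd i) ≡ suc (F (suc (odd i))) → F (odd (toℕ (fromℕ< i<n))) ≡ suc (F (suc (odd (toℕ (fromℕ< i<n)))))
      shift F = subst (λ i → F (odd i) ≡ suc (F (suc (odd i)))) (sym (Fin.toℕ-fromℕ< i<n))
      shift′ : ∀ F → F (suc (odd i)) ≡ suc (F (odd i)) → F (suc (odd (toℕ (fromℕ< i<n)))) ≡ suc (F (odd (toℕ (fromℕ< i<n))))
      shift′ F = subst (λ i → F (suc (odd i)) ≡ suc (F (odd i))) (sym (Fin.toℕ-fromℕ< i<n))

  -- Each block is counted at its largest element, which `search` finds by passing to later
  -- partners; the bound n limits the number of moves.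
  #≡count-last : ∀ {n} {π : Blocks n} → IsNC π → # π ≡ count (λ i → not (does (hasLater? π i)))
  #≡count-last {n} {π} nc = ≤-antisym
    (count-injective (proj₁ ∘ last) (λ i _ → isLast⁺ (proj₂ (proj₂ (last i)))) λ i j fi fj e →
      trans (sym (fixed⁻ ℓ fi)) (trans (label-edge (edges π) (from (∈-edges π)
        (~-trans (proj₁ (proj₂ (last i))) (subst (_~[ π ] j) (sym e) (~-sym (proj₁ (proj₂ (last j)))))))) (fixed⁻ ℓ fj)))
    (count-injective ℓ (λ i _ → fixed⁺ ℓ (label-idempotent (edges π) i)) λ i j li lj e →
      unique (isLast⁻ li) (isLast⁻ lj) (label⇒~ nc i j e))
    where
    open IsNC nc
    ℓ = label (edges π)
    isLast⁺ : ∀ {i} → ¬ HasLater π i → not (does (hasLater? π i)) ≡ true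
    isLast⁺ {i} h with hasLater? π i
    ... | yes l = contradiction l h
    ... | no _  = refl
    isLast⁻ : ∀ {i} → not (does (hasLater? π i)) ≡ true → ¬ HasLater π i
    isLast⁻ {i} h with hasLater? π i
    ... | no ¬l = ¬l
    unique : ∀ {i j} → ¬ HasLater π i → ¬ HasLater π j → i ~[ π ] j → i ≡ j
    unique {i} {j} li lj p with Fin.<-cmp i j
    ... | tri< i<j _ _ = contradiction (j , i<j , p) li
    ... | tri≈ _ e _   = e
    ... | tri> _ _ j<i = contradiction (i , j<i , ~-sym p) lj
    search : ∀ f i → n ≤ f + toℕ i → ∃ λ j → i ~[ π ] j × ¬ HasLater π j
    search zero    i n≤ = contradiction (Fin.toℕ<n i) (λ h → <⇒≱ h n≤)
    search (suc f) i n≤ with hasLater? π i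
    ... | no ¬l = i , ~-refl , ¬l
    ... | yes (j , i<j , p) with search f j (≤-trans n≤ (≤-trans (≤-reflexive (sym (+-suc f (toℕ i)))) (+-monoʳ-≤ f i<j)))
    ...   | k , q , l = k , ~-trans p q , l
    last : ∀ i → ∃ λ j → i ~[ π ] j × ¬ HasLater π j
    last i = search n i (m≤m+n n (toℕ i))

-- Every non-crossing partition comes from a Dyck path.

module Heights where

  open Sums
  open Partitions
  open Levels
  open import Data.Fin using (Fin; zero; suc; toℕ)
  import Data.Fin as Fin
  import Data.Fin.Properties as Fin
  open import Data.Fin.Subset.Properties using (_∈?_)
  open import Data.Nat as ℕ using (ℕ; zero; suc; _≤_; _<_; _<?_; _≤?_; s≤s; s≤s⁻¹)
  open import Data.Nat.Properties using (≤-refl; ≤-trans; ≤-reflexive; ≤-antisym; <⇒≤; <-irrefl;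
    <-trans; <⇒≱; ≤∧≢⇒<; ≤-<-trans; <-≤-trans; n≤1+n; m≤n⇒m≤1+n; ≮⇒≥; ≰⇒>; suc-injective)
  import Relation.Unary as U

  open Equivalence using (to; from)

  size : ∀ {n} {P : Fin n → Set} → U.Decidable P → ℕ
  size P? = count (λ i → does (P? i))

  module _ {n : ℕ} {P Q : Fin n → Set} (P? : U.Decidable P) (Q? : U.Decidable Q) where

    size-mono : (∀ i → P i → Q i) → size P? ≤ size Q?
    size-mono h = count-mono λ i p → dec-true (Q? i) (h i (does⁻ (P? i) p))

    size-strict : (∀ i → P i → Q i) → ∀ i → Q i → ¬ P i → suc (size P?) ≤ size Q?
    size-strict h i q ¬p = ≤-trans
      (s≤s (count-mono λ j p → ∖⁺ (λ i → does (Q? i)) (dec-true (Q? j) (h j (does⁻ (P? j) p)))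
        λ { refl → ¬p (does⁻ (P? j) p) }))
      (≤-reflexive (sym (count-remove (λ i → does (Q? i)) i (dec-true (Q? i) q))))

    size-≡⊎suc : (∀ i → P i → Q i) → (∀ i j → Q i → ¬ P i → Q j → ¬ P j → i ≡ j) →
                 size Q? ≡ size P? ⊎ size Q? ≡ suc (size P?)
    size-≡⊎suc h one with Fin.any? (λ i → Q? i ×-dec ¬? (P? i))
    ... | no ¬i = inj₁ (≤-antisym (count-mono back) (size-mono h))
      where
      back : ∀ i → does (Q? i) ≡ true → does (P? i) ≡ true
      back i q with P? i
      ... | yes p = refl
      ... | no ¬p = contradiction (i , does⁻ (Q? i) q , ¬p) ¬i
    ... | yes (i , q , ¬p) = inj₂ (trans (count-remove q? i (dec-true (Q? i) q)) (cong suc (≤-antisym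
        (count-mono back)
        (count-mono λ j p → ∖⁺ q? (dec-true (Q? j) (h j (does⁻ (P? j) p))) λ { refl → ¬p (does⁻ (P? j) p) }))))
      where
      q? = λ i → does (Q? i)
      back : ∀ j → (q? ∖ i) j ≡ true → does (P? j) ≡ true
      back j qj with ∖⁻ q? qj
      ... | qj′ , j≢i with P? j
      ...   | yes _ = refl
      ...   | no ¬pj = contradiction (one j i (does⁻ (Q? j) qj′) ¬pj q ¬p) j≢i

  weave : (ℕ → ℕ) → (ℕ → ℕ) → ℕ → ℕ
  weave f g zero          = f 0
  weave f g (suc zero)    = g 0
  weave f g (suc (suc p)) = weave (f ∘ suc) (g ∘ suc) p

  weave-dbl : ∀ f g i → weave f g (dbl i) ≡ f i
  weave-dbl f g zero    = refl
  weave-dbl f g (suc i) = weave-dbl (f ∘ suc) (g ∘ suc) i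

  weave-odd : ∀ f g i → weave f g (odd i) ≡ g i
  weave-odd f g zero    = refl
  weave-odd f g (suc i) = weave-odd (f ∘ suc) (g ∘ suc) i

  -- Every non-crossing π is the partition of a height function: twice the number of
  -- arcs c → (next element of the block of c) passing over the cut, plus 1 at odd cuts.
  module _ {n : ℕ} {π : Blocks n} (nc : IsNC π) where
    open IsNC nc

    -- c is the start of an arc over the cut dbl k (even) resp. odd k (odd).
    OverEven OverOdd : ℕ → Fin n → Set
    OverEven k c = toℕ c < k × (∃ λ d → k ≤ toℕ d × c ~[ π ] d) × (∀ e → c Fin.< e → toℕ e < k → ¬ c ~[ π ] e)
    OverOdd  k c = toℕ c < k × (∃ λ d → k < toℕ d × c ~[ π ] d) × (∀ e → c Fin.< e → toℕ e ≤ k → ¬ c ~[ π ] e)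

    overEven? : ∀ k → U.Decidable (OverEven k)
    overEven? k c = (toℕ c <? k) ×-dec Fin.any? (λ d → (k ≤? toℕ d) ×-dec (d ∈? block π c))
      ×-dec Fin.all? (λ e → (c Fin.<? e) →-dec ((toℕ e <? k) →-dec ¬? (e ∈? block π c)))

    overOdd? : ∀ k → U.Decidable (OverOdd k)
    overOdd? k c = (toℕ c <? k) ×-dec Fin.any? (λ d → (k <? toℕ d) ×-dec (d ∈? block π c))
      ×-dec Fin.all? (λ e → (c Fin.<? e) →-dec ((toℕ e ≤? k) →-dec ¬? (e ∈? block π c)))

    even# odd# : ℕ → ℕ
    even# k = size (overEven? k)
    odd#  k = size (overOdd? k)

    height : ℕ → ℕ
    height = weave (dbl ∘ even#) (odd ∘ odd#)

    height-dbl : ∀ k → height (dbl k) ≡ dbl (even# k)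
    height-dbl = weave-dbl _ _

    height-odd : ∀ k → height (odd k) ≡ odd (odd# k)
    height-odd = weave-odd _ _

    odd⇒even : ∀ k c → OverOdd k c → OverEven k c
    odd⇒even k c (c<k , (d , k<d , p) , none) = c<k , (d , <⇒≤ k<d , p) , λ e c<e e<k → none e c<e (<⇒≤ e<k)

    -- Arriving at point k can only end the arc that leads to k, and there is at most one: its start
    -- is the predecessor of k in the block.
    even#-odd# : ∀ k → even# k ≡ odd# k ⊎ even# k ≡ suc (odd# k)
    even#-odd# k = size-≡⊎suc (overOdd? k) (overEven? k) (odd⇒even k) one
      where
      hits : ∀ c → OverEven k c → ¬ OverOdd k c → ∃ λ d → toℕ d ≡ k × c ~[ π ] d
      hits c (c<k , (d , k≤d , p) , none) ¬o with Fin.any? (λ e → (toℕ e ℕ.≟ k) ×-dec (e ∈? block π c))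
      ... | yes w = w
      ... | no ¬w = contradiction
        (c<k , (d , ≤∧≢⇒< k≤d (λ e → ¬w (d , sym e , p)) , p) ,
          λ e c<e e≤k q → none e c<e (≤∧≢⇒< e≤k (λ e≡k → ¬w (e , e≡k , q))) q) ¬o
      one : ∀ i j → OverEven k i → ¬ OverOdd k i → OverEven k j → ¬ OverOdd k j → i ≡ j
      one i j oi ¬oi oj ¬oj with hits i oi ¬oi | hits j oj ¬oj
      ... | d , d≡k , p | d′ , d′≡k , q with Fin.toℕ-injective (trans d≡k (sym d′≡k))
      ...   | refl with Fin.<-cmp i j
      ...     | tri< i<j _ _ = contradiction (~-trans p (~-sym q)) (proj₂ (proj₂ oi) j i<j (proj₁ oj))
      ...     | tri≈ _ e _   = e
      ...     | tri> _ _ j<i = contradiction (~-trans q (~-sym p)) (proj₂ (proj₂ oj) i j<i (proj₁ oi))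

    -- Leaving point k can only add the arc that starts at k.
    odd#-even# : ∀ k → even# (suc k) ≡ odd# k ⊎ even# (suc k) ≡ suc (odd# k)
    odd#-even# k = size-≡⊎suc (overOdd? k) (overEven? (suc k))
      (λ c (c<k , (d , k<d , p) , none) → m≤n⇒m≤1+n c<k , (d , k<d , p) , λ e c<e e≤k → none e c<e (s≤s⁻¹ e≤k))
      λ i j oi ¬oi oj ¬oj → Fin.toℕ-injective (trans (at i oi ¬oi) (sym (at j oj ¬oj)))
      where
      at : ∀ c → OverEven (suc k) c → ¬ OverOdd k c → toℕ c ≡ k
      at c (c≤k , (d , k<d , p) , none) ¬o with toℕ c ℕ.≟ k
      ... | yes e = e
      ... | no ne = contradiction (≤∧≢⇒< (s≤s⁻¹ c≤k) ne , (d , k<d , p) , λ e c<e e≤k → none e c<e (s≤s e≤k)) ¬o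

    height-dyck : Dyck (dbl n) height
    height-dyck = record
      { start = trans (height-dbl 0) (cong dbl (size-zero (overEven? 0) λ _ ()))
      ; stop  = trans (height-dbl n) (cong dbl (size-zero (overEven? n)
                  λ { c (_ , (d , n≤d , _) , _) → <⇒≱ (Fin.toℕ<n d) n≤d }))
      ; unit  = unit
      }
      where
      size-zero : ∀ {m} {P : Fin m → Set} (P? : U.Decidable P) → (∀ i → ¬ P i) → size P? ≡ 0
      size-zero {zero}  P? ¬P = refl
      size-zero {suc m} P? ¬P with P? zero
      ... | yes p = contradiction p (¬P zero)
      ... | no _  = size-zero (P? ∘ suc) (¬P ∘ suc)
      unit : UnitSteps (dbl n) height
      unit p _ with even⊎odd p
      ... | inj₁ (k , refl) with even#-odd# k
      ...   | inj₁ e = inj₁ (trans (height-odd k) (cong suc (sym (trans (height-dbl k) (cong dbl e)))))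
      ...   | inj₂ e = inj₂ (trans (height-dbl k) (trans (cong dbl e) (cong suc (sym (height-odd k)))))
      unit p _ | inj₂ (k , refl) with odd#-even# k
      ...   | inj₁ e = inj₂ (trans (height-odd k) (cong suc (sym (trans (height-dbl (suc k)) (cong dbl e)))))
      ...   | inj₂ e = inj₁ (trans (height-dbl (suc k)) (trans (cong dbl e) (cong suc (sym (height-odd k)))))

    -- The start c is not in the block of i, as no element up to i follows it in its own block.
    -- Hence an element of the block of c between i and j would cross i ~ j, and the arc leaps over
    -- j as well.
    OverOdd-in-block : ∀ {i j k : Fin n} → i Fin.≤ k → k Fin.≤ j → i ~[ π ] j → ∀ c → OverOdd (toℕ i) c → OverOdd (toℕ k) c
    OverOdd-in-block {i} {j} {k} i≤k k≤j ij c (c<i , (d , i<d , cd) , none) =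
      <-≤-trans c<i i≤k , (d , ≤-<-trans k≤j j<d , cd) , none′
      where
      c≁i : ¬ c ~[ π ] i
      c≁i = none i c<i ≤-refl
      beyond : ∀ {e} → i Fin.< e → c ~[ π ] e → j Fin.< e
      beyond {e} i<e ce with Fin.<-cmp e j
      ... | tri< e<j _ _ = contradiction (~-noncrossing c<i i<e e<j ce ij) c≁i
      ... | tri≈ _ refl _ = contradiction (~-trans ce (~-sym ij)) c≁i
      ... | tri> _ _ j<e = j<e
      j<d = beyond i<d cd
      none′ : ∀ e → c Fin.< e → e Fin.≤ k → ¬ c ~[ π ] e
      none′ e c<e e≤k ce with i Fin.<? e
      ... | yes i<e = <⇒≱ (beyond i<e ce) (≤-trans e≤k k≤j)
      ... | no i≮e  = none e c<e (≮⇒≥ i≮e) ce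

    -- If c were between i and j, the arc from c to d would cross i ~ j.
    OverOdd-back : ∀ {i j} → i Fin.< j → i ~[ π ] j → ∀ c → OverOdd (toℕ j) c → OverOdd (toℕ i) c
    OverOdd-back {i} {j} i<j ij c (c<j , (d , j<d , cd) , none) =
      c<i , (d , <-trans i<j j<d , cd) , λ e c<e e≤i → none e c<e (≤-trans e≤i (<⇒≤ i<j))
      where
      c≁j : ¬ c ~[ π ] j
      c≁j = none j c<j ≤-refl
      c<i : c Fin.< i
      c<i with Fin.<-cmp c i
      ... | tri< c<i _ _ = c<i
      ... | tri≈ _ refl _ = contradiction ij c≁j
      ... | tri> _ _ i<c = contradiction (~-trans (~-sym (~-noncrossing i<c c<j j<d ij cd)) ij) c≁j

    odd#-mono : ∀ {i j k : Fin n} → i Fin.≤ k → k Fin.≤ j → i ~[ π ] j → odd# (toℕ i) ≤ odd# (toℕ k)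
    odd#-mono {i} {j} {k} i≤k k≤j ij =
      size-mono (overOdd? (toℕ i)) (overOdd? (toℕ k)) (OverOdd-in-block i≤k k≤j ij)

    odd#-block : ∀ {i j} → i Fin.< j → i ~[ π ] j → odd# (toℕ i) ≡ odd# (toℕ j)
    odd#-block {i} {j} i<j ij = ≤-antisym (odd#-mono (<⇒≤ i<j) ≤-refl ij)
      (size-mono (overOdd? (toℕ j)) (overOdd? (toℕ i)) (OverOdd-back i<j ij))

    odd#-block-≤ : ∀ {i j} → i Fin.≤ j → i ~[ π ] j → odd# (toℕ i) ≡ odd# (toℕ j)
    odd#-block-≤ {i} {j} i≤j ij with i Fin.≟ j
    ... | yes refl = refl
    ... | no i≢j   = odd#-block (≤∧≢⇒< i≤j (i≢j ∘ Fin.toℕ-injective)) ij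

    last-before : ∀ i k → toℕ i < k → ∃ λ c → i Fin.≤ c × toℕ c < k × i ~[ π ] c ×
                  (∀ e → c Fin.< e → toℕ e < k → ¬ i ~[ π ] e)
    last-before i (suc k) (s≤s i≤k) with Fin.any? (λ e → (toℕ e ℕ.≟ k) ×-dec (e ∈? block π i))
    ... | yes (e , refl , p) = e , i≤k , ≤-refl , p , λ e′ e<e′ e′≤e → contradiction (s≤s⁻¹ e′≤e) (<⇒≱ e<e′)
    ... | no ¬e with last-before i k (≤∧≢⇒< i≤k λ i≡k → ¬e (i , i≡k , ~-refl))
    ...   | c , i≤c , c<k , p , none = c , i≤c , m≤n⇒m≤1+n c<k , p ,
              λ e c<e e≤k q → none e c<e (≤∧≢⇒< (s≤s⁻¹ e≤k) λ e≡k → ¬e (e , e≡k , q)) q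

    open Cuts height

    -- Arcs over i pass over every cut up to that of j, so no odd cut on the way is lower. An even
    -- cut on the way has one arc more, that of the block of i and j itself, which contributes 2 and
    -- outweighs the 1 added at odd cuts.
    ~⇒≈ : ∀ {i j} → i Fin.< j → i ~[ π ] j → odd (toℕ i) ≈ odd (toℕ j)
    ~⇒≈ {i} {j} i<j ij = ≈⁺ (<⇒≤ (odd-< i<j))
      (trans (height-odd (toℕ i)) (trans (cong odd (odd#-block i<j ij)) (sym (height-odd (toℕ j)))))
      λ r i≤r r≤j → subst (_≤ height r) (sym (height-odd (toℕ i))) (low r i≤r r≤j)
      where
      low : ∀ r → odd (toℕ i) ≤ r → r ≤ odd (toℕ j) → odd (odd# (toℕ i)) ≤ height r
      low r i≤r r≤j with even⊎odd r
      ... | inj₂ (k , refl) = subst (odd (odd# (toℕ i)) ≤_) (sym (height-odd k)) (s≤s (dbl-≤ (subst (odd# (toℕ i) ≤_)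
              (cong odd# (Fin.toℕ-fromℕ< k<n)) (odd#-mono
                (subst (toℕ i ≤_) (sym (Fin.toℕ-fromℕ< k<n)) (dbl-≤⁻ (s≤s⁻¹ i≤r)))
                (subst (_≤ toℕ j) (sym (Fin.toℕ-fromℕ< k<n)) (dbl-≤⁻ (s≤s⁻¹ r≤j))) ij))))
        where
        k<n : k < n
        k<n = ≤-<-trans (dbl-≤⁻ (s≤s⁻¹ r≤j)) (Fin.toℕ<n j)
      ... | inj₁ (k , refl) = subst (odd (odd# (toℕ i)) ≤_) (sym (height-dbl k)) (<⇒≤ (dbl-≤ more))
        where
        i<k = odd-≤-dbl⁻ i≤r
        k≤j : k ≤ toℕ j
        k≤j = s≤s⁻¹ (odd-≤-dbl⁻ {k} {suc (toℕ j)} (s≤s r≤j))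
        more : suc (odd# (toℕ i)) ≤ even# k
        more with last-before i k i<k
        ... | c , i≤c , c<k , ic , none = size-strict (overOdd? (toℕ i)) (overEven? k)
          weaken c
          (c<k , (j , k≤j , ~-trans (~-sym ic) ij) , λ e c<e e<k q → none e c<e e<k (~-trans ic q))
          λ o → <⇒≱ (proj₁ o) i≤c
          where
          weaken : ∀ c′ → OverOdd (toℕ i) c′ → OverEven k c′
          weaken c′ o with OverOdd-in-block (<⇒≤ i<j) ≤-refl ij c′ o
          ... | _ , (d , j<d , c′d) , none-j = <-trans (proj₁ o) i<k , (d , ≤-trans k≤j (<⇒≤ j<d) , c′d) ,
            λ e c<e e<k → none-j e c<e (≤-trans (<⇒≤ e<k) k≤j)

    -- Let c be the last element of the block of i up to j; the cuts of i and c have equal height.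
    -- If c ≢ j, then either the arc leaving c passes over j and makes the cut of j higher, or no
    -- arc leaves c and the height drops right after c. Both contradict the equivalence.
    ≈⇒~ : ∀ {i j} → i Fin.< j → odd (toℕ i) ≈ odd (toℕ j) → i ~[ π ] j
    ≈⇒~ {i} {j} i<j h with j ∈? block π i
    ... | yes p = p
    ... | no ¬p with last-before i (suc (toℕ j)) (m≤n⇒m≤1+n i<j)
    ...   | c , i≤c , c≤j , ic , none with c Fin.≟ j
    ...     | yes refl = ic
    ...     | no c≢j with Fin.any? (λ d → (toℕ j <? toℕ d) ×-dec (d ∈? block π c))
    ...       | yes (d , j<d , cd) = contradiction (odd#≡ , more) λ (e , m) → <-irrefl e m
      where
      c<j = ≤∧≢⇒< (s≤s⁻¹ c≤j) (c≢j ∘ Fin.toℕ-injective)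
      more : odd# (toℕ c) < odd# (toℕ j)
      more = size-strict (overOdd? (toℕ c)) (overOdd? (toℕ j)) (OverOdd-in-block (<⇒≤ c<j) (<⇒≤ j<d) cd) c
        (c<j , (d , j<d , cd) , λ e c<e e≤j q → none e c<e (s≤s e≤j) (~-trans ic q))
        λ o → <-irrefl refl (proj₁ o)
      odd#≡ : odd# (toℕ c) ≡ odd# (toℕ j)
      odd#≡ = trans (sym (odd#-block-≤ i≤c ic)) (dbl-injective (suc-injective
        (trans (sym (height-odd (toℕ i))) (trans (≈⇒H≡ h) (height-odd (toℕ j))))))
    ...       | no ¬d = contradiction
        (proj₁ (h (dbl (suc (toℕ c))) (inj₁ (≤-trans (s≤s (dbl-≤ i≤c)) (n≤1+n _) , s≤s (<⇒≤ (odd-<-dbl c<j))))))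
        (<⇒≱ (subst₂ _<_ (sym (height-dbl (suc (toℕ c)))) (sym (trans (height-odd (toℕ i)) (cong odd (odd#-block-≤ i≤c ic))))
          (s≤s (dbl-≤ fewer))))
      where
      c<j = ≤∧≢⇒< (s≤s⁻¹ c≤j) (c≢j ∘ Fin.toℕ-injective)
      not-later : ∀ d → c Fin.< d → ¬ c ~[ π ] d
      not-later d c<d cd with toℕ d ≤? toℕ j
      ... | yes d≤j = none d c<d (s≤s d≤j) (~-trans ic cd)
      ... | no d≰j  = ¬d (d , ≰⇒> d≰j , cd)
      fewer : even# (suc (toℕ c)) ≤ odd# (toℕ c)
      fewer = size-mono (overEven? (suc (toℕ c))) (overOdd? (toℕ c)) λ c′ (c′≤c , (d , c<d , p) , none′) →
        ≤∧≢⇒< (s≤s⁻¹ c′≤c) (λ e → not-later d c<d (subst (_~[ π ] d) (Fin.toℕ-injective e) p)) ,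
        (d , c<d , p) , λ e c<e e≤c → none′ e c<e (s≤s e≤c)

    partition-height : partition height ≡ π
    partition-height = blocks-ext λ i j → mk⇔ (forth i j ∘ to (~-partition height i j)) (from (~-partition height i j) ∘ back i j)
      where
      forth : ∀ i j → odd (toℕ i) ≈ odd (toℕ j) → i ~[ π ] j
      forth i j h with Fin.<-cmp i j
      ... | tri< i<j _ _  = ≈⇒~ i<j h
      ... | tri≈ _ refl _ = ~-refl
      ... | tri> _ _ j<i  = ~-sym (≈⇒~ j<i (≈-sym {odd (toℕ i)} {odd (toℕ j)} h))
      back : ∀ i j → i ~[ π ] j → odd (toℕ i) ≈ odd (toℕ j)
      back i j p with Fin.<-cmp i j
      ... | tri< i<j _ _  = ~⇒≈ i<j p
      ... | tri≈ _ refl _ = ≈-refl {odd (toℕ i)}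
      ... | tri> _ _ j<i  = ≈-sym {odd (toℕ j)} {odd (toℕ i)} (~⇒≈ j<i (~-sym p))

-- Dyck words as codes for non-crossing partitions and matchings.

module DyckWords where

  open Sums
  open Components
  open Partitions
  open Levels
  open Heights
  open import Data.Fin using (Fin; zero; suc; toℕ; fromℕ<)
  import Data.Fin as Fin
  import Data.Fin.Properties as Fin
  open import Data.Fin.Subset using (Subset; ∣_∣; _∈_)
  open import Data.List using (List; []; _∷_; _++_; map; length; drop)
  import Data.List.Membership.Propositional as List
  import Data.List.Membership.Propositional.Properties as List
  open import Data.List.Properties using (∷-injective; ∷-injectiveʳ)
  open import Data.List.Relation.Unary.All using ([]; _∷_)
  open import Data.List.Relation.Unary.AllPairs as AllPairs using ([]; _∷_)
  open import Data.List.Relation.Unary.Any using (here)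
  open import Data.List.Relation.Unary.Unique.Propositional using (Unique)
  import Data.List.Relation.Unary.Unique.Propositional.Properties as Unique
  open import Data.Nat as ℕ using (ℕ; zero; suc; pred; _+_; _≤_; s≤s; z≤n)
  open import Data.Nat.Properties using (≤-refl; m≤m+n; m≤n⇒∃[o]m+o≡n; +-suc; +-identityʳ;
    suc-injective; +-cancelˡ-≤; m≢1+n+m; <⇒≤; <-irrefl; <-asym)
  open import Data.Vec as Vec using ([]; _∷_; lookup)
  open import Data.Vec.Properties using (lookup⇒[]=; []=⇒lookup)

  open Equivalence using (to; from)

  Word : Set
  Word = List Bool

  pattern U = true
  pattern D = false

  data Path : ℕ → Word → Set where
    []   : Path 0 []
    up   : ∀ {h w} → Path (suc h) w → Path h (U ∷ w)
    down : ∀ {h w} → Path h w → Path (suc h) (D ∷ w)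

  paths : ℕ → ℕ → List Word
  paths zero    zero    = [] ∷ []
  paths (suc h) zero    = []
  paths zero    (suc m) = map (U ∷_) (paths 1 m)
  paths (suc h) (suc m) = map (U ∷_) (paths (suc (suc h)) m) ++ map (D ∷_) (paths h m)

  ∈-paths⁻ : ∀ h m {w} → w List.∈ paths h m → Path h w × length w ≡ m
  ∈-paths⁻ zero    zero    (here refl) = [] , refl
  ∈-paths⁻ zero    (suc m) p with List.∈-map⁻ (U ∷_) p
  ... | w , q , refl with ∈-paths⁻ 1 m q
  ...   | r , refl = up r , refl
  ∈-paths⁻ (suc h) (suc m) p with List.∈-++⁻ (map (U ∷_) (paths (suc (suc h)) m)) p
  ... | inj₁ q with List.∈-map⁻ (U ∷_) q
  ...   | w , q , refl with ∈-paths⁻ (suc (suc h)) m q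
  ...     | r , refl = up r , refl
  ∈-paths⁻ (suc h) (suc m) p | inj₂ q with List.∈-map⁻ (D ∷_) q
  ...   | w , q , refl with ∈-paths⁻ h m q
  ...     | r , refl = down r , refl

  ∈-paths⁺ : ∀ {h w} → Path h w → w List.∈ paths h (length w)
  ∈-paths⁺ [] = here refl
  ∈-paths⁺ {zero}  (up p)   = List.∈-map⁺ (U ∷_) (∈-paths⁺ p)
  ∈-paths⁺ {suc h} (up p)   = List.∈-++⁺ˡ (List.∈-map⁺ (U ∷_) (∈-paths⁺ p))
  ∈-paths⁺ {suc h} (down {w = w} p) = List.∈-++⁺ʳ (map (U ∷_) (paths (suc (suc h)) (length w))) (List.∈-map⁺ (D ∷_) (∈-paths⁺ p))

  paths-unique : ∀ h m → Unique (paths h m)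
  paths-unique zero    zero    = [] ∷ []
  paths-unique (suc h) zero    = []
  paths-unique zero    (suc m) = Unique.map⁺ ∷-injectiveʳ (paths-unique 1 m)
  paths-unique (suc h) (suc m) = Unique.++⁺ (Unique.map⁺ ∷-injectiveʳ (paths-unique (suc (suc h)) m))
    (Unique.map⁺ ∷-injectiveʳ (paths-unique h m))
    λ (p , q) → disjoint (List.∈-map⁻ (U ∷_) p) (List.∈-map⁻ (D ∷_) q)
    where
    disjoint : ∀ {v : Word} {xs ys : List Word} → (∃ λ w → w List.∈ xs × v ≡ U ∷ w) → ¬ (∃ λ w → w List.∈ ys × v ≡ D ∷ w)
    disjoint (_ , _ , refl) (_ , _ , ())

  words : ℕ → List Word
  words = paths 0

  -- A down letter at height 0 is ignored; this does not occur on paths.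
  ht : ℕ → Word → ℕ → ℕ
  ht h w       zero    = h
  ht h []      (suc p) = h
  ht h (U ∷ w) (suc p) = ht (suc h) w p
  ht h (D ∷ w) (suc p) = ht (pred h) w p

  letter : Word → ℕ → Bool
  letter []      p       = D
  letter (b ∷ w) zero    = b
  letter (b ∷ w) (suc p) = letter w p

  letter-up : ∀ {h w} → Path h w → ∀ p → letter w p ≡ U → ht h w (suc p) ≡ suc (ht h w p)
  letter-up (up r)   zero    e = refl
  letter-up (up r)   (suc p) e = letter-up r p e
  letter-up (down r) (suc p) e = letter-up r p e

  letter-down : ∀ {h w} → Path h w → ∀ p → p ℕ.< length w → letter w p ≡ D → ht h w p ≡ suc (ht h w (suc p))
  letter-down (up r)   (suc p) (s≤s p<) e = letter-down r p p< e
  letter-down (down r) zero    p<       e = refl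
  letter-down (down r) (suc p) (s≤s p<) e = letter-down r p p< e

  letters-ext : ∀ {v w} → length v ≡ length w → (∀ p → p ℕ.< length v → letter v p ≡ letter w p) → v ≡ w
  letters-ext {[]}    {[]}    _ h = refl
  letters-ext {b ∷ v} {c ∷ w} l h = cong₂ _∷_ (h 0 (s≤s z≤n))
    (letters-ext (suc-injective l) λ p p< → h (suc p) (s≤s p<))

  path-unit : ∀ {h w} → Path h w → UnitSteps (length w) (ht h w)
  path-unit {h} {w} r p p< with letter w p in e
  ... | U = inj₁ (letter-up r p e)
  ... | D = inj₂ (letter-down r p p< e)

  path-end : ∀ {h w} → Path h w → ht h w (length w) ≡ 0
  path-end []       = refl
  path-end (up r)   = path-end r
  path-end (down r) = path-end r

  path-dyck : ∀ {w N} → Path 0 w → length w ≡ N → Dyck N (ht 0 w)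
  path-dyck r refl = record { start = refl ; stop = path-end r ; unit = path-unit r }

  wordOf : ℕ → (ℕ → ℕ) → Word
  wordOf zero    H = []
  wordOf (suc N) H = does (H 1 ℕ.≟ suc (H 0)) ∷ wordOf N (H ∘ suc)

  length-wordOf : ∀ N H → length (wordOf N H) ≡ N
  length-wordOf zero    H = refl
  length-wordOf (suc N) H = cong suc (length-wordOf N (H ∘ suc))

  descent : ∀ {a b : ℕ} → a ≡ suc b → b ≢ suc a
  descent {b = b} refl e = m≢1+n+m b {1} e

  wordOf-path : ∀ N {H} → UnitSteps N H → H N ≡ 0 → Path (H 0) (wordOf N H)
  wordOf-path zero    unit stop rewrite stop = []
  wordOf-path (suc N) {H} unit stop with unit 0 (s≤s z≤n) | wordOf-path N {H ∘ suc} (λ p p< → unit (suc p) (s≤s p<)) stop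
  ... | inj₁ e | r rewrite dec-true (H 1 ℕ.≟ suc (H 0)) e = up (subst (λ h → Path h (wordOf N (H ∘ suc))) e r)
  ... | inj₂ e | r rewrite dec-false (H 1 ℕ.≟ suc (H 0)) (descent e) = subst (λ h → Path h (D ∷ wordOf N (H ∘ suc))) (sym e) (down r)

  ht-wordOf : ∀ N {H} → UnitSteps N H → ∀ p → p ≤ N → ht (H 0) (wordOf N H) p ≡ H p
  ht-wordOf N       unit zero    _ = refl
  ht-wordOf (suc N) {H} unit (suc p) (s≤s p≤) with unit 0 (s≤s z≤n) | ht-wordOf N {H ∘ suc} (λ p p< → unit (suc p) (s≤s p<)) p p≤
  ... | inj₁ e | r rewrite dec-true (H 1 ℕ.≟ suc (H 0)) e = trans (cong (λ h → ht h (wordOf N (H ∘ suc)) p) (sym e)) r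
  ... | inj₂ e | r rewrite dec-false (H 1 ℕ.≟ suc (H 0)) (descent e) = trans (cong (λ h → ht (pred h) (wordOf N (H ∘ suc)) p) e) r

  ht-drop : ∀ h w p q → ht h w (p + q) ≡ ht (ht h w p) (drop p w) q
  ht-drop h w       zero    q       = refl
  ht-drop h []      (suc p) zero    = refl
  ht-drop h []      (suc p) (suc q) = refl
  ht-drop h (U ∷ w) (suc p) q       = ht-drop (suc h) w p q
  ht-drop h (D ∷ w) (suc p) q       = ht-drop (pred h) w p q

  ht-prefix : ∀ {k d} → Path k d → ∀ h s p → p ≤ length d → ht (h + k) (d ++ s) p ≡ h + ht k d p
  ht-prefix r                    h s zero    p≤       = refl
  ht-prefix {k} (up r)           h s (suc p) (s≤s p≤) rewrite sym (+-suc h k) = ht-prefix r h s p p≤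
  ht-prefix {suc k} (down r)     h s (suc p) (s≤s p≤) rewrite +-suc h k = ht-prefix r h s p p≤

  factor⇒≈ : ∀ w p {d s} → Path 0 d → drop p w ≡ d ++ s → Cuts._≈_ (ht 0 w) p (p + length d)
  factor⇒≈ w p {d} {s} r e = ≈⁺ (m≤m+n p _)
    (sym (trans (at _ ≤-refl) (trans (cong (ht 0 w p +_) (path-end r)) (+-identityʳ _))))
    λ q p≤q q≤ → low q (m≤n⇒∃[o]m+o≡n p≤q) q≤
    where
    open Cuts (ht 0 w)
    at : ∀ t → t ≤ length d → ht 0 w (p + t) ≡ ht 0 w p + ht 0 d t
    at t t≤ = trans (ht-drop 0 w p t) (trans (cong₂ (λ h v → ht h v t) (sym (+-identityʳ _)) e)
      (ht-prefix r (ht 0 w p) s t t≤))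
    low : ∀ q → (∃ λ t → p + t ≡ q) → q ≤ p + length d → ht 0 w p ≤ ht 0 w q
    low q (t , refl) q≤ = subst (ht 0 w p ≤_) (sym (at t (+-cancelˡ-≤ p _ _ q≤))) (m≤m+n _ _)

  module _ {n : ℕ} where

    ⟨_⟩ : Word → Blocks n
    ⟨ w ⟩ = partition (ht 0 w)

    module _ {w : Word} (w∈ : w List.∈ words (dbl n)) where
      private
        r = proj₁ (∈-paths⁻ 0 (dbl n) w∈)
        l = proj₂ (∈-paths⁻ 0 (dbl n) w∈)

      word-dyck : Dyck (dbl n) (ht 0 w)
      word-dyck = path-dyck r l

      U⇒hasLater : ∀ i → letter w (odd (toℕ i)) ≡ U → HasLater ⟨ w ⟩ i
      U⇒hasLater i e = up⇒hasLater word-dyck i (letter-up r _ e)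

      D⇒¬hasLater : ∀ i → letter w (odd (toℕ i)) ≡ D → ¬ HasLater ⟨ w ⟩ i
      D⇒¬hasLater i e = down⇒¬hasLater word-dyck i
        (letter-down r _ (subst (odd (toℕ i) ℕ.<_) (sym l) (odd-<-dbl (Fin.toℕ<n i))) e)

      D⇒hasEarlier : ∀ i → letter w (dbl (toℕ i)) ≡ D → HasEarlier ⟨ w ⟩ i
      D⇒hasEarlier i e = down⇒hasEarlier word-dyck i
        (letter-down r _ (subst (dbl (toℕ i) ℕ.<_) (sym l) (<⇒≤ (odd-<-dbl (Fin.toℕ<n i)))) e)

      U⇒¬hasEarlier : ∀ i → letter w (dbl (toℕ i)) ≡ U → ¬ HasEarlier ⟨ w ⟩ i
      U⇒¬hasEarlier i e = up⇒¬hasEarlier word-dyck i (letter-up r _ e)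

    ⟨⟩-injective : ∀ {v w} → v List.∈ words (dbl n) → w List.∈ words (dbl n) → ⟨ v ⟩ ≡ ⟨ w ⟩ → v ≡ w
    ⟨⟩-injective {v} {w} v∈ w∈ same = letters-ext (trans lv (sym lw)) λ p p< → letters p (subst (p ℕ.<_) lv p<)
      where
      lv = proj₂ (∈-paths⁻ 0 (dbl n) v∈)
      lw = proj₂ (∈-paths⁻ 0 (dbl n) w∈)
      rv = proj₁ (∈-paths⁻ 0 (dbl n) v∈)
      rw = proj₁ (∈-paths⁻ 0 (dbl n) w∈)
      not-both : ∀ {H : ℕ → ℕ} {p} → H (suc p) ≡ suc (H p) → ¬ H p ≡ suc (H (suc p))
      not-both u d = descent d u
      letters : ∀ p → p ℕ.< dbl n → letter v p ≡ letter w p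
      letters p p< with letter v p in ev | letter w p in ew
      ... | U | U = refl
      ... | D | D = refl
      ... | U | D = contradiction (letter-down rw p (subst (p ℕ.<_) (sym lw) p<) ew)
        (not-both {ht 0 w} {p} (partition-determines-steps (word-dyck v∈) (word-dyck w∈) same p p< (letter-up rv p ev)))
      ... | D | U = contradiction (letter-down rv p (subst (p ℕ.<_) (sym lv) p<) ev)
        (not-both {ht 0 v} {p} (partition-determines-steps (word-dyck w∈) (word-dyck v∈) (sym same) p p< (letter-up rw p ew)))

    -- The code is the word of the height function of π. The two height functions agree up to
    -- position dbl n only, but equivalence of two cuts looks at nothing beyond them.
    ⟨⟩-surjective : ∀ {π} → π List.∈ NC n → ∃ λ w → w List.∈ words (dbl n) × ⟨ w ⟩ ≡ π
    ⟨⟩-surjective {π} π∈ = w ,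
      subst (λ N → w List.∈ words N) (length-wordOf (dbl n) H) (∈-paths⁺ (subst (λ h → Path h w) start (wordOf-path (dbl n) unit stop))) ,
      trans (blocks-ext λ i j → record
        { to   = λ p → from (~-partition H i j) (Cuts.≈-cong (ht 0 w) (λ r r≤ → ht≡H r r≤) (cut≤ i) (cut≤ j) (to (~-partition (ht 0 w) i j) p))
        ; from = λ p → from (~-partition (ht 0 w) i j) (Cuts.≈-cong H (λ r r≤ → sym (ht≡H r r≤)) (cut≤ i) (cut≤ j) (to (~-partition H i j) p))
        ; to-cong = cong _ ; from-cong = cong _ })
        (partition-height nc)
      where
      nc = ∈NC⁻ π∈
      H = height nc
      open Dyck (height-dyck nc)
      w = wordOf (dbl n) H
      ht≡H : ∀ r → r ≤ dbl n → ht 0 w r ≡ H r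
      ht≡H r r≤ = trans (cong (λ h → ht h w r) (sym start)) (ht-wordOf (dbl n) unit r r≤)
      cut≤ : ∀ (i : Fin n) → odd (toℕ i) ≤ dbl n
      cut≤ i = <⇒≤ (odd-<-dbl (Fin.toℕ<n i))

    -- `⟨_⟩` is a bijection from the Dyck words onto NC n, so averages over NC n become averages
    -- over words.
    ∑-NC : (f : Blocks n → ℕ) → ∑ (NC n) f ≡ ∑ (words (dbl n)) (f ∘ ⟨_⟩)
    ∑-NC f = trans (∑-set NC-unique (map-unique ⟨_⟩ ⟨⟩-injective (paths-unique 0 (dbl n))) forth back f)
      (∑-map ⟨_⟩ (words (dbl n)) f)
      where
      forth : ∀ {π} → π List.∈ NC n → π List.∈ map ⟨_⟩ (words (dbl n))
      forth π∈ = let w , w∈ , e = ⟨⟩-surjective π∈ in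
        subst (List._∈ map ⟨_⟩ (words (dbl n))) e (List.∈-map⁺ ⟨_⟩ w∈)
      back : ∀ {π} → π List.∈ map ⟨_⟩ (words (dbl n)) → π List.∈ NC n
      back p = let w , _ , e = List.∈-map⁻ ⟨_⟩ p in
        subst (List._∈ NC n) (sym e) (partition∈NC (ht 0 w))

  -- A non-crossing matching, with openers U and closers D, is the non-crossing partition
  -- of the doubled word.
  double : Word → Word
  double []      = []
  double (b ∷ w) = b ∷ b ∷ double w

  length-double : ∀ w → length (double w) ≡ dbl (length w)
  length-double []      = refl
  length-double (b ∷ w) = cong (2 +_) (length-double w)

  double-path⁺ : ∀ {h w} → Path h w → Path (dbl h) (double w)
  double-path⁺ []       = []
  double-path⁺ (up r)   = up (up (double-path⁺ r))
  double-path⁺ (down r) = down (down (double-path⁺ r))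

  double-path⁻ : ∀ h {w} → Path (dbl h) (double w) → Path h w
  double-path⁻ zero    {[]}    []              = []
  double-path⁻ h       {U ∷ w} (up (up r))     = up (double-path⁻ (suc h) r)
  double-path⁻ (suc h) {D ∷ w} (down (down r)) = down (double-path⁻ h r)

  double-injective : ∀ {v w} → double v ≡ double w → v ≡ w
  double-injective {[]}    {[]}    e = refl
  double-injective {b ∷ v} {c ∷ w} e with ∷-injective e
  ... | refl , e′ = cong (b ∷_) (double-injective (∷-injectiveʳ e′))

  double-++ : ∀ v w → double (v ++ w) ≡ double v ++ double w
  double-++ []      w = refl
  double-++ (b ∷ v) w = cong (λ x → b ∷ b ∷ x) (double-++ v w)

  letter-double-even : ∀ w i → letter (double w) (dbl i) ≡ letter w i
  letter-double-even []      i       = refl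
  letter-double-even (b ∷ w) zero    = refl
  letter-double-even (b ∷ w) (suc i) = letter-double-even w i

  letter-double-odd : ∀ w i → letter (double w) (odd i) ≡ letter w i
  letter-double-odd []      i       = refl
  letter-double-odd (b ∷ w) zero    = refl
  letter-double-odd (b ∷ w) (suc i) = letter-double-odd w i

  undouble : ∀ m v → length v ≡ dbl m → (∀ i → i ℕ.< m → letter v (dbl i) ≡ letter v (odd i)) →
             ∃ λ w → length w ≡ m × double w ≡ v
  undouble zero    []          l h = [] , refl , refl
  undouble (suc m) (b ∷ c ∷ v) l h with h 0 (s≤s z≤n) | undouble m v (suc-injective (suc-injective l)) (λ i i<m → h (suc i) (s≤s i<m))
  ... | refl | w , refl , refl = b ∷ w , refl , refl

  ∣∣≡count : ∀ {n} (p : Subset n) → ∣ p ∣ ≡ count (lookup p)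
  ∣∣≡count []          = refl
  ∣∣≡count (true ∷ p)  = cong suc (∣∣≡count p)
  ∣∣≡count (false ∷ p) = ∣∣≡count p

  count-positive : ∀ {n k} (P : Fin n → Bool) → count P ≡ suc k → ∃ λ i → P i ≡ true
  count-positive {suc n} P e with P zero in P0
  ... | true  = zero , P0
  ... | false with count-positive (P ∘ suc) e
  ...   | i , Pi = suc i , Pi

  count-zero⁻ : ∀ {n} (P : Fin n → Bool) → count P ≡ 0 → ∀ i → P i ≢ true
  count-zero⁻ P e i Pi with trans (sym (count-remove P i Pi)) e
  ... | ()

  count-zero⁺ : ∀ {n} (P : Fin n → Bool) → (∀ i → P i ≢ true) → count P ≡ 0
  count-zero⁺ P h with count P in e
  ... | zero  = refl
  ... | suc k = contradiction (proj₂ (count-positive P e)) (h _)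

  count-two⁺ : ∀ {n} (P : Fin n → Bool) {i j} → P i ≡ true → P j ≡ true → j ≢ i →
               (∀ k → P k ≡ true → k ≡ i ⊎ k ≡ j) → count P ≡ 2
  count-two⁺ P {i} {j} Pi Pj j≢i only = trans (count-remove P i Pi) (cong suc
    (trans (count-remove (P ∖ i) j (∖⁺ P Pj j≢i)) (cong suc (count-zero⁺ ((P ∖ i) ∖ j) none))))
    where
    none : ∀ k → ((P ∖ i) ∖ j) k ≢ true
    none k e with ∖⁻ (P ∖ i) e
    ... | e′ , k≢j with ∖⁻ P e′
    ...   | Pk , k≢i with only k Pk
    ...     | inj₁ k≡i = k≢i k≡i
    ...     | inj₂ k≡j = k≢j k≡j

  count-two⁻ : ∀ {n} (P : Fin n → Bool) {i} → P i ≡ true → count P ≡ 2 →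
               ∃ λ j → P j ≡ true × j ≢ i × (∀ k → P k ≡ true → k ≡ i ⊎ k ≡ j)
  count-two⁻ P {i} Pi e with count-positive (P ∖ i) (suc-injective (trans (sym (count-remove P i Pi)) e))
  ... | j , q with ∖⁻ P q
  ...   | Pj , j≢i = j , Pj , j≢i , only
    where
    rest : count ((P ∖ i) ∖ j) ≡ 0
    rest = suc-injective (trans (sym (count-remove (P ∖ i) j q)) (suc-injective (trans (sym (count-remove P i Pi)) e)))
    only : ∀ k → P k ≡ true → k ≡ i ⊎ k ≡ j
    only k Pk with k Fin.≟ i | k Fin.≟ j
    ... | yes k≡i | _       = inj₁ k≡i
    ... | _       | yes k≡j = inj₂ k≡j
    ... | no k≢i  | no k≢j  = contradiction (∖⁺ (P ∖ i) (∖⁺ P Pk k≢i) k≢j) (count-zero⁻ _ rest k)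

  module _ {m : ℕ} {π : Blocks m} (nc : IsNC π) where
    open IsNC nc

    OneSided : Set
    OneSided = ∀ i → (HasLater π i × ¬ HasEarlier π i) ⊎ (HasEarlier π i × ¬ HasLater π i)

    private
      mem : ∀ {i j} → i ~[ π ] j → lookup (block π i) j ≡ true
      mem = []=⇒lookup
      mem⁻ : ∀ {i j} → lookup (block π i) j ≡ true → i ~[ π ] j
      mem⁻ = lookup⇒[]= _ _

    -- A third element in a block would give the middle one partners on both sides, which `first`
    -- rules out.
    oneSided⇒matching : OneSided → IsMatching π
    oneSided⇒matching one i = trans (∣∣≡count (block π i)) (two (one i))
      where
      first : ∀ {x} → HasEarlier π x → ¬ HasLater π x
      first {x} e l with one x
      ... | inj₁ (_ , ¬e) = ¬e e
      ... | inj₂ (_ , ¬l) = ¬l l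
      two : _ → count (lookup (block π i)) ≡ 2
      two (inj₁ ((j , i<j , p) , ¬e)) = count-two⁺ (lookup (block π i)) (mem ~-refl) (mem p) (λ { refl → <-irrefl refl i<j })
        λ k q → case k (mem⁻ q)
        where
        case : ∀ k → i ~[ π ] k → k ≡ i ⊎ k ≡ j
        case k q with Fin.<-cmp k i | Fin.<-cmp j k
        ... | tri< k<i _ _ | _ = contradiction (k , k<i , q) ¬e
        ... | tri≈ _ k≡i _ | _ = inj₁ k≡i
        ... | tri> _ _ i<k | tri≈ _ j≡k _ = inj₂ (sym j≡k)
        ... | tri> _ _ i<k | tri< j<k _ _ = contradiction (k , j<k , ~-trans (~-sym p) q) (first (i , i<j , ~-sym p))
        ... | tri> _ _ i<k | tri> _ _ k<j = contradiction (j , k<j , ~-trans (~-sym q) p) (first (i , i<k , ~-sym q))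
      two (inj₂ ((j , j<i , p) , ¬l)) = count-two⁺ (lookup (block π i)) (mem ~-refl) (mem p) (λ { refl → <-irrefl refl j<i })
        λ k q → case k (mem⁻ q)
        where
        case : ∀ k → i ~[ π ] k → k ≡ i ⊎ k ≡ j
        case k q with Fin.<-cmp i k | Fin.<-cmp j k
        ... | tri< i<k _ _ | _ = contradiction (k , i<k , q) ¬l
        ... | tri≈ _ i≡k _ | _ = inj₁ (sym i≡k)
        ... | tri> _ _ k<i | tri≈ _ j≡k _ = inj₂ (sym j≡k)
        ... | tri> _ _ k<i | tri< j<k _ _ = contradiction (i , k<i , ~-sym q) (first (j , j<k , ~-trans (~-sym q) p))
        ... | tri> _ _ k<i | tri> _ _ k<j = contradiction (i , j<i , ~-sym p) (first (k , k<j , ~-trans (~-sym p) q))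

    matching⇒oneSided : IsMatching π → OneSided
    matching⇒oneSided mat i with count-two⁻ (lookup (block π i)) (mem ~-refl) (trans (sym (∣∣≡count (block π i))) (mat i))
    ... | j , q , j≢i , only with Fin.<-cmp i j
    ...   | tri≈ _ i≡j _ = contradiction (sym i≡j) j≢i
    ...   | tri< i<j _ _ = inj₁ ((j , i<j , mem⁻ q) , ¬e)
      where
      ¬e : ¬ HasEarlier π i
      ¬e (k , k<i , p) with only k (mem p)
      ... | inj₁ refl = <-irrefl refl k<i
      ... | inj₂ refl = <-asym k<i i<j
    ...   | tri> _ _ j<i = inj₂ ((j , j<i , mem⁻ q) , ¬l)
      where
      ¬l : ¬ HasLater π i
      ¬l (k , i<k , p) with only k (mem p)
      ... | inj₁ refl = <-irrefl refl i<k
      ... | inj₂ refl = <-asym j<i i<k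

  module _ {m : ℕ} where

    ⟪_⟫ : Word → Blocks m
    ⟪ w ⟫ = ⟨ double w ⟩

    double∈words : ∀ {w} → w List.∈ words m → double w List.∈ words (dbl m)
    double∈words {w} w∈ with ∈-paths⁻ 0 m w∈
    ... | r , refl = subst (λ N → double w List.∈ words N) (length-double w) (∈-paths⁺ (double-path⁺ r))

    ⟪⟫∈NCMatchings : ∀ {w} → w List.∈ words m → ⟪ w ⟫ List.∈ NCMatchings m
    ⟪⟫∈NCMatchings {w} w∈ = List.∈-filter⁺ isMatching? v∈NC (oneSided⇒matching (∈NC⁻ v∈NC) one)
      where
      v∈ = double∈words w∈
      v∈NC = partition∈NC (ht 0 (double w))
      one : OneSided (∈NC⁻ v∈NC)
      one i with letter w (toℕ i) in e
      ... | U = inj₁ (U⇒hasLater v∈ i (trans (letter-double-odd w (toℕ i)) e) , U⇒¬hasEarlier v∈ i (trans (letter-double-even w (toℕ i)) e))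
      ... | D = inj₂ (D⇒hasEarlier v∈ i (trans (letter-double-even w (toℕ i)) e) , D⇒¬hasLater v∈ i (trans (letter-double-odd w (toℕ i)) e))

    -- In a matching each point is an opener or a closer, so the steps before and after its cut have
    -- the same direction and the word of the partition is a doubled one.
    ⟪⟫-surjective : ∀ {π} → π List.∈ NCMatchings m → ∃ λ w → w List.∈ words m × ⟪ w ⟫ ≡ π
    ⟪⟫-surjective {π} π∈ = undoubled (⟨⟩-surjective (proj₁ π∈NC))
      where
      π∈NC = List.∈-filter⁻ isMatching? {xs = NC m} π∈
      one = matching⇒oneSided (∈NC⁻ (proj₁ π∈NC)) (proj₂ π∈NC)
      undoubled : (∃ λ v → v List.∈ words (dbl m) × ⟨ v ⟩ ≡ π) → ∃ λ w → w List.∈ words m × ⟪ w ⟫ ≡ π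
      undoubled (v , v∈ , refl) = build (undouble m v (proj₂ (∈-paths⁻ 0 (dbl m) v∈)) λ i i<m →
        subst (λ i → letter v (dbl i) ≡ letter v (odd i)) (Fin.toℕ-fromℕ< i<m) (paired (fromℕ< i<m)))
        where
        paired : ∀ i → letter v (dbl (toℕ i)) ≡ letter v (odd (toℕ i))
        paired i with letter v (dbl (toℕ i)) in e | letter v (odd (toℕ i)) in o | one i
        ... | U | U | _ = refl
        ... | D | D | _ = refl
        ... | U | D | inj₁ (l , _) = contradiction l (D⇒¬hasLater v∈ i o)
        ... | U | D | inj₂ (e′ , _) = contradiction e′ (U⇒¬hasEarlier v∈ i e)
        ... | D | U | inj₁ (_ , ¬e) = contradiction (D⇒hasEarlier v∈ i e) ¬e
        ... | D | U | inj₂ (_ , ¬l) = contradiction (U⇒hasLater v∈ i o) ¬l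
        build : (∃ λ w → length w ≡ m × double w ≡ v) → ∃ λ w → w List.∈ words m × ⟪ w ⟫ ≡ ⟨ v ⟩
        build (w , refl , refl) = w , ∈-paths⁺ (double-path⁻ 0 (proj₁ (∈-paths⁻ 0 (dbl m) v∈))) , refl

    ∑-NCMatchings : (f : Blocks m → ℕ) → ∑ (NCMatchings m) f ≡ ∑ (words m) (f ∘ ⟪_⟫)
    ∑-NCMatchings f = trans (∑-set (Unique.filter⁺ isMatching? NC-unique)
        (map-unique ⟪_⟫ (λ v∈ w∈ e → double-injective (⟨⟩-injective {m} (double∈words v∈) (double∈words w∈) e)) (paths-unique 0 m))
        forth back f)
      (∑-map ⟪_⟫ (words m) f)
      where
      forth : ∀ {π} → π List.∈ NCMatchings m → π List.∈ map ⟪_⟫ (words m)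
      forth π∈ = let w , w∈ , e = ⟪⟫-surjective π∈ in
        subst (List._∈ map ⟪_⟫ (words m)) e (List.∈-map⁺ ⟪_⟫ w∈)
      back : ∀ {π} → π List.∈ map ⟪_⟫ (words m) → π List.∈ NCMatchings m
      back p = let w , w∈ , e = List.∈-map⁻ ⟪_⟫ p in
        subst (List._∈ NCMatchings m) (sym e) (⟪⟫∈NCMatchings w∈)

-- Catalan numbers, common balanced factors and the renewal inequality.

module Renewal where

  open Sums
  open Levels using (dbl; dbl-≤; dbl-+)
  open DyckWords using (Word; Path; []; up; down; paths; words; ∈-paths⁻; ∈-paths⁺; paths-unique)
  open import Data.Bool using (T)
  open import Data.Bool.Properties using (∧-zeroʳ; ∨-zeroʳ)
  open import Data.List using (List; []; _∷_; _++_; map; length; drop; filter; cartesianProduct)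
  open import Data.List.Membership.Propositional using (_∈_)
  open import Data.List.Membership.Propositional.Properties using (∈-filter⁻; ∈-cartesianProduct⁻;
    ∈-cartesianProduct⁺; ∈-map⁺; ∈-map⁻)
  open import Data.List.Properties using (length-++; length-map; ∷-injective; ++-identityʳ)
  open import Data.List.Relation.Unary.All using ([]; _∷_)
  open import Data.List.Relation.Unary.AllPairs using ([]; _∷_)
  open import Data.List.Relation.Unary.Unique.Propositional using (Unique)
  import Data.List.Relation.Unary.Unique.Propositional.Properties as Unique
  open import Data.Nat using (ℕ; zero; suc; _+_; _*_; _∸_; _^_; _≤_; _<_; _!; _/_; _≟_; _≡ᵇ_;
    _≤ᵇ_; s≤s; z≤n; >-nonZero)
  open import Data.Nat.DivMod using (m*n/n≡m)
  open import Data.Nat.Properties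
  open import Data.Nat.Solver using (module +-*-Solver)
  open +-*-Solver using (solve; _:=_; _:+_; _:*_; con)

  dbl≡+ : ∀ i → dbl i ≡ i + i
  dbl≡+ zero    = refl
  dbl≡+ (suc i) = cong suc (trans (cong suc (dbl≡+ i)) (sym (+-suc i i)))

  paths-short : ∀ h m → m < h → length (paths h m) ≡ 0
  paths-short (suc h) zero    _         = refl
  paths-short (suc h) (suc m) (s≤s m<h) = trans (length-++ (map (true ∷_) (paths (suc (suc h)) m)))
    (cong₂ _+_ (trans (length-map _ (paths (suc (suc h)) m)) (paths-short (suc (suc h)) m (m≤n⇒m≤1+n (m≤n⇒m≤1+n m<h))))
               (trans (length-map _ (paths h m)) (paths-short h m m<h)))

  paths-suc-suc : ∀ h m → length (paths (suc h) (suc m)) ≡ length (paths (suc (suc h)) m) + length (paths h m)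
  paths-suc-suc h m = trans (length-++ (map (true ∷_) (paths (suc (suc h)) m)))
    (cong₂ _+_ (length-map _ (paths (suc (suc h)) m)) (length-map _ (paths h m)))

  -- The ballot number (h + 1) m! / (d! (h + d + 1)!) for paths from height h to 0 with d up steps,
  -- cleared of denominators. Splitting off the leading letter gives the recursion.
  ballot : ∀ h d {m} → m ≡ d + d + h → length (paths h m) * (d ! * suc (h + d) !) ≡ suc h * m !
  ballot zero    zero    refl = refl
  ballot (suc h) zero    refl = begin
    length (paths (suc h) (suc h)) * (1 * suc (suc h + 0) !) ≡⟨ cong₂ _*_ one (trans (*-identityˡ _) (cong (λ k → suc k !) (+-identityʳ (suc h)))) ⟩
    1 * (suc (suc h) !)                            ≡⟨ *-identityˡ _ ⟩
    suc (suc h) * (suc h !)                        ∎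
    where
    open ≡-Reasoning
    straight : ∀ h → length (paths h h) ≡ 1
    straight zero    = refl
    straight (suc h) = trans (paths-suc-suc h h) (cong₂ _+_ (paths-short (suc (suc h)) h (s≤s (n≤1+n h))) (straight h))
    one = straight (suc h)
  ballot zero (suc d) {suc m} e = begin
    length (map (true ∷_) (paths 1 m)) * (suc d ! * suc (suc d) !)
      ≡⟨ cong (_* (suc d ! * suc (suc d) !)) (length-map _ (paths 1 m)) ⟩
    L * ((suc d * d !) * (suc (suc d) !))
      ≡⟨ solve 4 (λ l d f g → l :* (((con 1 :+ d) :* f) :* g) := (con 1 :+ d) :* (l :* (f :* g))) refl L d (d !) (suc (suc d) !) ⟩
    suc d * (L * (d ! * suc (suc d) !))
      ≡⟨ cong (suc d *_) (ballot 1 d m≡) ⟩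
    suc d * (2 * (m !))
      ≡⟨ solve 2 (λ d f → (con 1 :+ d) :* (con 2 :* f) := con 1 :* ((con 1 :+ (d :+ d :+ con 1)) :* f)) refl d (m !) ⟩
    1 * (suc (d + d + 1) * m !)
      ≡⟨ cong (λ k → 1 * (suc k * m !)) m≡ ⟨
    1 * (suc m * m !) ∎
    where
    open ≡-Reasoning
    L = length (paths 1 m)
    m≡ : m ≡ d + d + 1
    m≡ = suc-injective (trans e (solve 1 (λ d → (con 1 :+ d) :+ (con 1 :+ d) :+ con 0 := con 1 :+ (d :+ d :+ con 1)) refl d))
  ballot (suc h) (suc d) {suc m} e = begin
    length (paths (suc h) (suc m)) * (suc d ! * suc (suc h + suc d) !)
      ≡⟨ cong₂ (λ l k → l * (suc d ! * suc k !)) (paths-suc-suc h m) (cong suc (+-suc h d)) ⟩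
    (A + B) * ((suc d * d !) * (suc (suc (suc (h + d))) * suc (suc (h + d)) !))
      ≡⟨ solve 6 (λ a b h d f g →
           (a :+ b) :* (((con 1 :+ d) :* f) :* ((con 3 :+ (h :+ d)) :* g)) :=
           (con 1 :+ d) :* (a :* (f :* ((con 3 :+ (h :+ d)) :* g))) :+ (con 3 :+ (h :+ d)) :* (b :* (((con 1 :+ d) :* f) :* g)))
         refl A B h d (d !) (suc (suc (h + d)) !) ⟩
    suc d * (A * (d ! * suc (suc (suc (h + d))) !)) + suc (suc (suc (h + d))) * (B * (suc d ! * suc (suc (h + d)) !))
      ≡⟨ cong₂ (λ x y → suc d * x + suc (suc (suc (h + d))) * y)
           (ballot (suc (suc h)) d m≡)
           (trans (cong (λ k → B * (suc d ! * suc k !)) (sym (+-suc h d)))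
             (ballot h (suc d) (trans m≡ (solve 2 (λ h d → d :+ d :+ (con 2 :+ h) := (con 1 :+ d) :+ (con 1 :+ d) :+ h) refl h d)))) ⟩
    suc d * (suc (suc (suc h)) * m !) + suc (suc (suc (h + d))) * (suc h * m !)
      ≡⟨ solve 3 (λ h d f →
           (con 1 :+ d) :* ((con 3 :+ h) :* f) :+ (con 3 :+ (h :+ d)) :* ((con 1 :+ h) :* f) :=
           (con 2 :+ h) :* ((con 1 :+ (d :+ d :+ (con 2 :+ h))) :* f))
         refl h d (m !) ⟩
    suc (suc h) * (suc (d + d + suc (suc h)) * m !)
      ≡⟨ cong (λ k → suc (suc h) * (suc k * m !)) m≡ ⟨
    suc (suc h) * (suc m * m !) ∎
    where
    open ≡-Reasoning
    A = length (paths (suc (suc h)) m)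
    B = length (paths h m)
    m≡ : m ≡ d + d + suc (suc h)
    m≡ = suc-injective (trans e (solve 2 (λ h d → (con 1 :+ d) :+ (con 1 :+ d) :+ (con 1 :+ h) := con 1 :+ (d :+ d :+ (con 2 :+ h))) refl h d))

  cat : ℕ → ℕ
  cat n = length (words (dbl n))

  cat-! : ∀ d → cat d * (d ! * suc d !) ≡ dbl d !
  cat-! d = trans (ballot 0 d (trans (dbl≡+ d) (sym (+-identityʳ _)))) (*-identityˡ _)

  cat-suc : ∀ d → cat (suc d) * suc (suc d) ≡ (4 * d + 2) * cat d
  cat-suc d = *-cancelʳ-≡ _ _ (suc d * (d ! * suc d !)) {{m*n≢0 (suc d) _ {{_}} {{d !* suc d !≢0}}}} (begin
    c⁺ * suc (suc d) * (suc d * (d ! * suc d !))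
      ≡⟨ solve 4 (λ c d f g → c :* (con 2 :+ d) :* ((con 1 :+ d) :* (f :* g)) := c :* (((con 1 :+ d) :* f) :* ((con 2 :+ d) :* g)))
         refl c⁺ d (d !) (suc d !) ⟩
    c⁺ * (suc d ! * suc (suc d) !)
      ≡⟨ cat-! (suc d) ⟩
    suc (suc (dbl d)) * (suc (dbl d) * dbl d !)
      ≡⟨ cong₂ (λ k x → suc (suc k) * (suc k * x)) (dbl≡+ d) (sym (cat-! d)) ⟩
    suc (suc (d + d)) * (suc (d + d) * (cat d * (d ! * suc d !)))
      ≡⟨ solve 3 (λ c d x → (con 2 :+ (d :+ d)) :* ((con 1 :+ (d :+ d)) :* (c :* x)) := (con 4 :* d :+ con 2) :* c :* ((con 1 :+ d) :* x))
         refl (cat d) d (d ! * suc d !) ⟩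
    (4 * d + 2) * cat d * (suc d * (d ! * suc d !)) ∎)
    where
    open ≡-Reasoning
    c⁺ = cat (suc d)

  -- From the recurrence and 4 d + 2 ≤ 4 (d + 2). Squared, this is the factor 16 per unit of
  -- semilength.
  cat-suc-≤ : ∀ d → cat (suc d) ≤ 4 * cat d
  cat-suc-≤ d = *-cancelʳ-≤ _ _ (suc (suc d)) (begin
    cat (suc d) * suc (suc d) ≡⟨ cat-suc d ⟩
    (4 * d + 2) * cat d       ≤⟨ *-monoˡ-≤ (cat d) (m≤m+n (4 * d + 2) 6) ⟩
    (4 * d + 2 + 6) * cat d   ≡⟨ solve 2 (λ c d → (con 4 :* d :+ con 2 :+ con 6) :* c := con 4 :* c :* (con 2 :+ d)) refl (cat d) d ⟩
    4 * cat d * suc (suc d)   ∎)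
    where
    open ≤-Reasoning

  cat-+-≤ : ∀ j n → cat (j + n) * cat (j + n) ≤ 16 ^ j * (cat n * cat n)
  cat-+-≤ zero    n = ≤-reflexive (sym (*-identityˡ _))
  cat-+-≤ (suc j) n = begin
    cat (suc (j + n)) * cat (suc (j + n))     ≤⟨ *-mono-≤ (cat-suc-≤ (j + n)) (cat-suc-≤ (j + n)) ⟩
    4 * cat (j + n) * (4 * cat (j + n))       ≡⟨ solve 1 (λ c → con 4 :* c :* (con 4 :* c) := con 16 :* (c :* c)) refl (cat (j + n)) ⟩
    16 * (cat (j + n) * cat (j + n))          ≤⟨ *-monoʳ-≤ 16 (cat-+-≤ j n) ⟩
    16 * (16 ^ j * (cat n * cat n))           ≡⟨ *-assoc 16 (16 ^ j) _ ⟨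
    16 ^ suc j * (cat n * cat n)              ∎
    where
    open ≤-Reasoning

  balanced : ℕ → ℕ → Word → Bool
  balanced h       zero    v           = h ≡ᵇ 0
  balanced h       (suc t) []          = false
  balanced h       (suc t) (true ∷ v)  = balanced (suc h) t v
  balanced zero    (suc t) (false ∷ v) = false
  balanced (suc h) (suc t) (false ∷ v) = balanced h t v

  balanced⁻ : ∀ h t v → balanced h t v ≡ true → ∃₂ λ d s → v ≡ d ++ s × length d ≡ t × Path h d
  balanced⁻ zero    zero    v           e = [] , v , refl , refl , []
  balanced⁻ h       (suc t) (true ∷ v)  e with balanced⁻ (suc h) t v e
  ... | d , s , refl , refl , r = true ∷ d , s , refl , refl , up r
  balanced⁻ (suc h) (suc t) (false ∷ v) e with balanced⁻ h t v e
  ... | d , s , refl , refl , r = false ∷ d , s , refl , refl , down r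

  balanced⁺ : ∀ {h d} → Path h d → ∀ s → balanced h (length d) (d ++ s) ≡ true
  balanced⁺ []             s = refl
  balanced⁺ (up r)         s = balanced⁺ r s
  balanced⁺ (down r)       s = balanced⁺ r s

  balanced-prefix : ∀ h t d s → t ≤ length d → balanced h t (d ++ s) ≡ balanced h t d
  balanced-prefix h       zero    d           s _ = refl
  balanced-prefix h       (suc t) (true ∷ d)  s (s≤s t≤) = balanced-prefix (suc h) t d s t≤
  balanced-prefix zero    (suc t) (false ∷ d) s (s≤s t≤) = refl
  balanced-prefix (suc h) (suc t) (false ∷ d) s (s≤s t≤) = balanced-prefix h t d s t≤

  path-++ : ∀ {h k d w} → Path k d → Path h w → Path (k + h) (d ++ w)
  path-++ []       q = q
  path-++ (up r)   q = up (path-++ r q)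
  path-++ (down r) q = down (path-++ r q)

  path-drop : ∀ {h k} d {w} → Path k d → Path (k + h) (d ++ w) → Path h w
  path-drop []          []       q        = q
  path-drop (true ∷ d)  (up r)   (up q)   = path-drop d r q
  path-drop (false ∷ d) (down r) (down q) = path-drop d r q

  -- For p beyond the end of w the word d is appended, so that inserting a balanced d preserves
  -- paths for every p.
  insert : ℕ → Word → Word → Word
  insert zero    d w       = d ++ w
  insert (suc p) d []      = d
  insert (suc p) d (b ∷ w) = b ∷ insert p d w

  insert-path : ∀ p {h d w} → Path 0 d → Path h w → Path h (insert p d w)
  insert-path zero    r q        = path-++ r q
  insert-path (suc p) r []       = r
  insert-path (suc p) r (up q)   = up (insert-path p r q)
  insert-path (suc p) r (down q) = down (insert-path p r q)

  length-insert : ∀ p d w → length (insert p d w) ≡ length d + length w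
  length-insert zero    d w       = length-++ d
  length-insert (suc p) d []      = sym (+-identityʳ _)
  length-insert (suc p) d (b ∷ w) = trans (cong suc (length-insert p d w)) (sym (+-suc _ _))

  drop-insert : ∀ p d w → p ≤ length w → drop p (insert p d w) ≡ d ++ drop p w
  drop-insert zero    d w       _        = refl
  drop-insert (suc p) d (b ∷ w) (s≤s p≤) = drop-insert p d w p≤

  ++-injective : ∀ (d d′ : Word) {w w′} → length d ≡ length d′ → d ++ w ≡ d′ ++ w′ → d ≡ d′ × w ≡ w′
  ++-injective []      []       l e = refl , e
  ++-injective (b ∷ d) (c ∷ d′) l e with ∷-injective e
  ... | refl , e′ with ++-injective d d′ (suc-injective l) e′
  ...   | refl , e″ = refl , e″

  insert-injective : ∀ p {d d′ w w′} → length d ≡ length d′ → p ≤ length w → p ≤ length w′ →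
                     insert p d w ≡ insert p d′ w′ → d ≡ d′ × w ≡ w′
  insert-injective zero    {d} {d′} l _ _ e = ++-injective d d′ l e
  insert-injective (suc p) {w = b ∷ w} {c ∷ w′} l (s≤s p≤) (s≤s p≤′) e with ∷-injective e
  ... | refl , e′ with insert-injective p l p≤ p≤′ e′
  ...   | refl , refl = refl , refl

  ∑-⊆-support : {A : Set} {xs ys : List A} (f : A → ℕ) → Unique xs → (∀ {x} → x ∈ xs → f x ≢ 0 → x ∈ ys) →
                ∑ xs f ≤ ∑ ys f
  ∑-⊆-support {xs = xs} {ys} f u sub = ≤-trans (≤-reflexive (drop-zeros xs))
    (∑-⊆ (Unique.filter⁺ supp? u) (λ p → let x∈ , nz = ∈-filter⁻ supp? {xs = xs} p in sub x∈ nz) f)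
    where
    supp? = λ x → ¬? (f x ≟ 0)
    drop-zeros : ∀ xs → ∑ xs f ≡ ∑ (filter supp? xs) f
    drop-zeros [] = refl
    drop-zeros (x ∷ xs) with f x in e
    ... | zero  = drop-zeros xs
    ... | suc k = cong₂ _+_ (sym e) (drop-zeros xs)

  module _ (p j r : ℕ) where

    -- Dyck words of semilength j + r with a balanced factor of length 2 j at cut p, each listed
    -- once if p ≤ dbl r.
    insertions : List Word
    insertions = map (uncurry (insert p)) (cartesianProduct (words (dbl j)) (words (dbl r)))

    ∑-insertions : (f : Word → ℕ) →
      ∑ insertions f ≡ ∑ (words (dbl j)) λ d → ∑ (words (dbl r)) λ w → f (insert p d w)
    ∑-insertions f = trans (∑-map (uncurry (insert p)) (cartesianProduct (words (dbl j)) (words (dbl r))) f)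
      (∑-cartesian (words (dbl j)) (words (dbl r)) (λ d w → f (insert p d w)))

    module _ (p≤ : p ≤ dbl r) where

      insertions-unique : Unique insertions
      insertions-unique = map-unique (uncurry (insert p)) injective
        (Unique.cartesianProduct⁺ (paths-unique 0 (dbl j)) (paths-unique 0 (dbl r)))
        where
        injective : ∀ {x y} → x ∈ cartesianProduct (words (dbl j)) (words (dbl r)) →
                    y ∈ cartesianProduct (words (dbl j)) (words (dbl r)) →
                    uncurry (insert p) x ≡ uncurry (insert p) y → x ≡ y
        injective {d , w} {d′ , w′} x∈ y∈ e
          with ∈-cartesianProduct⁻ (words (dbl j)) (words (dbl r)) x∈ | ∈-cartesianProduct⁻ (words (dbl j)) (words (dbl r)) y∈
        ... | d∈ , w∈ | d′∈ , w′∈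
          with insert-injective p {d} {d′} {w} {w′}
                 (trans (proj₂ (∈-paths⁻ 0 (dbl j) d∈)) (sym (proj₂ (∈-paths⁻ 0 (dbl j) d′∈))))
                 (≤-trans p≤ (≤-reflexive (sym (proj₂ (∈-paths⁻ 0 (dbl r) w∈)))))
                 (≤-trans p≤ (≤-reflexive (sym (proj₂ (∈-paths⁻ 0 (dbl r) w′∈))))) e
        ...   | refl , refl = refl

      insertions⊆ : ∀ {x} → x ∈ insertions → x ∈ words (dbl (j + r))
      insertions⊆ x∈ with ∈-map⁻ (uncurry (insert p)) x∈
      ... | (d , w) , dw∈ , refl with ∈-cartesianProduct⁻ (words (dbl j)) (words (dbl r)) dw∈
      ...   | d∈ , w∈ with ∈-paths⁻ 0 (dbl j) d∈ | ∈-paths⁻ 0 (dbl r) w∈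
      ...     | rd , ld | rw , lw = subst (λ N → insert p d w ∈ words N)
        (trans (length-insert p d w) (trans (cong₂ _+_ ld lw) (sym (dbl-+ j r)))) (∈-paths⁺ (insert-path p rd rw))

  balanced⇒∈insertions : ∀ j r {w} → w ∈ words (dbl (j + r)) → balanced 0 (dbl j) w ≡ true → w ∈ insertions 0 j r
  balanced⇒∈insertions j r {w} w∈ b with balanced⁻ 0 (dbl j) w b | ∈-paths⁻ 0 (dbl (j + r)) w∈
  ... | d , s , refl , ld , rd | rw , lw = ∈-map⁺ (uncurry (insert 0)) (∈-cartesianProduct⁺
    (subst (λ N → d ∈ words N) ld (∈-paths⁺ rd))
    (subst (λ N → s ∈ words N) ls (∈-paths⁺ (path-drop d rd rw))))
    where
    ls : length s ≡ dbl r
    ls = +-cancelˡ-≡ (dbl j) _ _ (trans (cong (_+ length s) (sym ld)) (trans (sym (length-++ d)) (trans lw (dbl-+ j r))))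

  common : ℕ → Word → Word → Bool
  common t v w = balanced 0 t v ∧ balanced 0 t w

  found : ℕ → Word → Word → Bool
  found zero    v w = false
  found (suc K) v w = found K v w ∨ common (dbl (suc K)) v w

  -- The index is off by one: the shortest nonempty common balanced prefix has length 2 (j + 1).
  shortest : ℕ → Word → Word → Bool
  shortest j v w = not (found j v w) ∧ common (dbl (suc j)) v w

  found-prefix : ∀ K d d′ {s s′} → dbl K ≤ length d → dbl K ≤ length d′ → found K (d ++ s) (d′ ++ s′) ≡ found K d d′
  found-prefix zero    d d′ _ _ = refl
  found-prefix (suc K) d d′ {s} {s′} l l′ = cong₂ _∨_
    (found-prefix K d d′ (≤-trans (dbl-≤ (n≤1+n K)) l) (≤-trans (dbl-≤ (n≤1+n K)) l′))
    (cong₂ _∧_ (balanced-prefix 0 (dbl (suc K)) d s l) (balanced-prefix 0 (dbl (suc K)) d′ s′ l′))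

  shortest-prefix : ∀ j d d′ {s s′} → length d ≡ dbl (suc j) → length d′ ≡ dbl (suc j) →
                    shortest j (d ++ s) (d′ ++ s′) ≡ shortest j d d′
  shortest-prefix j d d′ {s} {s′} l l′ = cong₂ (λ b c → not b ∧ c)
    (found-prefix j d d′ (≤-trans (dbl-≤ (n≤1+n j)) (≤-reflexive (sym l))) (≤-trans (dbl-≤ (n≤1+n j)) (≤-reflexive (sym l′))))
    (cong₂ _∧_ (balanced-prefix 0 (dbl (suc j)) d s (≤-reflexive (sym l))) (balanced-prefix 0 (dbl (suc j)) d′ s′ (≤-reflexive (sym l′))))

  -- Pairs of semilength j + 1 that are irreducible under simultaneous cutting. Every pair of Dyck
  -- words of equal length factors uniquely into such pairs, so their generating function is 1 - 1 /
  -- ∑ C_k² x^k.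
  prime : ℕ → ℕ
  prime j = ∑ (words (dbl (suc j))) λ d → ∑ (words (dbl (suc j))) λ d′ → ⟦ shortest j d d′ ⟧

  module _ (p j r : ℕ) where
    private
      W = words (dbl (suc j + r))
      J = words (dbl (suc j))
      R = words (dbl r)

    -- Whether the inserted factors are the shortest common ones depends on them alone, so the sum
    -- factors into a choice of an irreducible pair and a free choice of the two surrounding words.
    ∑-shortest-insertions : p ≤ dbl r →
      (∑ (insertions p (suc j) r) λ v → ∑ (insertions p (suc j) r) λ w → ⟦ shortest j (drop p v) (drop p w) ⟧) ≡ prime j * (cat r * cat r)
    ∑-shortest-insertions p≤ = begin
      (∑ (insertions p (suc j) r) λ v → ∑ (insertions p (suc j) r) λ w → ⟦ shortest j (drop p v) (drop p w) ⟧)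
        ≡⟨ ∑-insertions p (suc j) r _ ⟩
      (∑ J λ d → ∑ R λ x → ∑ (insertions p (suc j) r) λ w → ⟦ shortest j (drop p (insert p d x)) (drop p w) ⟧)
        ≡⟨ (∑-cong J λ d d∈ → ∑-cong R λ x x∈ → trans (∑-insertions p (suc j) r _)
             (∑-cong J λ d′ d′∈ → trans (∑-cong R λ x′ x′∈ → cong ⟦_⟧ (local d d∈ x x∈ d′ d′∈ x′ x′∈)) (∑-const R _))) ⟩
      (∑ J λ d → ∑ R λ x → ∑ J λ d′ → length R * ⟦ shortest j d d′ ⟧)
        ≡⟨ (∑-cong J λ d _ → trans (∑-const R _) (cong (length R *_) (∑-* J (length R) _))) ⟩
      (∑ J λ d → length R * (length R * ∑ J λ d′ → ⟦ shortest j d d′ ⟧))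
        ≡⟨ trans (∑-* J (length R) _) (cong (length R *_) (∑-* J (length R) _)) ⟩
      length R * (length R * prime j)
        ≡⟨ solve 2 (λ a b → a :* (a :* b) := b :* (a :* a)) refl (length R) (prime j) ⟩
      prime j * (cat r * cat r) ∎
      where
      open ≡-Reasoning
      local : ∀ d → d ∈ J → ∀ x → x ∈ R → ∀ d′ → d′ ∈ J → ∀ x′ → x′ ∈ R →
              shortest j (drop p (insert p d x)) (drop p (insert p d′ x′)) ≡ shortest j d d′
      local d d∈ x x∈ d′ d′∈ x′ x′∈ = trans
        (cong₂ (shortest j) (drop-insert p d x (≤-trans p≤ (≤-reflexive (sym (proj₂ (∈-paths⁻ 0 (dbl r) x∈))))))
                            (drop-insert p d′ x′ (≤-trans p≤ (≤-reflexive (sym (proj₂ (∈-paths⁻ 0 (dbl r) x′∈)))))))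
        (shortest-prefix j d d′ (proj₂ (∈-paths⁻ 0 (dbl (suc j)) d∈)) (proj₂ (∈-paths⁻ 0 (dbl (suc j)) d′∈)))

    ∑-shortest-≥ : p ≤ dbl r →
      prime j * (cat r * cat r) ≤ (∑ W λ v → ∑ W λ w → ⟦ shortest j (drop p v) (drop p w) ⟧)
    ∑-shortest-≥ p≤ = ≤-trans (≤-reflexive (sym (∑-shortest-insertions p≤)))
      (≤-trans (∑-⊆ (insertions-unique p (suc j) r p≤) (insertions⊆ p (suc j) r p≤) _)
               (∑-mono W λ v _ → ∑-⊆ (insertions-unique p (suc j) r p≤) (insertions⊆ p (suc j) r p≤) _))

  -- At the beginning of the words the insertions exhaust all cases, because what follows a balanced
  -- prefix of a Dyck word is a Dyck word.
  ∑-shortest-≤ : ∀ j r → let W = words (dbl (suc j + r)) in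
    (∑ W λ v → ∑ W λ w → ⟦ shortest j v w ⟧) ≤ prime j * (cat r * cat r)
  ∑-shortest-≤ j r = ≤-trans
    (≤-trans (∑-mono W λ v _ → ∑-⊆-support _ (paths-unique 0 (dbl (suc j + r))) λ {w} w∈ nz → balanced⇒∈insertions (suc j) r w∈ (inner v w nz))
             (∑-⊆-support _ (paths-unique 0 (dbl (suc j + r))) λ {v} v∈ nz → balanced⇒∈insertions (suc j) r v∈ (outer v nz)))
    (≤-reflexive (∑-shortest-insertions 0 j r z≤n))
    where
    W = words (dbl (suc j + r))
    I = insertions 0 (suc j) r
    inner : ∀ v w → ⟦ shortest j v w ⟧ ≢ 0 → balanced 0 (dbl (suc j)) w ≡ true
    inner v w nz with balanced 0 (dbl (suc j)) w
    ... | true  = refl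
    ... | false = contradiction (cong ⟦_⟧ (trans (cong (not (found j v w) ∧_) (∧-zeroʳ (balanced 0 (dbl (suc j)) v))) (∧-zeroʳ _))) nz
    outer : ∀ v → (∑ I λ w → ⟦ shortest j v w ⟧) ≢ 0 → balanced 0 (dbl (suc j)) v ≡ true
    outer v nz with balanced 0 (dbl (suc j)) v
    ... | true  = refl
    ... | false = contradiction (trans (∑-cong I λ w _ → cong ⟦_⟧ (∧-zeroʳ (not (found j v w)))) (trans (∑-const I 0) (*-zeroʳ (length I)))) nz

  ∑< : ℕ → (ℕ → ℕ) → ℕ
  ∑< zero    f = 0
  ∑< (suc k) f = ∑< k f + f k

  ∑<-mono : ∀ k {f g} → (∀ j → j < k → f j ≤ g j) → ∑< k f ≤ ∑< k g
  ∑<-mono zero    h = z≤n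
  ∑<-mono (suc k) h = +-mono-≤ (∑<-mono k λ j j<k → h j (m≤n⇒m≤1+n j<k)) (h k ≤-refl)

  ∑<-cong : ∀ k {f g} → (∀ j → j < k → f j ≡ g j) → ∑< k f ≡ ∑< k g
  ∑<-cong k h = ≤-antisym (∑<-mono k λ j j<k → ≤-reflexive (h j j<k)) (∑<-mono k λ j j<k → ≤-reflexive (sym (h j j<k)))

  ∑<-+ : ∀ k f g → ∑< k (λ j → f j + g j) ≡ ∑< k f + ∑< k g
  ∑<-+ zero    f g = refl
  ∑<-+ (suc k) f g = trans (cong (_+ (f k + g k)) (∑<-+ k f g))
    (solve 4 (λ a b c d → a :+ b :+ (c :+ d) := a :+ c :+ (b :+ d)) refl (∑< k f) (∑< k g) (f k) (g k))

  ∑<-* : ∀ k c f → ∑< k (λ j → c * f j) ≡ c * ∑< k f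
  ∑<-* zero    c f = sym (*-zeroʳ c)
  ∑<-* (suc k) c f = trans (cong (_+ c * f k) (∑<-* k c f)) (sym (*-distribˡ-+ c (∑< k f) (f k)))

  module _ {A : Set} (xs : List A) (v w : A → Word) where

    ∑-found : ∀ K → ∑ xs (λ x → ⟦ found K (v x) (w x) ⟧) ≡ ∑< K (λ j → ∑ xs λ x → ⟦ shortest j (v x) (w x) ⟧)
    ∑-found zero    = trans (∑-const xs 0) (*-zeroʳ (length xs))
    ∑-found (suc K) = trans (∑-cong xs λ x _ → ⟦⟧-∨ (found K (v x) (w x)) _)
      (trans (∑-+ xs _ _) (cong (_+ (∑ xs λ x → ⟦ shortest K (v x) (w x) ⟧)) (∑-found K)))

  ∑∑-found : ∀ (xs : List Word) p K →
    (∑ xs λ v → ∑ xs λ w → ⟦ found K (drop p v) (drop p w) ⟧) ≡ ∑< K (λ j → ∑ xs λ v → ∑ xs λ w → ⟦ shortest j (drop p v) (drop p w) ⟧)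
  ∑∑-found xs p K = trans (sym (∑-cartesian xs xs _))
    (trans (∑-found (cartesianProduct xs xs) (drop p ∘ proj₁) (drop p ∘ proj₂) K) (∑<-cong K λ j _ → ∑-cartesian xs xs _))

  cat² : ℕ → ℕ
  cat² k = cat k * cat k

  convolution : (ℕ → ℕ) → ℕ → ℕ
  convolution f K = ∑< K λ j → prime j * f (K ∸ suc j)

  -- Cut a pair of Dyck words after its shortest nonempty common balanced prefix.
  renewal : ∀ k → cat² (suc k) ≤ convolution cat² (suc k)
  renewal k = begin
    cat (suc k) * cat (suc k)
      ≡⟨ trans (∑-const W _) (cong (length W *_) (trans (∑-const W 1) (*-identityʳ _))) ⟨
    (∑ W λ v → ∑ W λ w → 1)
      ≤⟨ (∑-mono W λ v v∈ → ∑-mono W λ w w∈ → ≤-reflexive (cong ⟦_⟧ (sym (all-found v w v∈ w∈)))) ⟩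
    (∑ W λ v → ∑ W λ w → ⟦ found (suc k) v w ⟧)
      ≡⟨ ∑∑-found W 0 (suc k) ⟩
    (∑< (suc k) λ j → ∑ W λ v → ∑ W λ w → ⟦ shortest j v w ⟧)
      ≤⟨ ∑<-mono (suc k) (λ j j<k → subst (λ n → (∑ (words (dbl n)) λ v → ∑ (words (dbl n)) λ w → ⟦ shortest j v w ⟧) ≤ prime j * cat² (suc k ∸ suc j))
           (m+[n∸m]≡n j<k) (∑-shortest-≤ j (suc k ∸ suc j))) ⟩
    convolution cat² (suc k) ∎
    where
    open ≤-Reasoning
    W = words (dbl (suc k))
    whole : ∀ v → v ∈ W → balanced 0 (dbl (suc k)) v ≡ true
    whole v v∈ with ∈-paths⁻ 0 (dbl (suc k)) v∈
    ... | r , l = trans (cong₂ (balanced 0) (sym l) (sym (++-identityʳ v))) (balanced⁺ r [])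
    all-found : ∀ v w → v ∈ W → w ∈ W → found (suc k) v w ≡ true
    all-found v w v∈ w∈ rewrite whole v v∈ | whole w w∈ = ∨-zeroʳ (found k v w)

  -- 16^K times the sum of cat² k / 16^k over k ≤ K
  partial : ℕ → ℕ
  partial zero    = 1
  partial (suc K) = 16 * partial K + cat² (suc K)

  partial-≥1 : ∀ K → 1 ≤ partial K
  partial-≥1 zero    = ≤-refl
  partial-≥1 (suc K) = ≤-trans (partial-≥1 K) (≤-trans (m≤m+n _ _) (m≤m+n (16 * partial K) _))

  partial-scale : ∀ j K → 16 ^ j * partial K ≤ partial (j + K)
  partial-scale zero    K = ≤-reflexive (*-identityˡ _)
  partial-scale (suc j) K = ≤-trans (≤-reflexive (*-assoc 16 (16 ^ j) _)) (≤-trans (*-monoʳ-≤ 16 (partial-scale j K)) (m≤m+n _ _))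

  -- The recurrence of `partial` carried through the convolution; the last term fits because
  -- `partial 0` and `cat² 0` are both 1.
  convolution-partial : ∀ K → convolution partial (suc K) ≡ 16 * convolution partial K + convolution cat² (suc K)
  convolution-partial K = begin
    ∑< K (λ j → prime j * partial (K ∸ j)) + prime K * partial (K ∸ K)
      ≡⟨ cong₂ (λ x k → x + prime K * partial k) (∑<-cong K step) (n∸n≡0 K) ⟩
    ∑< K (λ j → 16 * (prime j * partial (K ∸ suc j)) + prime j * cat² (K ∸ j)) + prime K * 1
      ≡⟨ cong₂ _+_ (trans (∑<-+ K _ _) (cong (_+ ∑< K (λ j → prime j * cat² (K ∸ j))) (∑<-* K 16 _)))
           (cong (λ k → prime K * cat² k) (sym (n∸n≡0 K))) ⟩
    16 * convolution partial K + ∑< K (λ j → prime j * cat² (K ∸ j)) + prime K * cat² (K ∸ K)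
      ≡⟨ +-assoc (16 * convolution partial K) _ _ ⟩
    16 * convolution partial K + convolution cat² (suc K) ∎
    where
    open ≡-Reasoning
    step : ∀ j → j < K → prime j * partial (K ∸ j) ≡ 16 * (prime j * partial (K ∸ suc j)) + prime j * cat² (K ∸ j)
    step j j<K = trans (cong (λ k → prime j * partial k) (sym e))
      (trans (solve 3 (λ a b c → a :* (con 16 :* b :+ c) := con 16 :* (a :* b) :+ a :* c) refl (prime j) (partial (K ∸ suc j)) (cat² (suc (K ∸ suc j))))
        (cong (λ k → 16 * (prime j * partial (K ∸ suc j)) + prime j * cat² k) e))
      where
      e : suc (K ∸ suc j) ≡ K ∸ j
      e = sym (+-∸-assoc 1 j<K)

  -- The renewal inequality summed over 1 ≤ k ≤ K with weights 16^(K - k); the term for k = 0, which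
  -- it does not cover, is the summand 16 ^ K.
  partial-≤ : ∀ K → partial K ≤ 16 ^ K + convolution partial K
  partial-≤ zero    = ≤-refl
  partial-≤ (suc K) = begin
    16 * partial K + cat² (suc K)
      ≤⟨ +-mono-≤ (*-monoʳ-≤ 16 (partial-≤ K)) (renewal K) ⟩
    16 * (16 ^ K + convolution partial K) + convolution cat² (suc K)
      ≡⟨ cong (_+ convolution cat² (suc K)) (*-distribˡ-+ 16 (16 ^ K) _) ⟩
    16 ^ suc K + 16 * convolution partial K + convolution cat² (suc K)
      ≡⟨ +-assoc (16 ^ suc K) _ _ ⟩
    16 ^ suc K + (16 * convolution partial K + convolution cat² (suc K))
      ≡⟨ cong (16 ^ suc K +_) (convolution-partial K) ⟨
    16 ^ suc K + convolution partial (suc K) ∎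
    where open ≤-Reasoning

  -- 16 ^ K times the generating function of the irreducible pairs at 1/16, truncated at semilength
  -- K.
  primes : ℕ → ℕ
  primes K = ∑< K λ j → prime j * 16 ^ (K ∸ suc j)

  power-split : ∀ {j K} → j < K → 16 ^ K ≡ 16 ^ (K ∸ suc j) * 16 ^ suc j
  power-split {j} {K} j<K = trans (cong (16 ^_) (sym (m∸n+n≡m j<K))) (^-distribˡ-+-* 16 (K ∸ suc j) (suc j))

  -- The normalised partial sums increase, so each factor `partial (K ∸ suc j)` can be replaced by
  -- `partial K` divided by 16^(j + 1). This decouples the convolution into a product.
  convolution-primes : ∀ K → 16 ^ K * convolution partial K ≤ primes K * partial K
  convolution-primes K = begin
    16 ^ K * convolution partial K
      ≡⟨ ∑<-* K (16 ^ K) _ ⟨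
    ∑< K (λ j → 16 ^ K * (prime j * partial (K ∸ suc j)))
      ≤⟨ ∑<-mono K term ⟩
    ∑< K (λ j → partial K * (prime j * 16 ^ (K ∸ suc j)))
      ≡⟨ ∑<-* K (partial K) _ ⟩
    partial K * primes K
      ≡⟨ *-comm (partial K) _ ⟩
    primes K * partial K ∎
    where
    open ≤-Reasoning
    term : ∀ j → j < K → 16 ^ K * (prime j * partial (K ∸ suc j)) ≤ partial K * (prime j * 16 ^ (K ∸ suc j))
    term j j<K = begin
      16 ^ K * (prime j * partial (K ∸ suc j))
        ≡⟨ cong (_* (prime j * partial (K ∸ suc j))) (power-split j<K) ⟩
      16 ^ (K ∸ suc j) * 16 ^ suc j * (prime j * partial (K ∸ suc j))
        ≡⟨ solve 4 (λ a b c d → a :* b :* (c :* d) := (b :* d) :* (c :* a)) refl (16 ^ (K ∸ suc j)) (16 ^ suc j) (prime j) (partial (K ∸ suc j)) ⟩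
      16 ^ suc j * partial (K ∸ suc j) * (prime j * 16 ^ (K ∸ suc j))
        ≤⟨ *-monoˡ-≤ (prime j * 16 ^ (K ∸ suc j)) (partial-scale (suc j) (K ∸ suc j)) ⟩
      partial (suc j + (K ∸ suc j)) * (prime j * 16 ^ (K ∸ suc j))
        ≡⟨ cong (λ k → partial k * (prime j * 16 ^ (K ∸ suc j))) (m+[n∸m]≡n j<K) ⟩
      partial K * (prime j * 16 ^ (K ∸ suc j)) ∎

  hits : ℕ → ℕ → ℕ → ℕ
  hits n K p = ∑ (words (dbl n)) λ v → ∑ (words (dbl n)) λ w → ⟦ found K (drop p v) (drop p w) ⟧

  -- The events for different shortest lengths are disjoint, so their counts add up. The condition
  -- on p leaves room for a factor of length 2 K, and `cat-+-≤` prices the semilength that the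
  -- surroundings lose.
  hits-≥ : ∀ n K p → K ≤ n → p ≤ dbl (n ∸ K) → cat² n * primes K ≤ 16 ^ K * hits n K p
  hits-≥ n K p K≤n p≤ = begin
    cat² n * primes K
      ≡⟨ ∑<-* K (cat² n) _ ⟨
    ∑< K (λ j → cat² n * (prime j * 16 ^ (K ∸ suc j)))
      ≤⟨ ∑<-mono K term ⟩
    ∑< K (λ j → 16 ^ K * ∑ W λ v → ∑ W λ w → ⟦ shortest j (drop p v) (drop p w) ⟧)
      ≡⟨ ∑<-* K (16 ^ K) _ ⟩
    16 ^ K * ∑< K (λ j → ∑ W λ v → ∑ W λ w → ⟦ shortest j (drop p v) (drop p w) ⟧)
      ≡⟨ cong (16 ^ K *_) (∑∑-found W p K) ⟨
    16 ^ K * hits n K p ∎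
    where
    open ≤-Reasoning
    W = words (dbl n)
    term : ∀ j → j < K → cat² n * (prime j * 16 ^ (K ∸ suc j)) ≤ 16 ^ K * ∑ W λ v → ∑ W λ w → ⟦ shortest j (drop p v) (drop p w) ⟧
    term j j<K = begin
      cat² n * (prime j * 16 ^ (K ∸ suc j))
        ≡⟨ cong (λ n → cat² n * (prime j * 16 ^ (K ∸ suc j))) (m+[n∸m]≡n j<n) ⟨
      cat² (suc j + r) * (prime j * 16 ^ (K ∸ suc j))
        ≤⟨ *-monoˡ-≤ (prime j * 16 ^ (K ∸ suc j)) (cat-+-≤ (suc j) r) ⟩
      16 ^ suc j * cat² r * (prime j * 16 ^ (K ∸ suc j))
        ≡⟨ solve 4 (λ a b c d → a :* b :* (c :* d) := d :* a :* (c :* b)) refl (16 ^ suc j) (cat² r) (prime j) (16 ^ (K ∸ suc j)) ⟩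
      16 ^ (K ∸ suc j) * 16 ^ suc j * (prime j * cat² r)
        ≡⟨ cong (_* (prime j * cat² r)) (power-split j<K) ⟨
      16 ^ K * (prime j * cat² r)
        ≤⟨ *-monoʳ-≤ (16 ^ K) (subst (λ n → prime j * cat² r ≤ ∑ (words (dbl n)) λ v → ∑ (words (dbl n)) λ w → ⟦ shortest j (drop p v) (drop p w) ⟧)
             (m+[n∸m]≡n j<n) (∑-shortest-≥ p j r (≤-trans p≤ (dbl-≤ (∸-monoʳ-≤ n j<K))))) ⟩
      16 ^ K * ∑ W (λ v → ∑ W λ w → ⟦ shortest j (drop p v) (drop p w) ⟧) ∎
      where
      j<n = ≤-trans j<K K≤n
      r = n ∸ suc j

  -- With x = 16 ^ K and s = `partial K`, the inequality x s ≤ x² + `primes K` s says that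
  -- `primes K` / x ≥ 1 - x / s, while the numeric hypothesis says that a / b ≤ 1 - x / s. The
  -- calculation combines them after multiplication by x s.
  hits-bound : ∀ a b n K p → K ≤ n → p ≤ dbl (n ∸ K) →
               a * partial K + b * 16 ^ K ≤ b * partial K → a * cat² n ≤ b * hits n K p
  hits-bound a b n K p K≤n p≤ numeric = *-cancelʳ-≤ _ _ s {{>-nonZero (partial-≥1 K)}}
    (*-cancelˡ-≤ x {{m^n≢0 16 K}} (+-cancelʳ-≤ (x * (b * x * c)) _ _ (begin
      x * (a * c * s) + x * (b * x * c)
        ≡⟨ solve 5 (λ x a b c s → x :* (a :* c :* s) :+ x :* (b :* x :* c) := x :* c :* (a :* s :+ b :* x)) refl x a b c s ⟩
      x * c * (a * s + b * x)
        ≤⟨ *-monoʳ-≤ (x * c) numeric ⟩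
      x * c * (b * s)
        ≡⟨ solve 4 (λ x b c s → x :* c :* (b :* s) := b :* c :* (x :* s)) refl x b c s ⟩
      b * c * (x * s)
        ≤⟨ *-monoʳ-≤ (b * c) (≤-trans (*-monoʳ-≤ x (partial-≤ K)) (≤-trans (≤-reflexive (*-distribˡ-+ x x _)) (+-monoʳ-≤ (x * x) (convolution-primes K)))) ⟩
      b * c * (x * x + q * s)
        ≡⟨ solve 5 (λ x b c s q → b :* c :* (x :* x :+ q :* s) := b :* s :* (c :* q) :+ x :* (b :* x :* c)) refl x b c s q ⟩
      b * s * (c * q) + x * (b * x * c)
        ≤⟨ +-monoˡ-≤ (x * (b * x * c)) (*-monoʳ-≤ (b * s) (hits-≥ n K p K≤n p≤)) ⟩
      b * s * (x * g) + x * (b * x * c)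
        ≡⟨ cong (_+ x * (b * x * c)) (solve 4 (λ x b s g → b :* s :* (x :* g) := x :* (b :* g :* s)) refl x b s g) ⟩
      x * (b * g * s) + x * (b * x * c) ∎)))
    where
    open ≤-Reasoning
    x = 16 ^ K
    s = partial K
    c = cat² n
    q = primes K
    g = hits n K p

  -- Computes partial by the recurrence for the Catalan numbers instead of by enumeration.
  accumulate : ℕ → ℕ → ℕ → ℕ → ℕ
  accumulate zero      k c s = s
  accumulate (suc fuel) k c s = accumulate fuel (suc k) c⁺ (16 * s + c⁺ * c⁺)
    where c⁺ = ((4 * k + 2) * c) / suc (suc k)

  accumulate-correct : ∀ fuel k → accumulate fuel k (cat k) (partial k) ≡ partial (fuel + k)
  accumulate-correct zero       k = refl
  accumulate-correct (suc fuel) k = trans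
    (cong (λ c → accumulate fuel (suc k) c (16 * partial k + c * c))
      (trans (cong (_/ suc (suc k)) (sym (cat-suc k))) (m*n/n≡m (cat (suc k)) (suc (suc k)))))
    (trans (accumulate-correct fuel (suc k)) (cong partial (+-suc fuel k)))

  -- A Boolean comparison, decided by evaluation of natural-number arithmetic, so that the proof at
  -- a concrete K is the unit value.
  window-check : ℕ → Bool
  window-check K = 21 * s + 247 * 16 ^ K ≤ᵇ 247 * s
    where s = accumulate K 0 1 1

  window-check-sound : ∀ K → T (window-check K) → 21 * partial K + 247 * 16 ^ K ≤ 247 * partial K
  window-check-sound K t = subst (λ s → 21 * s + 247 * 16 ^ K ≤ 247 * s)
    (trans (accumulate-correct K 0) (cong partial (+-identityʳ K)))
    (≤ᵇ⇒≤ (21 * accumulate K 0 1 1 + 247 * 16 ^ K) (247 * accumulate K 0 1 1) t)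

  abstract
    -- 21/247 = 0.085020… lies between 0.17/2 and 1 - 16^64 / partial 64, and the latter
    -- is below the limit 1 - 1/(16/π - 4) = 0.08506… for window → ∞.
    window : ℕ
    window = 64

    window-numeric : 21 * partial window + 247 * 16 ^ window ≤ 247 * partial window
    window-numeric = window-check-sound window _

  hits-window : ∀ n p → window ≤ n → p ≤ dbl (n ∸ window) → 21 * cat² n ≤ 247 * hits n window p
  hits-window n p w≤n p≤ = hits-bound 21 247 n window p w≤n p≤ window-numeric

-- Rotation of Dyck words and induction along first returns.

module Rotations where

  open Sums
  open Components
  open Partitions
  open Levels
  open DyckWords
  open Renewal using (path-++; path-drop)
  open import Data.Bool.Properties using () renaming (not-involutive to not-not)
  open import Data.Fin using (zero; suc; toℕ)
  open import Data.List using (List; []; _∷_; _++_; length; [_])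
  import Data.List.Membership.Propositional as List
  import Data.List.Membership.Propositional.Properties as List
  open import Data.List.Properties using (length-++; ++-assoc; ++-identityʳ; ∷-injective;
    ∷ʳ-injectiveˡ; length-map)
  open import Data.Nat as ℕ using (ℕ; zero; suc; _+_; _≤_; _<_; s≤s; z≤n; _≤?_)
  open import Data.Nat.Properties
  open import Data.Nat.Solver using (module +-*-Solver)
  open +-*-Solver using (solve; _:=_; _:+_; con)

  open Equivalence using (to; from)

  evenD oddD : Word → ℕ
  evenD []      = 0
  evenD (b ∷ w) = ⟦ not b ⟧ + oddD w
  oddD []       = 0
  oddD (b ∷ w)  = evenD w

  #D : Word → ℕ
  #D w = evenD w + oddD w

  length-path : ∀ {h w} → Path h w → dbl (#D w) ≡ length w + h
  length-path []                       = refl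
  length-path {h} (up {w = w} r)       = trans (cong dbl (+-comm (oddD w) (evenD w)))
    (trans (length-path r) (+-suc (length w) h))
  length-path {suc h} (down {w = w} r) = cong suc (trans (cong suc (trans (cong dbl (+-comm (oddD w) (evenD w)))
    (length-path r))) (sym (+-suc (length w) h)))

  length-balanced : ∀ {w} → Path 0 w → length w ≡ dbl (#D w)
  length-balanced r = sym (trans (length-path r) (+-identityʳ _))

  evenD-++ : ∀ k u v → length u ≡ dbl k → evenD (u ++ v) ≡ evenD u + evenD v
  evenD-++ zero    []          v l = refl
  evenD-++ (suc k) (b ∷ c ∷ u) v l = trans (cong (⟦ not b ⟧ +_) (evenD-++ k u v (suc-injective (suc-injective l))))
    (sym (+-assoc ⟦ not b ⟧ _ _))

  oddD-++ : ∀ k u v → length u ≡ dbl k → oddD (u ++ v) ≡ oddD u + oddD v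
  oddD-++ zero    []          v l = refl
  oddD-++ (suc k) (b ∷ c ∷ u) v l = trans (cong (⟦ not c ⟧ +_) (oddD-++ k u v (suc-injective (suc-injective l))))
    (sym (+-assoc ⟦ not c ⟧ _ _))

  oddD-double : ∀ w → oddD (double w) ≡ #D w
  oddD-double []      = refl
  oddD-double (b ∷ w) = trans (cong (⟦ not b ⟧ +_) (trans (oddD-double w) (+-comm (evenD w) (oddD w))))
    (sym (+-assoc ⟦ not b ⟧ (oddD w) (evenD w)))

  count-D : ∀ n w → length w ≡ dbl n → count {n} (λ i → not (letter w (odd (toℕ i)))) ≡ oddD w
  count-D zero    []          l = refl
  count-D (suc n) (b ∷ c ∷ w) l = cong (⟦ not c ⟧ +_) (count-D n w (suc-injective (suc-injective l)))

  -- A block has its last element at point i exactly when the letter after the cut of i is D.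
  #⟨⟩ : ∀ {n w} → w List.∈ words (dbl n) → # (⟨_⟩ {n} w) ≡ oddD w
  #⟨⟩ {n} {w} w∈ = trans (#≡count-last (∈NC⁻ (partition∈NC {n} (ht 0 w)))) (trans
    (count-cong (λ i → cong not (later i))) (count-D n w (proj₂ (∈-paths⁻ 0 (dbl n) w∈))))
    where
    later : ∀ i → does (hasLater? (⟨_⟩ {n} w) i) ≡ letter w (odd (toℕ i))
    later i with letter w (odd (toℕ i)) in e
    ... | true  = dec-true (hasLater? (⟨_⟩ {n} w) i) (U⇒hasLater {n} w∈ i e)
    ... | false = dec-false (hasLater? (⟨_⟩ {n} w) i) (D⇒¬hasLater {n} w∈ i e)

  #⟪⟫ : ∀ n {w} → w List.∈ words (dbl n) → # (⟪_⟫ {dbl n} w) ≡ n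
  #⟪⟫ n {w} w∈ = trans (#⟨⟩ {dbl n} (double∈words {dbl n} w∈)) (trans (oddD-double w)
    (dbl-injective (trans (sym (length-balanced r)) l)))
    where
    r = proj₁ (∈-paths⁻ 0 (dbl n) w∈)
    l = proj₂ (∈-paths⁻ 0 (dbl n) w∈)

  split : ℕ → Word → Word × Word
  split k       []      = [] , []
  split k       (U ∷ v) = map₁ (U ∷_) (split (suc k) v)
  split zero    (D ∷ v) = [] , v
  split (suc k) (D ∷ v) = map₁ (D ∷_) (split k v)

  -- This induces the Kreweras complement on non-crossing partitions (up to rotation) and
  -- the rotation by one point on matchings.
  rotate : Word → Word
  rotate (U ∷ v) = let x , y = split 0 v in x ++ U ∷ y ++ [ D ]
  rotate v       = v

  split-spec : ∀ k h v → Path (suc (k + h)) v →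
               let x , y = split k v in v ≡ x ++ D ∷ y × Path k x × Path h y
  split-spec k       h (U ∷ v) (up r)   with split-spec (suc k) h v r
  ... | e , p , q = cong (U ∷_) e , up p , q
  split-spec zero    h (D ∷ v) (down r) = refl , [] , r
  split-spec (suc k) h (D ∷ v) (down r) with split-spec k h v r
  ... | e , p , q = cong (D ∷_) e , down p , q

  record Rotation (w : Word) : Set where
    field
      {x y}  : Word
      path-x : Path 0 x
      path-y : Path 0 y
      source : w ≡ U ∷ x ++ D ∷ y
      target : rotate w ≡ x ++ U ∷ y ++ [ D ]

  rotation : ∀ {n w} → w List.∈ words (dbl (suc n)) → Rotation w
  rotation {n} {w} w∈ with w | ∈-paths⁻ 0 (dbl (suc n)) w∈
  ... | U ∷ v | up r , _ with split-spec 0 0 v r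
  ...   | e , p , q = record { path-x = p ; path-y = q ; source = cong (U ∷_) e ; target = refl }

  path-rotated : ∀ {x y} → Path 0 x → Path 0 y → Path 0 (x ++ U ∷ y ++ [ D ])
  path-rotated p q = path-++ p (up (path-++ q (down [])))

  length-rotated : ∀ x y → length (x ++ U ∷ y ++ [ D ]) ≡ length (U ∷ x ++ D ∷ y)
  length-rotated x y = trans (length-++ x) (trans (cong (λ k → length x + suc k) (trans (length-++ y) (+-comm (length y) 1)))
    (trans (+-suc (length x) _) (cong suc (sym (length-++ x)))))

  rotate∈words : ∀ {n w} → w List.∈ words (dbl (suc n)) → rotate w List.∈ words (dbl (suc n))
  rotate∈words {n} {w} w∈ = subst₂ (λ v N → v List.∈ words N) (sym target)
    (trans (length-rotated x y) (trans (cong length (sym source)) (proj₂ (∈-paths⁻ 0 (dbl (suc n)) w∈))))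
    (∈-paths⁺ (path-rotated path-x path-y))
    where open Rotation (rotation {n} w∈)

  -- The prefix t descends by h + 1 levels in total, one more than a path from h can afford.
  below : ∀ {h t} s → Path (suc h) t → ¬ Path h (t ++ s)
  below s (up r)             (up q)   = below s r q
  below s (down r@(up _))    (down q) = below s r q
  below s (down r@(down _))  (down q) = below s r q

  -- The U after x is the last up step from height 0. If x′ were longer than x, it would be x U a
  -- with a descending from 1 to 0; then y would start with a and go below its starting height.
  rotated-injective : ∀ x x′ {y y′} → Path 0 x → Path 0 x′ → Path 0 y → Path 0 y′ →
                      x ++ U ∷ y ++ [ D ] ≡ x′ ++ U ∷ y′ ++ [ D ] → x ≡ x′ × y ≡ y′
  rotated-injective x x′ {y} {y′} p p′ q q′ e = compare [] x x′ refl refl e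
    where
    tail : ∀ c a x x′ → c ≡ x → c ++ U ∷ a ≡ x′ → Path 0 x → Path 0 x′ → Path 1 a
    tail c a .c _ refl refl p p′ with path-drop c p p′
    ... | up r = r
    longer : ∀ y a y′ → y ++ [ D ] ≡ a ++ U ∷ y′ ++ [ D ] → Path 1 a → ¬ Path 0 y
    longer y a y′ e r q = below (U ∷ y′) r (subst (Path 0) (∷ʳ-injectiveˡ y (a ++ U ∷ y′)
      (trans e (sym (++-assoc a (U ∷ y′) [ D ])))) q)
    compare : ∀ c a a′ → c ++ a ≡ x → c ++ a′ ≡ x′ → a ++ U ∷ y ++ [ D ] ≡ a′ ++ U ∷ y′ ++ [ D ] → x ≡ x′ × y ≡ y′
    compare c [] [] e₁ e₂ e = trans (sym e₁) e₂ , ∷ʳ-injectiveˡ y y′ (proj₂ (∷-injective e))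
    compare c [] (b ∷ a′) e₁ e₂ e with ∷-injective e
    ... | refl , e′ = contradiction q (longer y a′ y′ e′ (tail c a′ x x′ (trans (sym (++-identityʳ c)) e₁) e₂ p p′))
    compare c (b ∷ a) [] e₁ e₂ e with ∷-injective e
    ... | refl , e′ = contradiction q′ (longer y′ a y (sym e′) (tail c a x′ x (trans (sym (++-identityʳ c)) e₂) e₁ p′ p))
    compare c (b ∷ a) (b′ ∷ a′) e₁ e₂ e with ∷-injective e
    ... | refl , e′ = compare (c ++ [ b ]) a a′ (trans (++-assoc c [ b ] a) e₁) (trans (++-assoc c [ b ] a′) e₂) e′

  rotate-injective : ∀ {n v w} → v List.∈ words (dbl (suc n)) → w List.∈ words (dbl (suc n)) → rotate v ≡ rotate w → v ≡ w
  rotate-injective {n} v∈ w∈ e = trans V.source (trans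
    (cong₂ (λ x y → U ∷ x ++ D ∷ y) (proj₁ same) (proj₂ same)) (sym W.source))
    where
    module V = Rotation (rotation {n} v∈)
    module W = Rotation (rotation {n} w∈)
    same = rotated-injective V.x W.x V.path-x W.path-x V.path-y W.path-y (trans (sym V.target) (trans e W.target))

  ∑-rotate : ∀ n (f : Word → ℕ) → ∑ (words (dbl (suc n))) (f ∘ rotate) ≡ ∑ (words (dbl (suc n))) f
  ∑-rotate n f = trans (sym (∑-map rotate W f)) (∑-⊆-length (map-unique rotate (rotate-injective {n}) (paths-unique 0 (dbl (suc n))))
    (λ p → let w , w∈ , e = List.∈-map⁻ rotate p in subst (List._∈ W) (sym e) (rotate∈words {n} w∈))
    (length-map rotate W) f)
    where W = words (dbl (suc n))

  -- Rotation shifts both x and y by one position, so each D inside them is at an odd position in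
  -- exactly one of the two words. The remaining D, which follows x in w and ends the rotated word,
  -- is at an odd position in both.
  oddD-rotate : ∀ {n w} → w List.∈ words (dbl (suc n)) → oddD w + oddD (rotate w) ≡ suc (suc n)
  oddD-rotate {n} {w} w∈ = begin
    oddD w + oddD (rotate w)
      ≡⟨ cong₂ (λ v v′ → oddD v + oddD v′) source target ⟩
    evenD (x ++ D ∷ y) + oddD (x ++ U ∷ y ++ [ D ])
      ≡⟨ cong₂ _+_ (evenD-++ (#D x) x (D ∷ y) (length-balanced path-x))
           (trans (oddD-++ (#D x) x (U ∷ y ++ [ D ]) (length-balanced path-x))
             (cong (oddD x +_) (evenD-++ (#D y) y [ D ] (length-balanced path-y)))) ⟩
    evenD x + suc (oddD y) + (oddD x + (evenD y + 1))
      ≡⟨ solve 4 (λ a b c d → a :+ (con 1 :+ b) :+ (c :+ (d :+ con 1)) := con 2 :+ ((a :+ c) :+ (d :+ b))) refl (evenD x) (oddD y) (oddD x) (evenD y) ⟩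
    suc (suc (#D x + #D y))
      ≡⟨ cong suc size ⟩
    suc (suc n) ∎
    where
    open ≡-Reasoning
    open Rotation (rotation {n} w∈)
    size : suc (#D x + #D y) ≡ suc n
    size = dbl-injective (trans (cong (2 +_) (trans (dbl-+ (#D x) (#D y)) (cong₂ _+_ (sym (length-balanced path-x)) (sym (length-balanced path-y)))))
      (trans (sym (trans (cong suc (trans (length-++ x) (+-suc (length x) (length y)))) refl))
        (trans (cong length (sym source)) (proj₂ (∈-paths⁻ 0 (dbl (suc n)) w∈)))))

  -- The first-return decomposition as an induction principle; the connectivity arguments recurse
  -- along it.
  data Tree : Word → Set where
    leaf : Tree []
    node : ∀ {x y} → Path 0 x → Tree x → Tree y → Tree (U ∷ x ++ D ∷ y)

  tree : ∀ {w} → Path 0 w → Tree w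
  tree {w} r = go (length w) w ≤-refl r
    where
    go : ∀ f w → length w ≤ f → Path 0 w → Tree w
    go f       []      _         []     = leaf
    go (suc f) (U ∷ v) (s≤s v≤f) (up r) with split-spec 0 0 v r
    ... | e , p , q = subst (λ v → Tree (U ∷ v)) (sym e) (node p (go f _ (≤-trans x≤ v≤f) p) (go f _ (≤-trans y≤ v≤f) q))
      where
      lv = trans (cong length e) (length-++ (proj₁ (split 0 v)))
      x≤ = ≤-trans (m≤m+n _ _) (≤-reflexive (sym lv))
      y≤ = ≤-trans (n≤1+n _) (≤-trans (m≤n+m _ (length (proj₁ (split 0 v)))) (≤-reflexive (sym lv)))

  reassoc : ∀ u d s (t : Word) → (u ++ d ++ s) ++ t ≡ u ++ d ++ (s ++ t)
  reassoc u d s t = trans (++-assoc u (d ++ s) t) (cong (u ++_) (++-assoc d s t))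

  reassocᵃ : ∀ u d s (t : Word) → (u ++ U ∷ d ++ D ∷ s) ++ t ≡ u ++ U ∷ d ++ D ∷ (s ++ t)
  reassocᵃ u d s t = trans (++-assoc u _ t) (cong (λ v → u ++ U ∷ v) (++-assoc d (D ∷ s) t))

  node-right : ∀ x y → U ∷ x ++ D ∷ y ≡ (U ∷ x ++ [ D ]) ++ y ++ []
  node-right x y = cong (U ∷_) (trans (cong (λ v → x ++ D ∷ v) (sym (++-identityʳ y))) (sym (++-assoc x [ D ] (y ++ []))))

  length-node-left : ∀ x → length (U ∷ x ++ [ D ]) ≡ 2 + length x
  length-node-left x = cong suc (trans (length-++ x) (+-comm (length x) 1))

  node-cuts : ∀ x y c → c ≤ length (U ∷ x ++ D ∷ y) →
              c ≡ 0 ⊎ (∃ λ i → i ≤ length x × c ≡ suc i) ⊎ (∃ λ i → i ≤ length y × c ≡ 2 + length x + i)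
  node-cuts x y zero    _ = inj₁ refl
  node-cuts x y (suc c) (s≤s c≤) with c ≤? length x
  ... | yes c≤x = inj₂ (inj₁ (c , c≤x , refl))
  ... | no c≰x with m≤n⇒∃[o]m+o≡n (≰⇒> c≰x)
  ...   | i , refl = inj₂ (inj₂ (i , +-cancelˡ-≤ (suc (length x)) _ _ (≤-trans c≤ (≤-reflexive
          (trans (length-++ x) (+-suc (length x) (length y))))) , refl))

  parity-even : ∀ {x} p → Path 0 x → parity (length x + p) ≡ parity p
  parity-even {x} p r = trans (cong (λ k → parity (k + p)) (length-balanced r)) (go (#D x))
    where
    go : ∀ k → parity (dbl k + p) ≡ parity p
    go zero    = refl
    go (suc k) = trans (not-not _) (go k)

  module Connectivity {P : Set} {E : Rel P 0ℓ} (isEquivalence : IsEquivalence E) where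
    private module E = IsEquivalence isEquivalence

    Factors : Word → (ℕ → P) → Set
    Factors x g = ∀ u d s → x ≡ u ++ d ++ s → Path 0 d → E (g (length u)) (g (length u + length d))

    Arcs : Word → (ℕ → P) → Set
    Arcs x g = ∀ u d s → x ≡ u ++ U ∷ d ++ D ∷ s → Path 0 d → E (g (length u)) (g (suc (length u + length d)))

    factors-left : ∀ a x b {g} → Factors (a ++ x ++ b) g → Factors x (λ p → g (length a + p))
    factors-left a x b {g} F u d s refl r = subst₂ (λ p q → E (g p) (g q)) (length-++ a)
      (trans (cong (_+ length d) (length-++ a)) (+-assoc (length a) (length u) (length d)))
      (F (a ++ u) d (s ++ b) (trans (cong (a ++_) (reassoc u d s b)) (sym (++-assoc a u _))) r)

    arcs-left : ∀ a x b {g} → Arcs (a ++ x ++ b) g → Arcs x (λ p → g (length a + p))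
    arcs-left a x b {g} F u d s refl r = subst₂ (λ p q → E (g p) (g q)) (length-++ a)
      (trans (cong (λ k → suc (k + length d)) (length-++ a)) (trans (cong suc (+-assoc (length a) (length u) (length d))) (sym (+-suc (length a) _))))
      (F (a ++ u) d (s ++ b) (trans (cong (a ++_) (reassocᵃ u d s b)) (sym (++-assoc a u _))) r)

    -- The cuts of parity s are linked to their successors; the parity flips when passing
    -- from U x D y to x.
    connect-cuts : ∀ {x} → Tree x → ∀ s g → Factors x g →
                   (∀ p → p < length x → parity p ≡ s → E (g p) (g (suc p))) →
                   ∀ c → c ≤ length x → E (g 0) (g c)
    connect-cuts leaf s g F L zero z≤n = E.refl
    connect-cuts (node {x} {y} r tx ty) s g F L c c≤ with node-cuts x y c c≤
    ... | inj₁ refl = E.refl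
    ... | inj₂ (inj₁ (i , i≤ , refl)) = E.trans (start s L) (x-part i i≤)
      where
      inside : ∀ {p} → p < length x → suc p < length (U ∷ x ++ D ∷ y)
      inside p< = s≤s (≤-trans p< (≤-trans (m≤m+n _ _) (≤-reflexive (sym (length-++ x)))))
      x-part : ∀ i → i ≤ length x → E (g 1) (g (suc i))
      x-part = connect-cuts tx (not s) (g ∘ suc) (factors-left [ U ] x (D ∷ y) {g} F)
        λ p p< e → L (suc p) (inside p<) (trans (cong not e) (not-not s))
      start : ∀ s′ → (∀ p → p < length (U ∷ x ++ D ∷ y) → parity p ≡ s′ → E (g p) (g (suc p))) → E (g 0) (g 1)
      start false L = L 0 (s≤s z≤n) refl
      -- Cut 0 has no link to cut 1 here. The detour goes along the factor U x D to its end, back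
      -- over its D, whose left cut has the right parity, and through x to cut 1.
      start true  L = E.trans (F [] (U ∷ x ++ [ D ]) y (cong (U ∷_) (sym (++-assoc x [ D ] y))) (up (path-++ r (down []))))
        (E.sym (E.trans (x-part (length x) ≤-refl) (E.trans
          (L (suc (length x)) (s≤s (≤-trans (≤-reflexive (+-comm 1 (length x))) (≤-trans (+-monoʳ-≤ (length x) (s≤s z≤n)) (≤-reflexive (sym (length-++ x {D ∷ y}))))))
            (cong not (trans (cong parity (sym (+-identityʳ (length x)))) (parity-even {x} 0 r))))
          (E.reflexive (cong g (sym (length-node-left x)))))))
    ... | inj₂ (inj₂ (i , i≤ , refl)) = E.trans
        (E.trans (F [] (U ∷ x ++ [ D ]) y (cong (U ∷_) (sym (++-assoc x [ D ] y))) (up (path-++ r (down []))))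
          (E.reflexive (cong g (trans (length-node-left x) (sym (+-identityʳ _))))))
        (connect-cuts ty s (λ p → g (2 + length x + p))
          (subst (λ k → Factors y (λ p → g (k + p))) (length-node-left x)
            (factors-left (U ∷ x ++ [ D ]) y [] {g} (subst (λ v → Factors v g) (node-right x y) F)))
          (λ p p< e → E.trans (L (2 + length x + p) (inside p<)
              (trans (not-not _) (trans (parity-even {x} p r) e))) (E.reflexive (cong g (sym (+-suc (2 + length x) p)))))
          i i≤)
      where
      inside : ∀ {p} → p < length y → 2 + length x + p < length (U ∷ x ++ D ∷ y)
      inside {p} p< = s≤s (≤-trans (≤-reflexive (cong suc (sym (+-suc (length x) p)))) (≤-trans (≤-reflexive (sym (+-suc (length x) (suc p)))) (≤-trans (+-monoʳ-≤ (length x) (s≤s p<)) (≤-reflexive (sym (length-++ x))))))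

    -- g and g ∘ suc place the same matching at two offsets that differ by one.
    connect-arcs : ∀ {x} → Tree x → ∀ g → Arcs x g → Arcs x (g ∘ suc) → ∀ c → c ≤ length x → E (g 0) (g c)
    connect-arcs leaf g A B zero z≤n = E.refl
    connect-arcs (node {x} {y} r tx ty) g A B c c≤ = cases (node-cuts x y c c≤)
      where
      x-part : ∀ i → i ≤ length x → E (g 1) (g (suc i))
      x-part = connect-arcs tx (g ∘ suc) (arcs-left [ U ] x (D ∷ y) {g} A) (arcs-left [ U ] x (D ∷ y) {g ∘ suc} B)
      right : ∀ {g} → Arcs (U ∷ x ++ D ∷ y) g → Arcs y (λ p → g (2 + length x + p))
      right {g} A = subst (λ k → Arcs y (λ p → g (k + p))) (length-node-left x)
        (arcs-left (U ∷ x ++ [ D ]) y [] {g} (subst (λ v → Arcs v g) (node-right x y) A))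
      y-part : ∀ i → i ≤ length y → E (g (2 + length x + 0)) (g (2 + length x + i))
      y-part = connect-arcs ty (λ p → g (2 + length x + p)) (right {g} A)
        λ u d s e q → subst₂ (λ a b → E (g a) (g b)) (sym (+-suc (2 + length x) _)) (sym (+-suc (2 + length x) _)) (right {g ∘ suc} B u d s e q)
      -- The arc around x leads from 0 to suc (length x), where the copy of x shifted by one ends;
      -- the induction hypothesis leads back to 1.
      0~1 : E (g 0) (g 1)
      0~1 = E.trans (A [] x y refl r) (E.sym (x-part (length x) ≤-refl))
      cases : c ≡ 0 ⊎ (∃ λ i → i ≤ length x × c ≡ suc i) ⊎ (∃ λ i → i ≤ length y × c ≡ 2 + length x + i) → E (g 0) (g c)
      cases (inj₁ refl) = E.refl
      cases (inj₂ (inj₁ (i , i≤ , refl))) = E.trans 0~1 (x-part i i≤)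
      -- The shifted copy of the same arc leads from 1 to the place where y starts.
      cases (inj₂ (inj₂ (i , i≤ , refl))) = E.trans 0~1 (E.trans (B [] x y refl r)
        (E.trans (E.reflexive (cong g (sym (+-identityʳ _)))) (y-part i i≤)))

-- Joins of a word with its rotation; common factors in meets and curves.

module Joins where

  open Sums
  open Components
  open Partitions
  open Levels
  open DyckWords
  open Renewal using (path-++; balanced; balanced⁻; found; common)
  open Rotations
  open import Data.Fin using (Fin; toℕ; fromℕ<)
  import Data.Fin as Fin
  import Data.Fin.Properties as Fin
  open import Data.List using (List; []; _∷_; _++_; length; drop; [_])
  import Data.List.Membership.Propositional as List
  import Data.List.Membership.Propositional.Properties as List
  open import Data.List.Properties using (length-++; ++-assoc; length-drop)
  open import Data.Nat as ℕ using (ℕ; zero; suc; _+_; _≤_; _<_; ⌊_/2⌋; ⌈_/2⌉; s≤s; z≤n; s≤s⁻¹;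
    _≤?_; _<?_)
  open import Data.Nat.Properties

  open Equivalence using (to; from)

  drop-length-++ : ∀ (u z : Word) → drop (length u) (u ++ z) ≡ z
  drop-length-++ []      z = refl
  drop-length-++ (b ∷ u) z = drop-length-++ u z

  -- Indices beyond N give the last point.
  pt : ∀ {N} → ℕ → Fin (suc N)
  pt {N} i = fromℕ< (s≤s (m⊓n≤n i N))

  toℕ-pt : ∀ {N i} → i ≤ N → toℕ (pt {N} i) ≡ i
  toℕ-pt {N} {i} i≤N = trans (Fin.toℕ-fromℕ< (s≤s (m⊓n≤n i N))) (m≤n⇒m⊓n≡m i≤N)

  pt-toℕ : ∀ {N} (i : Fin (suc N)) → pt (toℕ i) ≡ i
  pt-toℕ i = Fin.toℕ-injective (toℕ-pt (s≤s⁻¹ (Fin.toℕ<n i)))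

  odd-+ : ∀ i k → odd i + dbl k ≡ odd (i + k)
  odd-+ i k = cong suc (sym (dbl-+ i k))

  factor-~ : ∀ {N v} → v List.∈ words (dbl (suc N)) → ∀ p {d s i k} → Path 0 d → drop p v ≡ d ++ s →
             p ≡ odd i → length d ≡ dbl k → p + length d ≤ length v →
             i + k ≤ N × pt {N} i ~[ ⟨ v ⟩ ] pt (i + k)
  factor-~ {N} {v} v∈ p {d} {s} {i} {k} r e refl ld end≤ = i+k≤N ,
    from (~-partition (ht 0 v) (pt i) (pt (i + k))) (subst₂ (Cuts._≈_ (ht 0 v))
      (cong odd (sym (toℕ-pt (≤-trans (m≤m+n i k) i+k≤N))))
      (trans (cong (odd i +_) ld) (trans (odd-+ i k) (cong odd (sym (toℕ-pt i+k≤N)))))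
      (factor⇒≈ v p r e))
    where
    i+k≤N : i + k ≤ N
    i+k≤N = s≤s⁻¹ (odd-≤-dbl⁻ (≤-trans (≤-reflexive (sym (trans (cong (odd i +_) ld) (odd-+ i k))))
      (≤-trans end≤ (≤-reflexive (proj₂ (∈-paths⁻ 0 (dbl (suc N)) v∈))))))

  factor-~′ : ∀ {N v} → v List.∈ words (dbl (suc N)) → ∀ u d s {i k} → v ≡ u ++ d ++ s → Path 0 d →
              length u ≡ odd i → length d ≡ dbl k → pt {N} i ~[ ⟨ v ⟩ ] pt (i + k)
  factor-~′ v∈ u d s refl r lu ld = proj₂ (factor-~ v∈ (length u) r (drop-length-++ u (d ++ s)) lu ld
    (≤-trans (+-monoʳ-≤ (length u) (≤-trans (m≤m+n (length d) (length s)) (≤-reflexive (sym (length-++ d)))))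
      (≤-reflexive (sym (length-++ u)))))

  ⌊dbl/2⌋ : ∀ i → ⌊ dbl i /2⌋ ≡ i
  ⌊dbl/2⌋ zero    = refl
  ⌊dbl/2⌋ (suc i) = cong suc (⌊dbl/2⌋ i)

  ⌊odd/2⌋ : ∀ i → ⌊ odd i /2⌋ ≡ i
  ⌊odd/2⌋ zero    = refl
  ⌊odd/2⌋ (suc i) = cong suc (⌊odd/2⌋ i)

  parity-odd≢false : ∀ i → parity (odd i) ≢ false
  parity-odd≢false i e with trans (sym (cong not (parity-dbl i))) e
  ... | ()

  parity-dbl≢true : ∀ i → parity (dbl i) ≢ true
  parity-dbl≢true i e with trans (sym (parity-dbl i)) e
  ... | ()

  -- Every function that is constant on the blocks of σ and of τ is constant.
  Connects : ∀ {N} → Blocks (suc N) → Blocks (suc N) → Set₁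
  Connects {N} σ τ = ∀ {A : Set} (J : Fin (suc N) → A) → (∀ {i j} → i ~[ σ ] j → J i ≡ J j) →
                     (∀ {i j} → i ~[ τ ] j → J i ≡ J j) → ∀ i → i ≤ N → J (pt 0) ≡ J (pt i)

  connects⇒#∨≤1 : ∀ {N} (σ τ : Blocks (suc N)) → Connects σ τ → #∨ σ τ ≤ 1
  connects⇒#∨≤1 σ τ c = κ-connected es (pt 0) λ q →
    sym (subst (λ q → label es (pt 0) ≡ label es q) (pt-toℕ q)
      (c (label es) (λ p → label-edge es (List.∈-++⁺ˡ (from (∈-edges σ) p)))
        (λ p → label-edge es (List.∈-++⁺ʳ (edges σ) (from (∈-edges τ) p))) (toℕ q) (s≤s⁻¹ (Fin.toℕ<n q))))
    where es = edges σ ++ edges τ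

  module _ {n : ℕ} {w : Word} (w∈ : w List.∈ words (dbl (suc n))) where
    private
      r∈ = rotate∈words {n} w∈
    open Rotation (rotation {n} w∈)
    private
      kx = #D x
      ky = #D y
      lx = length-balanced path-x
      ly = length-balanced path-y

      length-w : length x + length y ≡ dbl n
      length-w = suc-injective (suc-injective (trans (cong suc (trans (sym (+-suc (length x) (length y))) (sym (length-++ x))))
        (trans (cong length (sym source)) (proj₂ (∈-paths⁻ 0 (dbl (suc n)) w∈)))))

      kx+ky : kx + ky ≡ n
      kx+ky = dbl-injective (trans (dbl-+ kx ky) (trans (cong₂ _+_ (sym lx) (sym ly)) length-w))

      source-x : ∀ u d s → x ≡ u ++ d ++ s → w ≡ (U ∷ u) ++ d ++ (s ++ D ∷ y)
      source-x u d s e = trans source (trans (cong (λ x → U ∷ x ++ D ∷ y) e) (cong (U ∷_) (reassoc u d s (D ∷ y))))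

      target-x : ∀ u d s → x ≡ u ++ d ++ s → rotate w ≡ u ++ d ++ (s ++ U ∷ y ++ [ D ])
      target-x u d s e = trans target (trans (cong (_++ U ∷ y ++ [ D ]) e) (reassoc u d s (U ∷ y ++ [ D ])))

      source-y : ∀ u d s → y ≡ u ++ d ++ s → w ≡ (U ∷ x ++ D ∷ u) ++ d ++ s
      source-y u d s e = trans source (trans (cong (λ y → U ∷ x ++ D ∷ y) e) (cong (U ∷_) (sym (++-assoc x (D ∷ u) (d ++ s)))))

      target-y : ∀ u d s → y ≡ u ++ d ++ s → rotate w ≡ (x ++ U ∷ u) ++ d ++ (s ++ [ D ])
      target-y u d s e = trans target (trans (cong (λ y → x ++ U ∷ y ++ [ D ]) e)
        (trans (cong (λ v → x ++ U ∷ v) (reassoc u d s [ D ])) (sym (++-assoc x (U ∷ u) _))))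

    module _ {A : Set} (J : Fin (suc n) → A) (joinˡ : ∀ {i j} → i ~[ ⟨ rotate w ⟩ ] j → J i ≡ J j)
             (joinʳ : ∀ {i j} → i ~[ ⟨ w ⟩ ] j → J i ≡ J j) where
      open Connectivity (kernel {suc n} J)

      -- Cut c of x is at position c + 1 in w and at c in the rotated word. It is odd in exactly one
      -- of them, and there it belongs to point ⌊ c /2⌋. The cuts 2 i and 2 i + 1 give the same
      -- point, which supplies the links starting at even cuts.
      x-cuts : ℕ → Fin (suc n)
      x-cuts c = pt ⌊ c /2⌋

      factors-x : Factors x x-cuts
      factors-x u d s e r with even⊎odd (length u)
      ... | inj₁ (i , lu) = trans
        (trans (cong (λ c → J (x-cuts c)) lu) (cong (J ∘ pt) (⌊dbl/2⌋ i)))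
        (trans (joinʳ (factor-~′ w∈ (U ∷ u) d (s ++ D ∷ y) {i} {#D d} (source-x u d s e) r (cong suc lu) (length-balanced r)))
          (trans (cong (J ∘ pt) (sym (⌊dbl/2⌋ (i + #D d)))) (cong (J ∘ x-cuts) (sym (trans (cong₂ _+_ lu (length-balanced r)) (sym (dbl-+ i (#D d))))))))
      ... | inj₂ (i , lu) = trans
        (trans (cong (λ c → J (x-cuts c)) lu) (cong (J ∘ pt) (⌊odd/2⌋ i)))
        (trans (joinˡ (factor-~′ r∈ u d (s ++ U ∷ y ++ [ D ]) {i} {#D d} (target-x u d s e) r lu (length-balanced r)))
          (trans (cong (J ∘ pt) (sym (⌊odd/2⌋ (i + #D d)))) (cong (J ∘ x-cuts) (sym (trans (cong₂ _+_ lu (length-balanced r)) (odd-+ i (#D d)))))))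

      links-x : ∀ p → p < length x → parity p ≡ false → J (x-cuts p) ≡ J (x-cuts (suc p))
      links-x p _ e with even⊎odd p
      ... | inj₁ (i , refl) = cong (J ∘ pt) (trans (⌊dbl/2⌋ i) (sym (⌊odd/2⌋ i)))
      ... | inj₂ (i , refl) = contradiction e (parity-odd≢false i)

      -- Cut c of y is at position 2 kx + 2 + c in w and at 2 kx + 1 + c in the rotated word. Now
      -- the odd c belong to w, points are obtained by rounding up, and the links start at odd cuts.
      y-cuts : ℕ → Fin (suc n)
      y-cuts c = pt (kx + ⌈ c /2⌉)

      factors-y : Factors y y-cuts
      factors-y u d s e r with even⊎odd (length u)
      ... | inj₁ (i , lu) = trans
        (trans (cong (J ∘ y-cuts) lu) (cong (λ k → J (pt (kx + k))) (⌊odd/2⌋ i)))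
        (trans (joinˡ (factor-~′ r∈ (x ++ U ∷ u) d (s ++ [ D ]) {kx + i} {#D d} (target-y u d s e) r
            (trans (length-++ x) (trans (cong₂ (λ a b → a + suc b) lx lu) (trans (+-suc (dbl kx) (dbl i)) (cong suc (sym (dbl-+ kx i))))))
            (length-balanced r)))
          (trans (cong (J ∘ pt) (trans (+-assoc kx i (#D d)) (cong (kx +_) (sym (⌊odd/2⌋ (i + #D d))))))
            (cong (J ∘ y-cuts) (sym (trans (cong₂ _+_ lu (length-balanced r)) (sym (dbl-+ i (#D d))))))))
      ... | inj₂ (i , lu) = trans
        (trans (cong (J ∘ y-cuts) lu) (cong (λ k → J (pt (kx + k))) (⌊dbl/2⌋ (suc i))))
        (trans (joinʳ (factor-~′ w∈ (U ∷ x ++ D ∷ u) d s {kx + suc i} {#D d} (source-y u d s e) r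
            (cong suc (trans (length-++ x) (trans (cong₂ (λ a b → a + suc b) lx lu) (sym (dbl-+ kx (suc i))))))
            (length-balanced r)))
          (trans (cong (J ∘ pt) (trans (+-assoc kx (suc i) (#D d)) (cong (kx +_) (sym (⌊dbl/2⌋ (suc (i + #D d)))))))
            (cong (J ∘ y-cuts) (sym (trans (cong₂ _+_ lu (length-balanced r)) (odd-+ i (#D d)))))))

      links-y : ∀ p → p < length y → parity p ≡ true → J (y-cuts p) ≡ J (y-cuts (suc p))
      links-y p _ e with even⊎odd p
      ... | inj₁ (i , refl) = contradiction e (parity-dbl≢true i)
      ... | inj₂ (i , refl) = cong (λ k → J (pt (kx + k))) (trans (⌊dbl/2⌋ (suc i)) (cong suc (sym (⌊odd/2⌋ i))))

      x-joined : ∀ i → i ≤ kx → J (pt 0) ≡ J (pt i)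
      x-joined i i≤ = trans (connect-cuts (tree path-x) false x-cuts factors-x links-x (dbl i) (≤-trans (dbl-≤ i≤) (≤-reflexive (sym lx))))
        (cong (J ∘ pt) (⌊dbl/2⌋ i))

      y-joined : ∀ i → i ≤ ky → J (pt kx) ≡ J (pt (kx + i))
      y-joined i i≤ = trans (cong (J ∘ pt) (sym (+-identityʳ kx)))
        (trans (connect-cuts (tree path-y) true y-cuts factors-y links-y (dbl i) (≤-trans (dbl-≤ i≤) (≤-reflexive (sym ly))))
          (cong (λ k → J (pt (kx + k))) (⌊odd/2⌋ i)))

      -- The cuts of x account for the points up to kx and those of y for the points from kx on; the
      -- shared point kx connects the two parts.
      all-joined : ∀ i → i ≤ n → J (pt 0) ≡ J (pt i)
      all-joined i i≤n with ≤-total i kx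
      ... | inj₁ i≤kx = x-joined i i≤kx
      ... | inj₂ kx≤i with m≤n⇒∃[o]m+o≡n kx≤i
      ...   | k , refl = trans (x-joined kx ≤-refl) (y-joined k (+-cancelˡ-≤ kx _ _ (≤-trans i≤n (≤-reflexive (sym kx+ky)))))

    #∨-rotate : #∨ (⟨_⟩ {suc n} (rotate w)) ⟨ w ⟩ ≤ 1
    #∨-rotate = connects⇒#∨≤1 ⟨ rotate w ⟩ ⟨ w ⟩ all-joined

    private
      M = suc (dbl n)
      -- Doubling turns an arc U d D into U (U d′ D) D with d′ the double of d; the balanced factor
      -- in the middle runs between the odd cuts of the two end points.
      arc-~ : ∀ {v} → v List.∈ words (suc M) → ∀ u d s → v ≡ u ++ U ∷ d ++ D ∷ s → Path 0 d →
              pt {M} (length u) ~[ ⟪ v ⟫ ] pt (suc (length u + length d))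
      arc-~ {v} v∈ u d s e r = subst (λ k → pt {M} (length u) ~[ ⟨_⟩ {suc M} (double v) ] pt k) (+-suc (length u) (length d))
        (factor-~′ {M} (double∈words {suc M} v∈) (double u ++ [ U ]) (U ∷ double d ++ [ D ]) (D ∷ double s) {length u} {suc (length d)}
          doubled (up (path-++ (double-path⁺ r) (down [])))
          (trans (length-++ (double u)) (trans (+-comm _ 1) (cong suc (length-double u))))
          (cong suc (trans (length-++ (double d)) (trans (+-comm _ 1) (cong suc (length-double d))))))
        where
        doubled : double v ≡ (double u ++ [ U ]) ++ (U ∷ double d ++ [ D ]) ++ D ∷ double s
        doubled = trans (cong double e) (trans (double-++ u _) (trans
          (cong (λ z → double u ++ U ∷ U ∷ z) (trans (double-++ d (D ∷ s)) (sym (++-assoc (double d) [ D ] (D ∷ double s)))))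
          (sym (++-assoc (double u) [ U ] _))))

    module _ {A : Set} (J : Fin (suc M) → A) (joinˡ : ∀ {i j} → i ~[ ⟪ rotate w ⟫ ] j → J i ≡ J j)
             (joinʳ : ∀ {i j} → i ~[ ⟪ w ⟫ ] j → J i ≡ J j) where
      private module C = Connectivity (kernel {suc M} J)

      arcs-source : C.Arcs w pt
      arcs-source u d s e r = joinʳ (arc-~ w∈ u d s e r)

      arcs-target : C.Arcs (rotate w) pt
      arcs-target u d s e r = joinˡ (arc-~ r∈ u d s e r)

      x-joinedᵐ : ∀ c → c ≤ length x → J (pt 0) ≡ J (pt c)
      x-joinedᵐ = C.connect-arcs (tree path-x) pt
        (C.arcs-left [] x (U ∷ y ++ [ D ]) {pt} (subst (λ v → C.Arcs v pt) target arcs-target))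
        (C.arcs-left [ U ] x (D ∷ y) {pt} (subst (λ v → C.Arcs v pt) source arcs-source))

      y-joinedᵐ : ∀ c → c ≤ length y → J (pt (suc (length x + 0))) ≡ J (pt (suc (length x + c)))
      y-joinedᵐ = C.connect-arcs (tree path-y) (λ c → pt (suc (length x + c)))
        (subst (λ k → C.Arcs y (λ c → pt (k + c))) (trans (length-++ x) (+-comm (length x) 1))
          (C.arcs-left (x ++ [ U ]) y [ D ] {pt}
            (subst (λ v → C.Arcs v pt) (trans target (sym (++-assoc x [ U ] (y ++ [ D ])))) arcs-target)))
        λ u d s e q → subst₂ (λ a b → J (pt a) ≡ J (pt b)) (sym (cong suc (+-suc (length x) _))) (sym (cong suc (+-suc (length x) _)))
          (subst (λ k → C.Arcs y (λ c → pt (k + c))) (length-node-left x)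
            (C.arcs-left (U ∷ x ++ [ D ]) y [] {pt}
              (subst (λ v → C.Arcs v pt) (trans source (node-right x y)) arcs-source)) u d s e q)

      all-joinedᵐ : ∀ i → i ≤ M → J (pt 0) ≡ J (pt i)
      all-joinedᵐ i i≤ with i ≤? length x
      ... | yes i≤x = x-joinedᵐ i i≤x
      ... | no i≰x with m≤n⇒∃[o]m+o≡n (≰⇒> i≰x)
      -- The arc around x in w joins point 0 to point suc (length x), from which `y-joinedᵐ`
      -- continues.
      ...   | c , refl = trans (arcs-source [] x y source path-x)
        (trans (cong (λ k → J (pt (suc k))) (sym (+-identityʳ (length x))))
          (y-joinedᵐ c (+-cancelˡ-≤ (suc (length x)) _ _ (≤-trans i≤ (≤-reflexive (cong suc (sym length-w)))))))

    #∨-rotateᵐ : #∨ (⟪_⟫ {dbl (suc n)} (rotate w)) ⟪ w ⟫ ≤ 1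
    #∨-rotateᵐ = connects⇒#∨≤1 ⟪ rotate w ⟫ ⟪ w ⟫ all-joinedᵐ

  found⁻ : ∀ K v w → found K v w ≡ true → ∃ λ k → common (dbl (suc k)) v w ≡ true
  found⁻ (suc K) v w e with found K v w in f
  ... | true  = found⁻ K v w f
  ... | false = K , e

  ∧⁻ : ∀ a b → a ∧ b ≡ true → a ≡ true × b ≡ true
  ∧⁻ true true _ = refl , refl

  record Prefix (k : ℕ) (v : Word) : Set where
    field
      {d s} : Word
      path   : Path 0 d
      split≡ : v ≡ d ++ s
      length≡ : length d ≡ dbl k

  prefix : ∀ k v → balanced 0 (dbl k) v ≡ true → Prefix k v
  prefix k v e with balanced⁻ 0 (dbl k) v e
  ... | d , s , v≡ , l , r = record { path = r ; split≡ = v≡ ; length≡ = l }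

  prefix-end : ∀ {k} p v → p ≤ length v → Prefix k (drop p v) → p + dbl k ≤ length v
  prefix-end {k} p v p≤ pr = ≤-trans (+-monoʳ-≤ p (≤-trans (≤-reflexive (sym length≡)) (≤-trans (m≤m+n (length d) (length s))
      (≤-reflexive (trans (sym (length-++ d)) (trans (cong length (sym split≡)) (length-drop p v)))))))
    (≤-reflexive (m+[n∸m]≡n p≤))
    where open Prefix pr

  found⇒prefixes : ∀ K v w → found K v w ≡ true → ∃ λ k → Prefix (suc k) v × Prefix (suc k) w
  found⇒prefixes K v w e = let k , c = found⁻ K v w e
                               a , b = ∧⁻ (balanced 0 (dbl (suc k)) v) _ c in
    k , prefix (suc k) v a , prefix (suc k) w b

  count-complement : ∀ {n} (P : Fin n → Bool) → count P + count (not ∘ P) ≡ n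
  count-complement {zero}  P = refl
  count-complement {suc n} P with P Fin.zero
  ... | true  = cong suc (count-complement (P ∘ Fin.suc))
  ... | false = trans (+-suc _ _) (cong suc (count-complement (P ∘ Fin.suc)))

  module _ {N : ℕ} {v w : Word} (v∈ : v List.∈ words (dbl (suc N))) (w∈ : w List.∈ words (dbl (suc N))) where

    -- A common factor starting at the cut of i leads to the cut of the same later point in both
    -- words, so i is not the last element of its block of the meet; and blocks are counted at last
    -- elements.
    #∩-found : ∀ K → # (⟨_⟩ {suc N} v ∩ᴾ ⟨ w ⟩) + count {suc N} (λ i → found K (drop (odd (toℕ i)) v) (drop (odd (toℕ i)) w)) ≤ suc N
    #∩-found K = ≤-trans (+-mono-≤ (≤-reflexive (#≡count-last meet)) (count-mono gains))
      (≤-reflexive (trans (+-comm (count {suc N} (λ i → not (does (hasLater? μ i)))) (count {suc N} (λ i → does (hasLater? μ i))))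
        (count-complement (λ i → does (hasLater? μ i)))))
      where
      μ = ⟨_⟩ {suc N} v ∩ᴾ ⟨ w ⟩
      meet = ∈NC⁻ (∩ᴾ∈NC (∈NC⁻ (partition∈NC {suc N} (ht 0 v))) (∈NC⁻ (partition∈NC {suc N} (ht 0 w))))
      later : ∀ {z} → z List.∈ words (dbl (suc N)) → ∀ i {k} → Prefix (suc k) (drop (odd (toℕ i)) z) →
              toℕ i + suc k ≤ N × i ~[ ⟨ z ⟩ ] pt (toℕ i + suc k)
      later {z} z∈ i {k} pr = let le , p = factor-~ z∈ (odd (toℕ i)) {i = toℕ i} {suc k} path split≡ refl length≡
                                             (subst (λ t → odd (toℕ i) + t ≤ length z) (sym length≡) (prefix-end (odd (toℕ i)) z i≤ pr)) in
        le , subst (λ j → j ~[ ⟨ z ⟩ ] pt (toℕ i + suc k)) (pt-toℕ i) p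
        where
        open Prefix pr
        i≤ : odd (toℕ i) ≤ length z
        i≤ = ≤-trans (<⇒≤ (odd-<-dbl (Fin.toℕ<n i))) (≤-reflexive (sym (proj₂ (∈-paths⁻ 0 (dbl (suc N)) z∈))))
      gains : ∀ i → found K (drop (odd (toℕ i)) v) (drop (odd (toℕ i)) w) ≡ true → does (hasLater? μ i) ≡ true
      gains i e = let k , pv , pw = found⇒prefixes K _ _ e
                      le , p = later v∈ i pv
                      _ , q = later w∈ i pw in
        dec-true (hasLater? μ i) (pt (toℕ i + suc k) ,
          subst (toℕ i <_) (sym (toℕ-pt le)) (≤-trans (s≤s (m≤m+n (toℕ i) k)) (≤-reflexive (sym (+-suc (toℕ i) k)))) ,
          from (∩ᴾ-~ ⟨ v ⟩ ⟨ w ⟩ {i} {pt (toℕ i + suc k)}) (p , q))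

  module _ {m : ℕ} where

    inside : ℕ → ℕ → Fin m → Bool
    inside p q i = does (p ≤? toℕ i) ∧ does (toℕ i <? q)

    inside⁺ : ∀ {p q i} → p ≤ toℕ i → toℕ i < q → inside p q i ≡ true
    inside⁺ {p} {q} {i} a b = cong₂ _∧_ (dec-true (p ≤? toℕ i) a) (dec-true (toℕ i <? q) b)

    inside⁻ : ∀ {p q i} → inside p q i ≡ true → p ≤ toℕ i × toℕ i < q
    inside⁻ {p} {q} {i} e = let a , b = ∧⁻ _ _ e in does⁻ (p ≤? toℕ i) a , does⁻ (toℕ i <? q) b

    module _ {z : Word} (z∈ : z List.∈ words m) {p k : ℕ} (p≤ : p ≤ m) (pr : Prefix k (drop p z)) where
      open Prefix pr
      private
        Z = double z
        q = p + dbl k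
        q≤ : q ≤ m
        q≤ = ≤-trans (prefix-end p z (≤-trans p≤ (≤-reflexive (sym (proj₂ (∈-paths⁻ 0 m z∈))))) pr) (≤-reflexive (proj₂ (∈-paths⁻ 0 m z∈)))
        dyck = word-dyck {m} (double∈words {m} z∈)
        open Cuts (ht 0 Z)
        drop-double : ∀ p z → drop (dbl p) (double z) ≡ double (drop p z)
        drop-double zero    z       = refl
        drop-double (suc p) []      = refl
        drop-double (suc p) (b ∷ z) = drop-double p z
        ends : dbl p ≈ dbl q
        ends = subst (dbl p ≈_) (trans (cong (dbl p +_) (trans (length-double d) (cong dbl length≡))) (sym (dbl-+ p (dbl k))))
          (factor⇒≈ Z (dbl p) (double-path⁺ path) (trans (drop-double p z) (trans (cong double split≡) (double-++ d s))))
        cut≤ : ∀ (i : Fin m) → odd (toℕ i) ≤ dbl m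
        cut≤ i = <⇒≤ (odd-<-dbl (Fin.toℕ<n i))
        odd≉dbl : ∀ (i : Fin m) r → r ≤ m → ¬ odd (toℕ i) ≈ dbl r
        odd≉dbl i r r≤ h with Dyck.≈-odd dyck {toℕ i} (cut≤ i) (dbl-≤ r≤) h
        ... | j , e = parity-dbl≢true r (trans (cong parity e) (cong not (parity-dbl j)))

      -- In the doubled word the ends of the factor are equivalent even cuts. An arc leaving the
      -- factor would cross this pair and make an odd cut equivalent to an even one.
      inside-closed : ∀ i j → i ~[ ⟪ z ⟫ ] j → inside p q i ≡ true → inside p q j ≡ true
      inside-closed i j ij e with inside⁻ {p} {q} e
      ... | p≤i , i<q with toℕ j <? p | q ≤? toℕ j
      ...   | no j≮p  | no q≰j  = inside⁺ (≮⇒≥ j≮p) (≰⇒> q≰j)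
      ...   | yes j<p | _       = contradiction
        (≈-trans {odd (toℕ i)} {odd (toℕ j)} {dbl p} h
          (≈-noncrossing {odd (toℕ j)} {dbl p} {odd (toℕ i)} {dbl q} (odd-<-dbl j<p) (s≤s (dbl-≤ p≤i)) (odd-<-dbl i<q)
          (≈-sym {odd (toℕ i)} {odd (toℕ j)} h) ends)) (odd≉dbl i p p≤)
        where h = to (~-partition (ht 0 Z) i j) ij
      ...   | no _    | yes q≤j = contradiction
        (≈-sym {dbl p} {odd (toℕ i)} (≈-noncrossing {dbl p} {odd (toℕ i)} {dbl q} {odd (toℕ j)} (s≤s (dbl-≤ p≤i)) (odd-<-dbl i<q) (s≤s (dbl-≤ q≤j))
          ends (to (~-partition (ht 0 Z) i j) ij))) (odd≉dbl i p p≤)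

    module _ {v w : Word} (v∈ : v List.∈ words m) (w∈ : w List.∈ words m) where

      -- A common balanced factor is closed under both matchings, so the point at which it
      -- starts is the least point of its curve.
      found-≤-#∨ : ∀ K → count {m} (λ i → found K (drop (toℕ i) v) (drop (toℕ i) w)) ≤ #∨ (⟪_⟫ {m} v) ⟪ w ⟫
      found-≤-#∨ K = count-injective ℓ (λ i _ → fixed⁺ ℓ (label-idempotent es i)) λ i j fi fj e → apart i j fi fj e
        where
        es = edges (⟪_⟫ {m} v) ++ edges ⟪ w ⟫
        ℓ = label es
        bool-ext : ∀ {a b} → (a ≡ true → b ≡ true) → (b ≡ true → a ≡ true) → a ≡ b
        bool-ext {true}  {b}     f g = sym (f refl)
        bool-ext {false} {true}  f g = g refl
        bool-ext {false} {false} f g = refl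
        separated : ∀ {k} i → Prefix (suc k) (drop (toℕ i) v) → Prefix (suc k) (drop (toℕ i) w) →
                    ∀ x y → ℓ x ≡ ℓ y → inside (toℕ i) (toℕ i + dbl (suc k)) x ≡ inside (toℕ i) (toℕ i + dbl (suc k)) y
        separated {k} i pv pw = label⇒related (kernel (inside (toℕ i) (toℕ i + dbl (suc k)))) es λ {x} {y} h → edge x y (List.∈-++⁻ (edges ⟪ v ⟫) h)
          where
          i≤m = <⇒≤ (Fin.toℕ<n i)
          both : ∀ {z} → z List.∈ words m → Prefix (suc k) (drop (toℕ i) z) → ∀ x y → x ~[ ⟪ z ⟫ ] y →
                 inside (toℕ i) (toℕ i + dbl (suc k)) x ≡ inside (toℕ i) (toℕ i + dbl (suc k)) y
          both {z} z∈ pr x y h = bool-ext (inside-closed z∈ i≤m pr x y h)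
            (inside-closed z∈ i≤m pr y x (IsNC.~-sym (∈NC⁻ (partition∈NC {m} (ht 0 (double z)))) h))
          edge : ∀ x y → _ ⊎ _ → _
          edge x y (inj₁ h) = both v∈ pv x y (to (∈-edges ⟪ v ⟫) h)
          edge x y (inj₂ h) = both w∈ pw x y (to (∈-edges ⟪ w ⟫) h)
        -- The common factor starting at j contains j but no smaller i, and membership in it is
        -- constant on curves.
        ordered : ∀ i j → found K (drop (toℕ j) v) (drop (toℕ j) w) ≡ true → ℓ i ≡ ℓ j → ¬ i Fin.< j
        ordered i j fj e i<j = let k , pv , pw = found⇒prefixes K _ _ fj in
          <⇒≱ i<j (proj₁ (inside⁻ {toℕ j} {toℕ j + dbl (suc k)} {i} (trans (separated j pv pw i j e)
            (inside⁺ {toℕ j} {toℕ j + dbl (suc k)} {j} ≤-refl (m<m+n (toℕ j) (s≤s z≤n))))))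
        apart : ∀ i j → found K (drop (toℕ i) v) (drop (toℕ i) w) ≡ true → found K (drop (toℕ j) v) (drop (toℕ j) w) ≡ true →
                ℓ i ≡ ℓ j → i ≡ j
        apart i j fi fj e with Fin.<-cmp i j
        ... | tri< i<j _ _ = contradiction i<j (ordered i j fj e)
        ... | tri≈ _ i≡j _ = i≡j
        ... | tri> _ _ j<i = contradiction j<i (ordered j i fi (sym e))

-- Averaging over pairs of words.

module Totals where

  open Sums
  open Components
  open Graphs
  open Partitions
  open Covers
  open Levels
  open DyckWords
  open Renewal
  open Rotations using (rotate; rotate∈words; oddD-rotate; #⟨⟩; #⟪⟫; ∑-rotate)
  open Joins
  open import Data.Fin using (toℕ)
  open import Data.List using (List; length; drop; cartesianProduct)
  import Data.List.Membership.Propositional as List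
  import Data.List.Membership.Propositional.Properties as List
  open import Data.Nat using (ℕ; suc; _+_; _*_; _∸_; _≤_; _<_)
  open import Data.Nat.Properties
  open import Data.Nat.Solver using (module +-*-Solver)
  open +-*-Solver using (solve; _:=_; _:+_; _:*_; con)

  open Equivalence using (to; from)

  ∑∑ : {A : Set} → List A → (A → A → ℕ) → ℕ
  ∑∑ xs f = ∑ xs λ x → ∑ xs (f x)

  module _ {A : Set} (xs : List A) where

    ∑∑-mono : {f g : A → A → ℕ} → (∀ x y → x List.∈ xs → y List.∈ xs → f x y ≤ g x y) → ∑∑ xs f ≤ ∑∑ xs g
    ∑∑-mono h = ∑-mono xs λ x x∈ → ∑-mono xs λ y y∈ → h x y x∈ y∈

    ∑∑-+ : (f g : A → A → ℕ) → ∑∑ xs (λ x y → f x y + g x y) ≡ ∑∑ xs f + ∑∑ xs g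
    ∑∑-+ f g = trans (∑-cong xs λ x _ → ∑-+ xs (f x) (g x)) (∑-+ xs _ _)

    ∑∑-const : (c : ℕ) → ∑∑ xs (λ _ _ → c) ≡ length xs * (length xs * c)
    ∑∑-const c = trans (∑-cong xs λ _ _ → ∑-const xs c) (∑-const xs _)

    ∑∑-left : (f : A → ℕ) → ∑∑ xs (λ x _ → f x) ≡ length xs * ∑ xs f
    ∑∑-left f = trans (∑-cong xs λ x _ → ∑-const xs (f x)) (∑-* xs (length xs) f)

    ∑∑-right : (f : A → ℕ) → ∑∑ xs (λ _ → f) ≡ length xs * ∑ xs f
    ∑∑-right f = ∑-const xs _

    ∑∑-swap : (f : A → A → ℕ) → ∑∑ xs f ≡ ∑∑ xs (λ x y → f y x)
    ∑∑-swap f = ∑-swap xs xs f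

  module _ (k : ℕ) where
    private
      n = suc k
      W = words (dbl n)
      C = length W

    distance : Word → Word → ℕ
    distance v w = d-H {n} ⟨ v ⟩ ⟨ w ⟩

    #⟨⟩-rotate : ∀ {w} → w List.∈ W → # (⟨_⟩ {n} w) + # (⟨_⟩ {n} (rotate w)) ≡ suc n
    #⟨⟩-rotate {w} w∈ = trans (cong₂ _+_ (#⟨⟩ {n} w∈) (#⟨⟩ {n} (rotate∈words {k} w∈))) (oddD-rotate {k} w∈)

    ∑-# : ∑ W (λ w → # (⟨_⟩ {n} w)) + ∑ W (λ w → # (⟨_⟩ {n} w)) ≡ C * suc n
    ∑-# = trans (cong (∑ W (λ w → # (⟨_⟩ {n} w)) +_) (sym (∑-rotate k λ w → # (⟨_⟩ {n} w))))
      (trans (sym (∑-+ W _ _)) (trans (∑-cong W λ w w∈ → #⟨⟩-rotate w∈) (∑-const W (suc n))))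

    distance-lower : k * (C * C) ≤ 2 * ∑∑ W distance
    distance-lower = +-cancelʳ-≤ (C * (C * 2)) _ _ (begin
      k * (C * C) + C * (C * 2)
        ≡⟨ solve 2 (λ k c → k :* (c :* c) :+ c :* (c :* con 2) := c :* (c :* (con 2 :+ k))) refl k C ⟩
      C * (C * suc n)
        ≡⟨ ∑∑-const W (suc n) ⟨
      ∑∑ W (λ _ _ → suc n)
        ≤⟨ ∑∑-mono W (λ w v w∈ v∈ → bound w v w∈) ⟩
      ∑∑ W (λ w v → distance (rotate w) v + distance v w + 2)
        ≡⟨ trans (∑∑-+ W _ _) (cong₂ _+_ (∑∑-+ W _ _) (∑∑-const W 2)) ⟩
      ∑∑ W (λ w v → distance (rotate w) v) + ∑∑ W (λ w v → distance v w) + C * (C * 2)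
        ≡⟨ cong (_+ C * (C * 2)) (cong₂ _+_ (∑-rotate k λ w → ∑ W (distance w)) (∑∑-swap W λ w v → distance v w)) ⟩
      ∑∑ W distance + ∑∑ W distance + C * (C * 2)
        ≡⟨ cong (λ t → ∑∑ W distance + t + C * (C * 2)) (sym (+-identityʳ (∑∑ W distance))) ⟩
      2 * ∑∑ W distance + C * (C * 2) ∎)
      where
      open ≤-Reasoning
      bound : ∀ w v → w List.∈ W → suc n ≤ distance (rotate w) v + distance v w + 2
      bound w v w∈ = +-cancelʳ-≤ (#v + #v) _ _ (begin
        suc n + (#v + #v)
          ≡⟨ cong (_+ (#v + #v)) (#⟨⟩-rotate w∈) ⟨
        #w + #w′ + (#v + #v)
          ≡⟨ solve 3 (λ a b c → a :+ b :+ (c :+ c) := b :+ c :+ (c :+ a)) refl #w #w′ #v ⟩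
        #w′ + #v + (#v + #w)
          ≤⟨ +-mono-≤ (d-H-lower (partition∈NC {n} (ht 0 (rotate w))) (partition∈NC {n} (ht 0 v))) (d-H-lower (partition∈NC {n} (ht 0 v)) (partition∈NC {n} (ht 0 w))) ⟩
        distance (rotate w) v + (a + a) + (distance v w + (b + b))
          ≡⟨ solve 4 (λ d e a b → d :+ (a :+ a) :+ (e :+ (b :+ b)) := d :+ e :+ ((a :+ b) :+ (a :+ b))) refl (distance (rotate w) v) (distance v w) a b ⟩
        distance (rotate w) v + distance v w + ((a + b) + (a + b))
          ≤⟨ +-monoʳ-≤ (distance (rotate w) v + distance v w) (+-mono-≤ joins joins) ⟩
        distance (rotate w) v + distance v w + ((#v + 1) + (#v + 1))
          ≡⟨ solve 2 (λ d c → d :+ ((c :+ con 1) :+ (c :+ con 1)) := d :+ con 2 :+ (c :+ c)) refl (distance (rotate w) v + distance v w) #v ⟩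
        distance (rotate w) v + distance v w + 2 + (#v + #v) ∎)
        where
        #w = # (⟨_⟩ {n} w)
        #w′ = # (⟨_⟩ {n} (rotate w))
        #v = # (⟨_⟩ {n} v)
        a = #∨ (⟨_⟩ {n} (rotate w)) ⟨ v ⟩
        b = #∨ (⟨_⟩ {n} v) ⟨ w ⟩
        -- Submodularity with v in the middle leaves the join of w with its rotation as the outer
        -- term, which has a single block.
        joins : a + b ≤ #v + 1
        joins = ≤-trans (κ-submodular (edges (⟨_⟩ {n} (rotate w))) (edges ⟨ v ⟩) (edges ⟨ w ⟩)) (+-monoʳ-≤ #v (#∨-rotate {k} w∈))

    curves : Word → Word → ℕ
    curves v w = #∨ (⟪_⟫ {dbl n} v) ⟪ w ⟫

    curves-upper : 2 * ∑∑ W curves ≤ suc n * (C * C)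
    curves-upper = begin
      2 * ∑∑ W curves
        ≡⟨ cong (∑∑ W curves +_) (+-identityʳ (∑∑ W curves)) ⟩
      ∑∑ W curves + ∑∑ W curves
        ≡⟨ cong₂ _+_ (sym (∑-rotate k λ w → ∑ W (curves w))) (∑∑-swap W curves) ⟩
      ∑∑ W (λ w v → curves (rotate w) v) + ∑∑ W (λ w v → curves v w)
        ≡⟨ ∑∑-+ W _ _ ⟨
      ∑∑ W (λ w v → curves (rotate w) v + curves v w)
        ≤⟨ ∑∑-mono W (λ w v w∈ v∈ → ≤-trans (κ-submodular (edges (⟪_⟫ {dbl n} (rotate w))) (edges ⟪ v ⟫) (edges ⟪ w ⟫))
             (+-mono-≤ (≤-reflexive (#⟪⟫ n v∈)) (#∨-rotateᵐ {k} w∈))) ⟩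
      ∑∑ W (λ _ _ → n + 1)
        ≡⟨ ∑∑-const W (n + 1) ⟩
      C * (C * (n + 1))
        ≡⟨ solve 2 (λ c n → c :* (c :* (n :+ con 1)) := (con 1 :+ n) :* (c :* c)) refl C n ⟩
      suc n * (C * C) ∎
      where open ≤-Reasoning

    module _ (a b K : ℕ) (K≤n : K ≤ n) (hits-≥ : ∀ p → p ≤ dbl (n ∸ K) → a * cat² n ≤ b * hits n K p) where

      -- `cut` is `odd` for partitions and the identity for matchings, where every position of the
      -- word is a point; r is a number of initial points whose cuts have room for a factor of
      -- length 2 K.
      ∑∑-hits : ∀ m (cut : ℕ → ℕ) r → r ≤ m → (∀ i → i < r → cut i ≤ dbl (n ∸ K)) →
        r * (a * (C * C)) ≤ b * ∑∑ W (λ v w → count {m} λ i → found K (drop (cut (toℕ i)) v) (drop (cut (toℕ i)) w))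
      ∑∑-hits m cut r r≤m cut≤ = ≤-trans
        (∑-count (cartesianProduct W W) (λ (v , w) i → found K (drop (cut (toℕ i)) v) (drop (cut (toℕ i)) w)) b r (a * (C * C)) r≤m
          λ i i<r → ≤-trans (hits-≥ (cut (toℕ i)) (cut≤ (toℕ i) i<r)) (≤-reflexive (cong (b *_) (sym (∑-cartesian W W _)))))
        (≤-reflexive (cong (b *_) (∑-cartesian W W _)))

      curves-lower : dbl (n ∸ K) * (a * (C * C)) ≤ b * ∑∑ W curves
      curves-lower = ≤-trans
        (∑∑-hits (dbl n) (λ p → p) (dbl (n ∸ K)) (dbl-≤ (m∸n≤m n K)) λ i i<r → <⇒≤ i<r)
        (*-monoʳ-≤ b (∑∑-mono W λ v w v∈ w∈ → found-≤-#∨ v∈ w∈ K))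

      -- For each pair the distance plus both block numbers plus twice the number of common-factor
      -- points is at most 2 n. The two block numbers together average n + 1 by `∑-#`.
      distance-upper : b * ∑∑ W distance + 2 * ((n ∸ K) * (a * (C * C))) ≤ b * (n * (C * C))
      distance-upper = +-cancelʳ-≤ (b * (C * (C * suc n))) _ _ (begin
        b * T + 2 * (r * (a * (C * C))) + b * (C * (C * suc n))
          ≡⟨ cong (λ s → b * T + 2 * (r * (a * (C * C))) + b * s) sizes ⟩
        b * T + 2 * (r * (a * (C * C))) + b * (Σ#ˡ + Σ#ʳ)
          ≤⟨ +-monoˡ-≤ (b * (Σ#ˡ + Σ#ʳ)) (+-monoʳ-≤ (b * T) (*-monoʳ-≤ 2 (∑∑-hits n odd r (m∸n≤m n K) λ i i<r → <⇒≤ (odd-<-dbl i<r)))) ⟩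
        b * T + 2 * (b * Γ) + b * (Σ#ˡ + Σ#ʳ)
          ≡⟨ solve 5 (λ b t g x y → b :* t :+ con 2 :* (b :* g) :+ b :* (x :+ y) :=
               b :* (t :+ (x :+ y) :+ (g :+ g))) refl b T Γ Σ#ˡ Σ#ʳ ⟩
        b * (T + (Σ#ˡ + Σ#ʳ) + (Γ + Γ))
          ≤⟨ *-monoʳ-≤ b pointwise ⟩
        b * (C * (C * (n + n)))
          -- Weakens 2 n to n + (n + 1), so that the average n + 1 of the block numbers cancels.
          ≤⟨ *-monoʳ-≤ b (≤-trans (m≤m+n _ (C * C)) (≤-reflexive (solve 2 (λ c n → c :* (c :* (n :+ n)) :+ c :* c := n :* (c :* c) :+ c :* (c :* (con 1 :+ n))) refl C n))) ⟩
        b * (n * (C * C) + C * (C * suc n))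
          ≡⟨ *-distribˡ-+ b (n * (C * C)) _ ⟩
        b * (n * (C * C)) + b * (C * (C * suc n)) ∎)
        where
        open ≤-Reasoning
        T = ∑∑ W distance
        r = n ∸ K
        g : Word → Word → ℕ
        g v w = count {n} λ i → found K (drop (odd (toℕ i)) v) (drop (odd (toℕ i)) w)
        Γ = ∑∑ W g
        Σ#ˡ = ∑∑ W λ v w → # (⟨_⟩ {n} v)
        Σ#ʳ = ∑∑ W λ v w → # (⟨_⟩ {n} w)
        sizes : C * (C * suc n) ≡ Σ#ˡ + Σ#ʳ
        sizes = trans (cong (C *_) (sym ∑-#)) (trans (*-distribˡ-+ C _ _) (sym (cong₂ _+_ (∑∑-left W _) (∑∑-right W _))))
        pointwise : T + (Σ#ˡ + Σ#ʳ) + (Γ + Γ) ≤ C * (C * (n + n))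
        pointwise = ≤-trans (≤-reflexive (trans (cong₂ _+_ (trans (cong (T +_) (sym (∑∑-+ W _ _))) (sym (∑∑-+ W _ _))) (sym (∑∑-+ W g g))) (sym (∑∑-+ W _ _))))
          (≤-trans (∑∑-mono W λ v w v∈ w∈ → bound v w v∈ w∈) (≤-reflexive (∑∑-const W (n + n))))
          where
          bound : ∀ v w → v List.∈ W → w List.∈ W → distance v w + (# (⟨_⟩ {n} v) + # (⟨_⟩ {n} w)) + (g v w + g v w) ≤ n + n
          bound v w v∈ w∈ = ≤-trans (+-monoˡ-≤ (g v w + g v w) (d-H-upper (partition∈NC {n} (ht 0 v)) (partition∈NC {n} (ht 0 w))))
            (≤-trans (≤-reflexive (solve 2 (λ a b → a :+ a :+ (b :+ b) := a :+ b :+ (a :+ b)) refl (# (⟨_⟩ {n} v ∩ᴾ ⟨ w ⟩)) (g v w)))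
              (+-mono-≤ (#∩-found v∈ w∈ K) (#∩-found v∈ w∈ K)))

-- From sums over words to the means in the statement.

module Means where

  open Sums
  open Components
  open Graphs
  open Partitions
  open Levels
  open DyckWords
  open Renewal
  open Totals
  open import Data.List using (List; _∷_; length; map; cartesianProduct)
  import Data.List.Membership.Propositional as List
  import Data.List.Membership.Propositional.Properties as List
  open import Data.Nat
  open import Data.Nat.ListAction using (sum)
  open import Data.Nat.Properties
  open import Data.Nat.Solver using (module +-*-Solver)
  open +-*-Solver using (solve; _:=_; _:+_; _:*_; con)
  import Data.Rational as ℚ
  open import Data.Integer using (+_)

  open Equivalence using (to; from)

  mean-≡ : {A : Set} (f : A → ℕ) (xs : List A) {l : ℕ} → length xs ≡ suc l → mean f xs ≡ + sum (map f xs) ℚ./ suc l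
  mean-≡ f (x ∷ xs) refl = refl

  -- By `cat-!` a vanishing Catalan number would make a factorial vanish. This puts the denominators
  -- of the means into the form suc l.
  cat≢0 : ∀ n → ∃ λ l → cat n * cat n ≡ suc l
  cat≢0 n with cat n in e
  ... | suc c = _ , refl
  ... | zero  with trans (sym (cat-! n)) (cong (_* (n ! * suc n !)) e) | 1≤n! (dbl n)
  ...   | z | le with subst (1 ≤_) z le
  ...     | ()

  length≡∑ : {A : Set} (xs : List A) → length xs ≡ ∑ xs (λ _ → 1)
  length≡∑ xs = sym (trans (∑-const xs 1) (*-identityʳ _))

  length-cartesian : {A : Set} (xs : List A) → length (cartesianProduct xs xs) ≡ length xs * length xs
  length-cartesian xs = trans (length≡∑ (cartesianProduct xs xs)) (trans (∑-cartesian xs xs λ _ _ → 1)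
    (trans (∑-const xs _) (cong (length xs *_) (sym (length≡∑ xs)))))

  ∑∑-NC : ∀ n (f : Blocks n → Blocks n → ℕ) → ∑ (cartesianProduct (NC n) (NC n)) (uncurry f) ≡ ∑∑ (words (dbl n)) λ v w → f ⟨ v ⟩ ⟨ w ⟩
  ∑∑-NC n f = trans (∑-cartesian (NC n) (NC n) f) (trans (∑-NC {n} λ π → ∑ (NC n) (f π)) (∑-cong (words (dbl n)) λ v _ → ∑-NC {n} (f ⟨ v ⟩)))

  length-NC : ∀ n → length (NC n) ≡ cat n
  length-NC n = trans (length≡∑ (NC n)) (trans (∑-NC {n} λ _ → 1) (sym (length≡∑ (words (dbl n)))))

  d′-≡ : ∀ n {l} → cat n * cat n ≡ suc l → d′ n ≡ + ∑∑ (words (dbl n)) (λ v w → d-H {n} ⟨ v ⟩ ⟨ w ⟩) ℚ./ suc l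
  d′-≡ n {l} e = trans
    (mean-≡ (uncurry d-H) (cartesianProduct (NC n) (NC n)) (trans (length-cartesian (NC n)) (trans (cong₂ _*_ (length-NC n) (length-NC n)) e)))
    (cong (λ s → + s ℚ./ suc l) (∑∑-NC n d-H))

  module _ {m : ℕ} where

    ∑∑-NCMatchings : (f : Blocks m → Blocks m → ℕ) →
      ∑ (cartesianProduct (NCMatchings m) (NCMatchings m)) (uncurry f) ≡ ∑∑ (words m) λ v w → f ⟪ v ⟫ ⟪ w ⟫
    ∑∑-NCMatchings f = trans (∑-cartesian (NCMatchings m) (NCMatchings m) f)
      (trans (∑-NCMatchings {m} λ π → ∑ (NCMatchings m) (f π)) (∑-cong (words m) λ v _ → ∑-NCMatchings {m} (f ⟪ v ⟫)))

    length-NCMatchings : length (NCMatchings m) ≡ length (words m)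
    length-NCMatchings = trans (length≡∑ (NCMatchings m)) (trans (∑-NCMatchings {m} λ _ → 1) (sym (length≡∑ (words m))))

    matching-NC : ∀ {π} → π List.∈ NCMatchings m → IsNC π
    matching-NC π∈ = ∈NC⁻ (proj₁ (List.∈-filter⁻ isMatching? {xs = NC m} π∈))

  #curves≡#∨ : ∀ n {σ τ} → IsNC σ → IsNC τ → #curves n (σ , τ) ≡ #∨ σ τ
  #curves≡#∨ n {σ} {τ} nσ nτ = #components≡κ (arc? n (σ , τ)) (edges σ ++ edges τ)
    (λ { (inj₁ p) → inj₁ (IsNC.~-sym nσ p) ; (inj₂ p) → inj₂ (IsNC.~-sym nτ p) })
    (mk⇔ (λ { (inj₁ p) → List.∈-++⁺ˡ (from (∈-edges σ) p) ; (inj₂ p) → List.∈-++⁺ʳ (edges σ) (from (∈-edges τ) p) })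
         (λ p → back (List.∈-++⁻ (edges σ) p)))
    where
    open import Data.List using (_++_)
    open import Data.Sum using (_⊎_)
    back : ∀ {u v} → (u , v) List.∈ edges σ ⊎ (u , v) List.∈ edges τ → Arc n (σ , τ) u v
    back (inj₁ p) = inj₁ (to (∈-edges σ) p)
    back (inj₂ p) = inj₂ (to (∈-edges τ) p)

  c′-≡ : ∀ n {l} → cat n * cat n ≡ suc l →
         c′ n ≡ + ∑∑ (words (dbl n)) (λ v w → #∨ (⟪_⟫ {dbl n} v) ⟪ w ⟫) ℚ./ suc l
  c′-≡ n {l} e = trans
    (mean-≡ (#curves n) (meandricSystems n) (trans (length-cartesian (NCMatchings (2 * n)))
      (trans (cong₂ _*_ (length-NCMatchings {2 * n}) (length-NCMatchings {2 * n})) (trans (cong (λ m → length (words m) * length (words m)) 2*n) e))))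
    (cong (λ s → + s ℚ./ suc l) (trans (∑-cong (meandricSystems n) same)
      (trans (∑∑-NCMatchings {2 * n} #∨) (cong (λ m → ∑∑ (words m) λ v w → #∨ (⟪_⟫ {m} v) ⟪ w ⟫) 2*n))))
    where
    2*n : 2 * n ≡ dbl n
    2*n = trans (cong (_+_ n) (+-identityʳ n)) (sym (dbl≡+ n))
    same : ∀ M → M List.∈ meandricSystems n → #curves n M ≡ uncurry #∨ M
    same (σ , τ) M∈ = let σ∈ , τ∈ = List.∈-cartesianProduct⁻ (NCMatchings (2 * n)) (NCMatchings (2 * n)) M∈ in
      #curves≡#∨ n (matching-NC σ∈) (matching-NC τ∈)

  module _ {n K L : ℕ} (K≤n : K ≤ n) (large : 4200 * K ≤ n) where
    private
      r = n ∸ K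
      split-n : n * L ≡ r * L + K * L
      split-n = trans (cong (_* L) (sym (m∸n+n≡m K≤n))) (*-distribʳ-+ L r K)
      small : 4200 * (K * L) ≤ n * L
      small = ≤-trans (≤-reflexive (sym (*-assoc 4200 K L))) (*-monoˡ-≤ L large)
    open ≤-Reasoning

    -- In units of 1/24700, twice 21/247 is 4200 and 0.17 is 4199. The K points without room for a
    -- factor may therefore be lost as soon as 4200 (n - K) ≥ 4199 n, that is, 4200 K ≤ n.
    upper-numeric : ∀ {T} → 247 * T + 2 * (r * (21 * L)) ≤ 247 * (n * L) → 100 * T ≤ 83 * n * L
    upper-numeric {T} h = *-cancelˡ-≤ 247 (+-cancelʳ-≤ (4200 * (n * L)) _ _ (begin
      247 * (100 * T) + 4200 * (n * L)
        ≡⟨ cong (λ x → 247 * (100 * T) + 4200 * x) split-n ⟩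
      247 * (100 * T) + 4200 * (r * L + K * L)
        ≡⟨ solve 4 (λ t r k l → con 247 :* (con 100 :* t) :+ con 4200 :* (r :* l :+ k :* l) :=
             con 100 :* (con 247 :* t :+ con 2 :* (r :* (con 21 :* l))) :+ con 4200 :* (k :* l)) refl T r K L ⟩
      100 * (247 * T + 2 * (r * (21 * L))) + 4200 * (K * L)
        ≤⟨ +-mono-≤ (*-monoʳ-≤ 100 h) small ⟩
      100 * (247 * (n * L)) + n * L
        ≡⟨ solve 2 (λ n l → con 100 :* (con 247 :* (n :* l)) :+ n :* l := con 247 :* (con 83 :* n :* l) :+ con 4200 :* (n :* l)) refl n L ⟩
      247 * (83 * n * L) + 4200 * (n * L) ∎))

    lower-numeric : ∀ {T} → dbl r * (21 * L) ≤ 247 * T → 17 * n * L ≤ 100 * T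
    lower-numeric {T} h = *-cancelˡ-≤ 247 (+-cancelʳ-≤ (n * L) _ _ (begin
      247 * (17 * n * L) + n * L
        ≡⟨ solve 2 (λ n l → con 247 :* (con 17 :* n :* l) :+ n :* l := con 4200 :* (n :* l)) refl n L ⟩
      4200 * (n * L)
        ≡⟨ cong (4200 *_) split-n ⟩
      4200 * (r * L + K * L)
        ≡⟨ solve 3 (λ r k l → con 4200 :* (r :* l :+ k :* l) := con 100 :* ((r :+ r) :* (con 21 :* l)) :+ con 4200 :* (k :* l)) refl r K L ⟩
      100 * ((r + r) * (21 * L)) + 4200 * (K * L)
        ≤⟨ +-mono-≤ (*-monoʳ-≤ 100 (subst (λ d → d * (21 * L) ≤ 247 * T) (dbl≡+ r) h)) small ⟩
      100 * (247 * T) + n * L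
        ≡⟨ cong (_+ n * L) (solve 1 (λ t → con 100 :* (con 247 :* t) := con 247 :* (con 100 :* t)) refl T) ⟩
      247 * (100 * T) + n * L ∎))

-- Inequalities between fractions.

module Fractions where

  open import Data.Integer as ℤ using (+_; +[1+_])
  import Data.Integer.Properties as ℤ
  open import Data.Nat as ℕ using (ℕ; suc)
  import Data.Nat.Properties as ℕ
  open import Data.Rational
  open import Data.Rational.Properties
  open import Data.Rational.Unnormalised as ℚᵘ using (mkℚᵘ; *≤*; *≡*)
  import Data.Rational.Unnormalised.Properties as ℚᵘ

  frac-≤ : ∀ {a b c d} → a ℕ.* suc d ℕ.≤ c ℕ.* suc b → + a / suc b ≤ + c / suc d
  frac-≤ {a} {b} {c} {d} h = toℚᵘ-cancel-≤ (ℚᵘ.≤-respˡ-≃ (ℚᵘ.≃-sym (toℚᵘ-fromℚᵘ (mkℚᵘ (+ a) b)))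
    (ℚᵘ.≤-respʳ-≃ (ℚᵘ.≃-sym (toℚᵘ-fromℚᵘ (mkℚᵘ (+ c) d)))
      (*≤* (subst₂ ℤ._≤_ (ℤ.pos-* a (suc d)) (ℤ.pos-* c (suc b)) (ℤ.+≤+ h)))))

  fromℚᵘ-homo-* : ∀ p q → fromℚᵘ p * fromℚᵘ q ≡ fromℚᵘ (p ℚᵘ.* q)
  fromℚᵘ-homo-* p q = toℚᵘ-injective (ℚᵘ.≃-trans (toℚᵘ-homo-* (fromℚᵘ p) (fromℚᵘ q))
    (ℚᵘ.≃-trans (ℚᵘ.*-cong (toℚᵘ-fromℚᵘ p) (toℚᵘ-fromℚᵘ q)) (ℚᵘ.≃-sym (toℚᵘ-fromℚᵘ (p ℚᵘ.* q)))))

  fromℚᵘ-homo-+ : ∀ p q → fromℚᵘ p + fromℚᵘ q ≡ fromℚᵘ (p ℚᵘ.+ q)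
  fromℚᵘ-homo-+ p q = toℚᵘ-injective (ℚᵘ.≃-trans (toℚᵘ-homo-+ (fromℚᵘ p) (fromℚᵘ q))
    (ℚᵘ.≃-trans (ℚᵘ.+-cong (toℚᵘ-fromℚᵘ p) (toℚᵘ-fromℚᵘ q)) (ℚᵘ.≃-sym (toℚᵘ-fromℚᵘ (p ℚᵘ.+ q)))))

  frac-* : ∀ a b n → (+ a / suc b) * (+ n / 1) ≡ + (a ℕ.* n) / suc b
  frac-* a b n = trans (fromℚᵘ-homo-* (mkℚᵘ (+ a) b) (mkℚᵘ (+ n) 0)) (fromℚᵘ-cong {mkℚᵘ (+ a) b ℚᵘ.* mkℚᵘ (+ n) 0} {mkℚᵘ (+ (a ℕ.* n)) b}
    (*≡* (cong₂ ℤ._*_ (sym (ℤ.pos-* a n)) (cong +_ (sym (ℕ.*-identityʳ (suc b)))))))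

  half-suc : ∀ n → ½ * (+ suc n / 1) ≡ + n / 2 + ½
  half-suc n = trans (frac-* 1 1 (suc n)) (sym (trans (fromℚᵘ-homo-+ (mkℚᵘ (+ n) 1) (mkℚᵘ (+ 1) 1))
    (fromℚᵘ-cong {mkℚᵘ (+ n) 1 ℚᵘ.+ mkℚᵘ (+ 1) 1} {mkℚᵘ (+ (1 ℕ.* suc n)) 1}
      (*≡* (trans (cong (λ z → z ℤ.* + 2) (cong₂ ℤ._+_ (sym (ℤ.pos-* n 2)) refl)) 
        (trans (sym (ℤ.pos-* (n ℕ.* 2 ℕ.+ 2) 2)) (trans (cong +_ (solve 1 (λ n → (n :* con 2 :+ con 2) :* con 2 := con 1 :* (con 1 :+ n) :* con 4) refl n))
          (ℤ.pos-* (1 ℕ.* suc n) 4))))))))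
    where
    open import Data.Nat.Solver using (module +-*-Solver)
    open +-*-Solver

  half-suc′ : ∀ n → + suc n / 2 ≡ ½ * (+ n / 1) + ½
  half-suc′ n = sym (trans (cong (_+ ½) (frac-* 1 1 n)) (trans (fromℚᵘ-homo-+ (mkℚᵘ (+ (1 ℕ.* n)) 1) (mkℚᵘ (+ 1) 1))
    (fromℚᵘ-cong {mkℚᵘ (+ (1 ℕ.* n)) 1 ℚᵘ.+ mkℚᵘ (+ 1) 1} {mkℚᵘ (+ suc n) 1}
      (*≡* (trans (cong (λ z → z ℤ.* + 2) (cong₂ ℤ._+_ (sym (ℤ.pos-* (1 ℕ.* n) 2)) refl))
        (trans (sym (ℤ.pos-* (1 ℕ.* n ℕ.* 2 ℕ.+ 2) 2)) (trans (cong +_ (solve 1 (λ n → (con 1 :* n :* con 2 :+ con 2) :* con 2 := (con 1 :+ n) :* con 4) refl n))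
          (ℤ.pos-* (suc n) 4))))))))
    where
    open import Data.Nat.Solver using (module +-*-Solver)
    open +-*-Solver

  -- For ε = (k + 1) / (d + 1) every n ≥ d + 1 gives ε n ≥ 1. The target ½ is the deviation of (n -
  -- 1) / 2 and (n + 1) / 2 from n / 2.
  archimedean : ∀ ε → 0ℚ < ε → ∃ λ N → ∀ n → N ℕ.≤ n → ½ ≤ ε * (+ n / 1)
  archimedean ε 0<ε = go ε {{positive 0<ε}}
    where
    go : ∀ ε → {{_ : Positive ε}} → ∃ λ N → ∀ n → N ℕ.≤ n → ½ ≤ ε * (+ n / 1)
    go ε@(mkℚ +[1+ k ] d _) = suc d , λ n d<n → subst (½ ≤_)
      (trans (sym (frac-* (suc k) d n)) (cong (_* (+ n / 1)) (fromℚᵘ-toℚᵘ ε)))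
      (frac-≤ {1} {1} {suc k ℕ.* n} {d} (ℕ.≤-trans (ℕ.≤-trans (ℕ.≤-reflexive (ℕ.*-identityˡ (suc d))) d<n)
        (ℕ.≤-trans (ℕ.m≤m+n n (k ℕ.* n)) (ℕ.m≤m*n (suc k ℕ.* n) 2))))

  below-half : ∀ ε n {q} → ½ ≤ ε * (+ suc n / 1) → + n / 2 ≤ q → (½ - ε) * (+ suc n / 1) ≤ q
  below-half ε n {q} ε≥ h = ≤-trans (≤-reflexive (trans (*-distribʳ-+ x ½ (- ε)) (cong (λ z → ½ * x + z) (sym (neg-distribˡ-* ε x)))))
    (≤-trans (+-monoʳ-≤ (½ * x) (neg-antimono-≤ ε≥))
      (≤-trans (≤-reflexive (trans (cong (_- ½) (half-suc n)) (trans (+-assoc (+ n / 2) ½ (- ½)) (+-identityʳ (+ n / 2))))) h))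
    where x = + suc n / 1

  above-half : ∀ ε n {q} → ½ ≤ ε * (+ n / 1) → q ≤ + suc n / 2 → q ≤ (½ + ε) * (+ n / 1)
  above-half ε n {q} ε≥ h = ≤-trans h (≤-trans (≤-reflexive (half-suc′ n))
    (≤-trans (+-monoʳ-≤ (½ * x) ε≥) (≤-reflexive (sym (*-distribʳ-+ x ½ ε)))))
    where x = + n / 1

-- The four bounds for fixed n.

module Bounds where

  open Levels using (dbl)
  open DyckWords using (words)
  open Renewal using (cat; window; hits-window)
  open Totals
  open Means
  open Fractions
  open import Data.Integer using (+_)
  open import Data.Nat as ℕ using (ℕ; suc)
  import Data.Nat.Properties as ℕ
  open import Data.Rational
  open import Data.Rational.Properties

  fraction-≤-total : ∀ a b T {L l} → L ≡ suc l → a ℕ.* L ℕ.≤ suc b ℕ.* T → + a / suc b ≤ + T / suc l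
  fraction-≤-total a b T {l = l} refl h = frac-≤ {a} {b} {T} {l} (ℕ.≤-trans h (ℕ.≤-reflexive (ℕ.*-comm (suc b) T)))

  total-≤-fraction : ∀ a b T {L l} → L ≡ suc l → suc b ℕ.* T ℕ.≤ a ℕ.* L → + T / suc l ≤ + a / suc b
  total-≤-fraction a b T {l = l} refl h = frac-≤ {T} {l} {a} {b} (ℕ.≤-trans (ℕ.≤-reflexive (ℕ.*-comm T (suc b))) h)

  module _ (k : ℕ) where
    private
      n = suc k
      L = cat n ℕ.* cat n
      L≡ = proj₂ (cat≢0 n)
      distances = ∑∑ (words (dbl n)) (distance k)
      components = ∑∑ (words (dbl n)) (curves k)

    half-≤-d′ : + k / 2 ≤ d′ n
    half-≤-d′ = ≤-trans (fraction-≤-total k 1 distances L≡ (distance-lower k)) (≤-reflexive (sym (d′-≡ n L≡)))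

    c′-≤-half : c′ n ≤ + suc n / 2
    c′-≤-half = ≤-trans (≤-reflexive (c′-≡ n L≡)) (total-≤-fraction (suc n) 1 components L≡ (curves-upper k))

    module _ (large : 4200 ℕ.* window ℕ.≤ n) where
      private
        window≤n : window ℕ.≤ n
        window≤n = ℕ.≤-trans (ℕ.m≤n*m window 4200) large

      d′-≤ : d′ n ≤ (+ 83 / 100) * (+ n / 1)
      d′-≤ = ≤-trans (≤-reflexive (d′-≡ n L≡)) (≤-trans
        (total-≤-fraction (83 ℕ.* n) 99 distances L≡ (upper-numeric {n} {window} {L} window≤n large {distances}
          (distance-upper k 21 247 window window≤n λ p → hits-window n p window≤n)))
        (≤-reflexive (sym (frac-* 83 99 n))))

      ≤-c′ : (+ 17 / 100) * (+ n / 1) ≤ c′ n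
      ≤-c′ = ≤-trans (≤-reflexive (frac-* 17 99 n)) (≤-trans
        (fraction-≤-total (17 ℕ.* n) 99 components L≡ (lower-numeric {n} {window} {L} window≤n large {components}
          (curves-lower k 21 247 window window≤n λ p → hits-window n p window≤n)))
        (≤-reflexive (sym (c′-≡ n L≡))))

open import Data.Integer using (+_)
open import Data.Nat as ℕ using (ℕ)
open import Data.Rational using (ℚ; 0ℚ; ½; _/_; _+_; _-_; _*_; _≤_; _<_)
import Data.Nat.Properties as ℕ
open Renewal using (window)
open Fractions using (archimedean; below-half; above-half)
open Bounds

corollary1p5 : (∀ (ε : ℚ) → 0ℚ < ε → ∃[ N ] (∀ (n : ℕ) → N ℕ.≤ n →
    ((½ - ε) * (+ n / 1) ≤ d′ n) ×
    (d′ n ≤ (+ 83 / 100) * (+ n / 1)))) ×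
    (∀ (ε : ℚ) → 0ℚ < ε → ∃[ N ] (∀ (n : ℕ) → N ℕ.≤ n →
    ((+ 17 / 100) * (+ n / 1) ≤ c′ n) ×
    (c′ n ≤ (½ + ε) * (+ n / 1))))
corollary1p5 = distances , components
  where
  threshold : ℕ → ℕ
  -- The `suc` excludes n = 0, so that n - 1 is available as k; the second summand leaves the
  -- numerical margin for the last `window` points.
  threshold N = ℕ.suc N ℕ.+ 4200 ℕ.* window

  distances : ∀ ε → 0ℚ < ε → ∃[ N ] (∀ n → N ℕ.≤ n →
    ((½ - ε) * (+ n / 1) ≤ d′ n) × (d′ n ≤ (+ 83 / 100) * (+ n / 1)))
  distances ε 0<ε = let N , small = archimedean ε 0<ε in threshold N , λ where
    (ℕ.suc k) N≤n → below-half ε k (small (ℕ.suc k) (ℕ.m+n≤o⇒m≤o N (ℕ.<⇒≤ N≤n))) (half-≤-d′ k) ,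
                    d′-≤ k (ℕ.m+n≤o⇒n≤o (ℕ.suc N) N≤n)

  components : ∀ ε → 0ℚ < ε → ∃[ N ] (∀ n → N ℕ.≤ n →
    ((+ 17 / 100) * (+ n / 1) ≤ c′ n) × (c′ n ≤ (½ + ε) * (+ n / 1)))
  components ε 0<ε = let N , small = archimedean ε 0<ε in threshold N , λ where
    (ℕ.suc k) N≤n → ≤-c′ k (ℕ.m+n≤o⇒n≤o (ℕ.suc N) N≤n) ,
                    above-half ε (ℕ.suc k) (small (ℕ.suc k) (ℕ.m+n≤o⇒m≤o N (ℕ.<⇒≤ N≤n))) (c′-≤-half k)
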